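{- Let $K$ be the quotient field of a principal ideal domain $\mathcal{O}_K$, let $L/K$ be a finite Galois extension with Galois group $G=J\rtimes G'$ ($J$ normal in $G$), put $E=L^{G'}$ and $F=L^J$, and let $\mathcal{O}_L,\mathcal{O}_E,\mathcal{O}_F$ be the integral closures of $\mathcal{O}_K$ in $L,E,F$. Let $L/K$ be equipped with an induced Hopf Galois structure, with Hopf algebra $H=H_1\otimes_K\overline H$, where $H_1$ and $\overline H$ are the Hopf algebras of the corresponding Hopf Galois structures of $E/K$ and $F/K$. If $E/K$ and $F/K$ are arithmetically disjoint, then: 1. $\mathfrak{A}_H=\mathfrak{A}_{H_1}\otimes_{\mathcal{O}_K}\mathfrak{A}_{\overline H}$. 2. If $\mathcal{O}_E$ is $\mathfrak{A}_{H_1}$-free and $\mathcal{O}_F$ is $\mathfrak{A}_{\overline H}$-free, then $\mathcal{O}_L$ is $\mathfrak{A}_H$-free. Moreover, if $\gamma$ is a free generator of $\mathcal{O}_E$ as $\mathfrak{A}_{H_1}$-module and $\delta$ is a free generator of $\mathcal{O}_F$ as $\mathfrak{A}_{\overline H}$-module, then $\gamma\delta$ is a free generator of $\mathcal{O}_L$ as $\mathfrak{A}_H$-module.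
   Context: Arithmetically disjoint: $E/K$ and $F/K$ are arithmetically disjoint if $\mathcal{O}_{EF}=\mathcal{O}_E\otimes_{\mathcal{O}_K}\mathcal{O}_F$, i.e. $E,F$ are linearly disjoint over $K$ and the canonical map $\mathcal{O}_E\otimes_{\mathcal{O}_K}\mathcal{O}_F\to\mathcal{O}_{EF}$ is an isomorphism (here $EF=L$). Associated order: if a $K$-Hopf algebra $A$ acts on a finite separable extension $M/K$ through a Hopf Galois structure, then $\mathfrak{A}_A=\{\alpha\in A\mid \alpha\cdot x\in\mathcal{O}_M\text{ for all }x\in\mathcal{O}_M\}$. Thus $\mathfrak{A}_H,\mathfrak{A}_{H_1},\mathfrak{A}_{\overline H}$ are the associated orders of $\mathcal{O}_L,\mathcal{O}_E,\mathcal{O}_F$ respectively. A free generator of $\mathcal{O}_M$ as $\mathfrak{A}_A$-module is $\beta\in\mathcal{O}_M$ such that $\mathfrak{A}_A\to\mathcal{O}_M$, $a\mapsto a\cdot\beta$, is bijective; freeness means that such a generator exists. Induced Hopf Galois structures. Let $\lambda':G'\to\mathrm{Perm}(G')$ and $\lambda:G\to\mathrm{Perm}(G)$ be the left regular representations, and $\lambda_c:G\to\mathrm{Perm}(J)$, $\lambda_c(\sigma\tau)(\sigma')=\sigma\tau\sigma'\tau^{ -1}$ for $\sigma,\sigma'\in J$, $\tau\in G'$. A subgroup of $\mathrm{Perm}(Y)$ is regular if it acts simply transitively on $Y$. Let $N_1\le\mathrm{Perm}(J)$ be regular and normalized by $\lambda_c(G)$, and $N_2\le\mathrm{Perm}(G')$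 regular and normalized by $\lambda'(G')$. Then: - $H_1=L[N_1]^G$ ($G$ acting on $L$ by the Galois action and on $N_1$ by conjugation via $\lambda_c$) acts on $E$ by $(\sum_i c_in_i)\cdot x=\sum_i c_in_i^{ -1}(1_J)(x)$, giving a Hopf Galois structure of $E/K$; - $\overline H=F[N_2]^{G/J}$ (with $G/J\cong G'$ acting on $F$ by the Galois action and on $N_2$ by conjugation via $\lambda'$) acts on $F$ by $(\sum_j d_jm_j)\cdot z=\sum_j d_jm_j^{ -1}(1_{G'})(z)$, giving a Hopf Galois structure of $F/K$ (the one corresponding to the structure $L[N_2]^{G'}$ of $L/E$); - with $\iota(\varphi,\psi)(\sigma\tau)=\varphi(\sigma)\psi(\tau)$, the group $N=\iota(N_1\times N_2)\le\mathrm{Perm}(G)$ is regular and normalized by $\lambda(G)$. The induced Hopf Galois structure of $L/K$ has Hopf algebra $H=L[N]^G$ ($G$ acting on $N$ by conjugation via $\lambda$) with action $(\sum_k c_kn_k)\cdot x=\sum_k c_kn_k^{ -1}(1_G)(x)$ on $L$. One has $H=H_1\otimes_K\overline H$ via $(\sum_i c_in_i)\otimes(\sum_j d_jm_j)\mapsto\sum_{i,j}c_id_j\,\iota(n_i,m_j)$, and $\mathfrak{A}_{H_1}\otimes_{\mathcal{O}_K}\mathfrak{A}_{\overline H}$ is regarded inside $H$ through this identification. -}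

module Defs where

open import Level using (Level; suc)
open import Algebra.Bundles using (CommutativeRing; Group; Semiring)
open import Algebra.Apartness.Bundles using (HeytingField; HeytingCommutativeRing)
open import Algebra.Module.Bundles using (LeftModule)
open import Algebra.Morphism.Structures using (module RingMorphisms)
import Algebra.Definitions.RawSemiring as Power
import Algebra.Properties.CommutativeMonoid.Sum as Sum
import Algebra.Properties.Group as GroupProperties
open import Data.Fin.Base using (Fin; toℕ)
open import Data.List.Base using (List; []; _∷_; [_]; _++_; foldr; map)
open import Data.Nat.Base using (ℕ)
open import Data.Product using (∃!)
open import Data.Product.Base
  using (Σ; ∃; ∃₂; _×_; _,_; proj₁; proj₂)
open import Data.Sum.Base using (_⊎_)
open import Data.Unit.Polymorphic.Base using (⊤)
open import Data.Vec.Functional using (Vector)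
open import Function.Base using (_∘_)
open import Function.Bundles using (Func; Inverse; _⇔_)
import Function.Construct.Composition as Composition
import Function.Construct.Identity as Identity
import Function.Construct.Symmetry as Symmetry
open import Relation.Binary.Bundles using (Setoid)
import Relation.Binary.Construct.On as On
import Relation.Binary.PropositionalEquality.Properties as ≡
import Relation.Binary.Reasoning.Setoid as SetoidReasoning
open import Relation.Nullary.Negation using (¬_)
open import Relation.Unary using (Pred; _∈_; _∩_)

module _ {u : Level} where

  U : {A : Set u} → Pred A u
  U _ = ⊤

  Finite : Setoid u u → Set u
  Finite S = Σ ℕ λ n → Inverse (≡.setoid (Fin n)) S

  subsetoid : (S : Setoid u u) → Pred (Setoid.Carrier S) u → Setoid u u
  subsetoid S P = record
    { Carrier       = Σ (Setoid.Carrier S) P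
    ; _≈_           = λ x y → Setoid._≈_ S (proj₁ x) (proj₁ y)
    ; isEquivalence = On.isEquivalence proj₁ (Setoid.isEquivalence S)
    }

  BijectiveOn : (S T : Setoid u u) → Pred (Setoid.Carrier S) u →
                Pred (Setoid.Carrier T) u →
                (Setoid.Carrier S → Setoid.Carrier T) → Set u
  BijectiveOn S T P Q f =
      (∀ {x} → x ∈ P → f x ∈ Q)
    × (∀ {x y} → x ∈ P → y ∈ P → f x T.≈ f y → x S.≈ y)
    × (∀ {y} → y ∈ Q → ∃ λ x → x ∈ P × f x T.≈ y)
    where
    module S = Setoid S
    module T = Setoid T

module _ {u : Level} (R : CommutativeRing u u) where

  open CommutativeRing R

  record IsIdeal (I : Pred Carrier u) : Set u where
    field
      resp     : ∀ {x y} → x ≈ y → x ∈ I → y ∈ I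
      0∈       : 0# ∈ I
      +-closed : ∀ {x y} → x ∈ I → y ∈ I → x + y ∈ I
      *-closed : ∀ r {x} → x ∈ I → r * x ∈ I

  -- Ideals are arbitrary predicates, not only decidable ones.  Excluded
  -- middle for Set u is a consequence: apply principal to the ideal of all
  -- x with x ≈ 0# or P.
  record IsPrincipalIdealDomain : Set (suc u) where
    field
      1≉0       : ¬ 1# ≈ 0#
      domain    : ∀ {x y} → x * y ≈ 0# → x ≈ 0# ⊎ y ≈ 0#
      principal : ∀ (I : Pred Carrier u) → IsIdeal I →
                  ∃ λ a → ∀ x → x ∈ I ⇔ (∃ λ r → x ≈ r * a)

module _ {u : Level} (R S : CommutativeRing u u)
         (f : CommutativeRing.Carrier R → CommutativeRing.Carrier S) where

  private
    module R = CommutativeRing R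
    module S = CommutativeRing S
  open RingMorphisms R.rawRing S.rawRing

  IsQuotientField : Set u
  IsQuotientField = IsRingMonomorphism f
    × (∀ x → ∃₂ λ a b → ¬ b R.≈ R.0# × x S.* f b S.≈ f a)

  IsIntegral : Pred S.Carrier u
  IsIntegral x = ∃₂ λ n (a : Vector R.Carrier n) →
    x ^ n S.+ sum (λ i → f (a i) S.* (x ^ toℕ i)) S.≈ S.0#
    where
    open Power (Semiring.rawSemiring S.semiring) using (_^_)
    open Sum S.+-commutativeMonoid using (sum)

  restrictScalars : IsRingHomomorphism f → LeftModule R.ring u u
  restrictScalars f-hom = record
    { Carrierᴹ = S.Carrier
    ; _≈ᴹ_ = S._≈_
    ; _+ᴹ_ = S._+_
    ; _*ₗ_ = λ r x → f r S.* x
    ; 0ᴹ = S.0#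
    ; -ᴹ_ = S.-_
    ; isLeftModule = record
      { isLeftSemimodule = record
        { +ᴹ-isCommutativeMonoid = S.+-isCommutativeMonoid
        ; isPreleftSemimodule = record
          { *ₗ-cong = λ r≈s x≈y → S.*-cong (⟦⟧-cong r≈s) x≈y
          ; *ₗ-zeroˡ = λ x → S.trans (S.*-congʳ 0#-homo) (S.zeroˡ x)
          ; *ₗ-distribʳ = λ x r s → S.trans (S.*-congʳ (+-homo r s)) (S.distribʳ x (f r) (f s))
          ; *ₗ-identityˡ = λ x → S.trans (S.*-congʳ 1#-homo) (S.*-identityˡ x)
          ; *ₗ-assoc = λ r s x → S.trans (S.*-congʳ (*-homo r s)) (S.*-assoc (f r) (f s) x)
          ; *ₗ-zeroʳ = λ r → S.zeroʳ (f r)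
          ; *ₗ-distribˡ = λ r → S.distribˡ (f r)
          }
        }
      ; -ᴹ‿cong = S.-‿cong
      ; -ᴹ‿inverse = S.-‿inverse
      }
    }
    where open IsRingHomomorphism f-hom

module _ {u : Level} {R : CommutativeRing u u} where

  private
    module R = CommutativeRing R

  pointwise : Setoid u u → LeftModule R.ring u u → LeftModule R.ring u u
  pointwise X M = record
    { Carrierᴹ = Func X M.≈ᴹ-setoid
    ; _≈ᴹ_ = λ a b → ∀ x → Func.to a x M.≈ᴹ Func.to b x
    ; _+ᴹ_ = λ a b → record
        { to = λ x → Func.to a x M.+ᴹ Func.to b x
        ; cong = λ e → M.+ᴹ-cong (Func.cong a e) (Func.cong b e) }
    ; _*ₗ_ = λ r a → record
        { to = λ x → r M.*ₗ Func.to a x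
        ; cong = λ e → M.*ₗ-cong R.refl (Func.cong a e) }
    ; 0ᴹ = record { to = λ _ → M.0ᴹ ; cong = λ _ → M.≈ᴹ-refl }
    ; -ᴹ_ = λ a → record
        { to = λ x → M.-ᴹ Func.to a x
        ; cong = λ e → M.-ᴹ‿cong (Func.cong a e) }
    ; isLeftModule = record
      { isLeftSemimodule = record
        { +ᴹ-isCommutativeMonoid = record
          { isMonoid = record
            { isSemigroup = record
              { isMagma = record
                { isEquivalence = record
                  { refl = λ _ → M.≈ᴹ-refl
                  ; sym = λ p x → M.≈ᴹ-sym (p x)
                  ; trans = λ p q x → M.≈ᴹ-trans (p x) (q x)
                  }
                ; ∙-cong = λ p q x → M.+ᴹ-cong (p x) (q x)
                }
              ; assoc = λ a b c x → M.+ᴹ-assoc _ _ _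
              }
            ; identity = (λ a x → M.+ᴹ-identityˡ _) , (λ a x → M.+ᴹ-identityʳ _)
            }
          ; comm = λ a b x → M.+ᴹ-comm _ _
          }
        ; isPreleftSemimodule = record
          { *ₗ-cong = λ r≈s p x → M.*ₗ-cong r≈s (p x)
          ; *ₗ-zeroˡ = λ a x → M.*ₗ-zeroˡ _
          ; *ₗ-distribʳ = λ a r s x → M.*ₗ-distribʳ _ r s
          ; *ₗ-identityˡ = λ a x → M.*ₗ-identityˡ _
          ; *ₗ-assoc = λ r s a x → M.*ₗ-assoc r s _
          ; *ₗ-zeroʳ = λ r x → M.*ₗ-zeroʳ r
          ; *ₗ-distribˡ = λ r a b x → M.*ₗ-distribˡ r _ _
          }
        }
      ; -ᴹ‿cong = λ p x → M.-ᴹ‿cong (p x)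
      ; -ᴹ‿inverse = (λ a x → M.-ᴹ‿inverseˡ _) , (λ a x → M.-ᴹ‿inverseʳ _)
      }
    }
    where module M = LeftModule M

-- The tensor product over R of a submodule A of M and a submodule B of N.
-- A tensor is a formal sum of pairs (a , b), up to the congruence generated
-- by bilinearity and the module structures.  The sums and multiples in the
-- relations are those of M and N; closure of A and B under them is not an
-- argument, since each relation only speaks of elements lying in A and B.
module Tensor {u : Level} (R : CommutativeRing u u)
              (M N : LeftModule (CommutativeRing.ring R) u u)
              (A : Pred (LeftModule.Carrierᴹ M) u)
              (B : Pred (LeftModule.Carrierᴹ N) u) where

  private
    module R = CommutativeRing R
    module M = LeftModule M
    module N = LeftModule N

  FormalSum : Set u
  FormalSum = List (∃ A × ∃ B)

  infix 4 _~_
  data _~_ : FormalSum → FormalSum → Set u where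
    refl    : ∀ {s} → s ~ s
    sym     : ∀ {s t} → s ~ t → t ~ s
    trans   : ∀ {s t w} → s ~ t → t ~ w → s ~ w
    ++-cong : ∀ {s s′ t t′} → s ~ s′ → t ~ t′ → s ++ t ~ s′ ++ t′
    ++-comm : ∀ s t → s ++ t ~ t ++ s
    cong    : ∀ {a a′ : ∃ A} {b b′ : ∃ B} →
              proj₁ a M.≈ᴹ proj₁ a′ → proj₁ b N.≈ᴹ proj₁ b′ →
              [ a , b ] ~ [ a′ , b′ ]
    +ˡ      : ∀ {a₁ a₂ a : ∃ A} {b : ∃ B} →
              proj₁ a M.≈ᴹ proj₁ a₁ M.+ᴹ proj₁ a₂ →
              [ a , b ] ~ (a₁ , b) ∷ (a₂ , b) ∷ []
    +ʳ      : ∀ {a : ∃ A} {b₁ b₂ b : ∃ B} →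
              proj₁ b N.≈ᴹ proj₁ b₁ N.+ᴹ proj₁ b₂ →
              [ a , b ] ~ (a , b₁) ∷ (a , b₂) ∷ []
    0ˡ      : ∀ {a : ∃ A} {b : ∃ B} → proj₁ a M.≈ᴹ M.0ᴹ → [ a , b ] ~ []
    0ʳ      : ∀ {a : ∃ A} {b : ∃ B} → proj₁ b N.≈ᴹ N.0ᴹ → [ a , b ] ~ []
    balance : ∀ r {a ra : ∃ A} {b rb : ∃ B} →
              proj₁ ra M.≈ᴹ r M.*ₗ proj₁ a → proj₁ rb N.≈ᴹ r N.*ₗ proj₁ b →
              [ ra , b ] ~ [ a , rb ]

  tensor : Setoid u u
  tensor = record
    { Carrier       = FormalSum
    ; _≈_           = _~_
    ; isEquivalence = record { refl = refl ; sym = sym ; trans = trans }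
    }

  -- The additive map determined by a ⊗ b ↦ φ a b.
  extend : (T : LeftModule (CommutativeRing.ring R) u u) →
           (M.Carrierᴹ → N.Carrierᴹ → LeftModule.Carrierᴹ T) →
           FormalSum → LeftModule.Carrierᴹ T
  extend T φ = foldr T._+ᴹ_ T.0ᴹ ∘ map λ (a , b) → φ (proj₁ a) (proj₁ b)
    where module T = LeftModule T

module _ {u : Level} where

  record IsSubgroup (G : Group u u) (P : Pred (Group.Carrier G) u) : Set u where
    open Group G
    field
      resp      : ∀ {x y} → x ≈ y → x ∈ P → y ∈ P
      ε-closed  : ε ∈ P
      ∙-closed  : ∀ {x y} → x ∈ P → y ∈ P → x ∙ y ∈ P
      ⁻¹-closed : ∀ {x} → x ∈ P → x ⁻¹ ∈ P

  subgroup : {G : Group u u} {P : Pred (Group.Carrier G) u} → IsSubgroup G P → Group u u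
  subgroup {G} {P} isSubgroup = record
    { Carrier = Σ Carrier P
    ; _≈_ = λ x y → proj₁ x ≈ proj₁ y
    ; _∙_ = λ (x , p) (y , q) → x ∙ y , ∙-closed p q
    ; ε   = ε , ε-closed
    ; _⁻¹ = λ (x , p) → x ⁻¹ , ⁻¹-closed p
    ; isGroup = record
      { isMonoid = record
        { isSemigroup = record
          { isMagma = record
            { isEquivalence = On.isEquivalence proj₁ isEquivalence
            ; ∙-cong = ∙-cong
            }
          ; assoc = λ _ _ _ → assoc _ _ _
          }
        ; identity = (λ _ → identityˡ _) , (λ _ → identityʳ _)
        }
      ; inverse = (λ _ → inverseˡ _) , (λ _ → inverseʳ _)
      ; ⁻¹-cong = ⁻¹-cong
      }
    }
    where
    open Group G
    open IsSubgroup isSubgroup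

  Perm : Setoid u u → Group u u
  Perm Y = record
    { Carrier = Inverse Y Y
    ; _≈_ = λ f g → ∀ y → to f y ≈ to g y
    ; _∙_ = λ f g → Composition.inverse g f
    ; ε   = Identity.inverse Y
    ; _⁻¹ = Symmetry.inverse
    ; isGroup = record
      { isMonoid = record
        { isSemigroup = record
          { isMagma = record
            { isEquivalence = record
              { refl = λ _ → refl
              ; sym = λ p y → sym (p y)
              ; trans = λ p q y → trans (p y) (q y)
              }
            ; ∙-cong = λ {_} {f′} {g} {_} p q y → trans (p (to g y)) (to-cong f′ (q y))
            }
          ; assoc = λ _ _ _ _ → refl
          }
        ; identity = (λ _ _ → refl) , (λ _ _ → refl)
        }
      ; inverse = (λ f y → strictlyInverseʳ f y) , (λ f y → strictlyInverseˡ f y)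
      ; ⁻¹-cong = λ {f} {g} p y →
          trans (sym (strictlyInverseʳ g (from f y)))
                (from-cong g (trans (sym (p (from f y))) (strictlyInverseˡ f y)))
      }
    }
    where
    open Setoid Y
    open Inverse

  module _ {Y : Setoid u u} (N : Pred (Group.Carrier (Perm Y)) u) where

    private
      module P = Group (Perm Y)

    record IsRegularSubgroup : Set u where
      field
        isSubgroup        : IsSubgroup (Perm Y) N
        simplyTransitive  : ∀ x y → ∃! P._≈_ λ η → η ∈ N × Setoid._≈_ Y (Inverse.to η x) y

    NormalizedBy : {Γ : Set u} → (Γ → P.Carrier) → Set u
    NormalizedBy ρ = ∀ g {η} → η ∈ N → ρ g P.∙ η P.∙ ρ g P.⁻¹ ∈ N

    regular⇒finite : IsRegularSubgroup → Setoid.Carrier Y → Finite Y →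
                     Finite (subsetoid P.setoid N)
    regular⇒finite isRegular y₀ (n , enum) = n , Composition.inverse enum record
      { to = λ y → proj₁ (simplyTransitive y₀ y) , proj₁ (value y)
      ; from = λ (η , _) → to η y₀
      ; to-cong = λ {x} {y} x≈y →
          proj₂ (proj₂ (simplyTransitive y₀ x))
                (proj₁ (value y) , trans (proj₂ (value y)) (sym x≈y))
      ; from-cong = λ η≈θ → η≈θ y₀
      ; inverse =
          (λ { {η , η∈N} {y} y≈ →
             proj₂ (proj₂ (simplyTransitive y₀ y)) (η∈N , sym y≈) })
        , (λ { {y} {η , _} η≈ → trans (η≈ y₀) (proj₂ (value y)) })
      }
      where
      open Setoid Y
      open Inverse
      open IsRegularSubgroup isRegular
      value : ∀ y → _
      value y = proj₁ (proj₂ (simplyTransitive y₀ y))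

  module _ (G : Group u u) where

    open Group G
    open GroupProperties G

    leftMult : Carrier → Inverse setoid setoid
    leftMult g = record
      { to = g ∙_
      ; from = g ⁻¹ ∙_
      ; to-cong = ∙-congˡ
      ; from-cong = ∙-congˡ
      ; inverse = (λ {x} e → trans (∙-congˡ e) (\\-leftDividesˡ g x))
                , (λ {x} e → trans (∙-congˡ e) (\\-leftDividesʳ g x))
      }

    record IsSemidirect (J G′ : Pred Carrier u) : Set u where
      field
        J-isSubgroup  : IsSubgroup G J
        G′-isSubgroup : IsSubgroup G G′
        J-normal      : ∀ g {x} → x ∈ J → g ∙ x ∙ g ⁻¹ ∈ J
        factor        : ∀ g → ∃₂ λ σ τ → σ ∈ J × τ ∈ G′ × g ≈ σ ∙ τ
        trivial-∩     : ∀ {g} → g ∈ J → g ∈ G′ → g ≈ ε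

module Semidirect {u : Level} {G : Group u u} {J G′ : Pred (Group.Carrier G) u}
                  (isSemidirect : IsSemidirect G J G′) where

  open Group G
  open GroupProperties G
  open IsSemidirect isSemidirect
  open SetoidReasoning setoid

  Jᴳ G′ᴳ : Group u u
  Jᴳ  = subgroup J-isSubgroup
  G′ᴳ = subgroup G′-isSubgroup

  private
    module Jᴳ = Group Jᴳ
    module G′ᴳ = Group G′ᴳ
    module PJ = Group (Perm Jᴳ.setoid)
    module PG′ = Group (Perm G′ᴳ.setoid)
    module PG = Group (Perm setoid)

  -- The two factors of g = σ τ with σ in J and τ in G′.
  πJ : Carrier → Jᴳ.Carrier
  πJ g = let (σ , _ , σ∈J , _) = factor g in σ , σ∈J

  πG′ : Carrier → G′ᴳ.Carrier
  πG′ g = let (_ , τ , _ , τ∈G′ , _) = factor g in τ , τ∈G′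

  factor-≈ : ∀ g → g ≈ proj₁ (πJ g) ∙ proj₁ (πG′ g)
  factor-≈ g = let (_ , _ , _ , _ , e) = factor g in e

  factor-unique : ∀ (σ σ′ : Jᴳ.Carrier) (τ τ′ : G′ᴳ.Carrier) →
    proj₁ σ ∙ proj₁ τ ≈ proj₁ σ′ ∙ proj₁ τ′ → σ Jᴳ.≈ σ′ × τ G′ᴳ.≈ τ′
  factor-unique (σ , σ∈) (σ′ , σ′∈) (τ , τ∈) (τ′ , τ′∈) e = σ≈σ′ , τ≈τ′
    where
    module J′ = IsSubgroup J-isSubgroup
    module G″ = IsSubgroup G′-isSubgroup
    d : σ′ ⁻¹ ∙ σ ≈ τ′ ∙ τ ⁻¹
    d = begin
      σ′ ⁻¹ ∙ σ                     ≈⟨ //-rightDividesʳ τ _ ⟨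
      σ′ ⁻¹ ∙ σ ∙ τ ∙ τ ⁻¹          ≈⟨ ∙-congʳ (assoc _ _ _) ⟩
      σ′ ⁻¹ ∙ (σ ∙ τ) ∙ τ ⁻¹        ≈⟨ ∙-congʳ (∙-congˡ e) ⟩
      σ′ ⁻¹ ∙ (σ′ ∙ τ′) ∙ τ ⁻¹      ≈⟨ ∙-congʳ (\\-leftDividesʳ σ′ τ′) ⟩
      τ′ ∙ τ ⁻¹                     ∎
    d≈ε : σ′ ⁻¹ ∙ σ ≈ ε
    d≈ε = trivial-∩ (J′.∙-closed (J′.⁻¹-closed σ′∈) σ∈)
                    (G″.resp (sym d) (G″.∙-closed τ′∈ (G″.⁻¹-closed τ∈)))
    σ≈σ′ : σ ≈ σ′
    σ≈σ′ = trans (inverseʳ-unique (σ′ ⁻¹) σ d≈ε) (⁻¹-involutive σ′)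
    τ≈τ′ : τ ≈ τ′
    τ≈τ′ = sym (x∙y⁻¹≈ε⇒x≈y τ′ τ (trans (sym d) d≈ε))

  π-unique : ∀ {g} σ τ → g ≈ proj₁ σ ∙ proj₁ τ → πJ g Jᴳ.≈ σ × πG′ g G′ᴳ.≈ τ
  π-unique {g} σ τ e =
    factor-unique (πJ g) σ (πG′ g) τ (trans (sym (factor-≈ g)) e)

  π-cong : ∀ {g h} → g ≈ h → πJ g Jᴳ.≈ πJ h × πG′ g G′ᴳ.≈ πG′ h
  π-cong {g} {h} e = π-unique (πJ h) (πG′ h) (trans e (factor-≈ h))

  conjPerm : Carrier → PJ.Carrier
  conjPerm g = record
    { to = λ (x , p) → g ∙ x ∙ g ⁻¹ , J-normal g p
    ; from = λ (x , p) → g ⁻¹ ∙ x ∙ g ⁻¹ ⁻¹ , J-normal (g ⁻¹) p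
    ; to-cong = λ e → ∙-congʳ (∙-congˡ e)
    ; from-cong = λ e → ∙-congʳ (∙-congˡ e)
    ; inverse = (λ e → trans (∙-congʳ (∙-congˡ e)) (cancel g _))
              , (λ e → trans (∙-congʳ (∙-congˡ e)) (cancel′ g _))
    }
    where
    cancel′ : ∀ g x → g ⁻¹ ∙ (g ∙ x ∙ g ⁻¹) ∙ g ⁻¹ ⁻¹ ≈ x
    cancel′ g x = begin
      g ⁻¹ ∙ (g ∙ x ∙ g ⁻¹) ∙ g ⁻¹ ⁻¹   ≈⟨ ∙-congʳ (∙-congˡ (assoc _ _ _)) ⟩
      g ⁻¹ ∙ (g ∙ (x ∙ g ⁻¹)) ∙ g ⁻¹ ⁻¹ ≈⟨ ∙-congʳ (\\-leftDividesʳ g _) ⟩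
      x ∙ g ⁻¹ ∙ g ⁻¹ ⁻¹                ≈⟨ //-rightDividesʳ (g ⁻¹) x ⟩
      x                                 ∎
    cancel : ∀ g x → g ∙ (g ⁻¹ ∙ x ∙ g ⁻¹ ⁻¹) ∙ g ⁻¹ ≈ x
    cancel g x = begin
      g ∙ (g ⁻¹ ∙ x ∙ g ⁻¹ ⁻¹) ∙ g ⁻¹   ≈⟨ ∙-congʳ (∙-congˡ (assoc _ _ _)) ⟩
      g ∙ (g ⁻¹ ∙ (x ∙ g ⁻¹ ⁻¹)) ∙ g ⁻¹ ≈⟨ ∙-congʳ (\\-leftDividesˡ g _) ⟩
      x ∙ g ⁻¹ ⁻¹ ∙ g ⁻¹                ≈⟨ //-rightDividesˡ (g ⁻¹) x ⟩
      x                                 ∎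

  lam : Carrier → PG.Carrier
  lam = leftMult G

  lam′ : G′ᴳ.Carrier → PG′.Carrier
  lam′ = leftMult G′ᴳ

  -- (σ τ) acts on σ′ by σ′ ↦ σ τ σ′ τ⁻¹.
  lamᶜ : Carrier → PJ.Carrier
  lamᶜ g = leftMult Jᴳ (πJ g) PJ.∙ conjPerm (proj₁ (πG′ g))

  ι : PJ.Carrier → PG′.Carrier → PG.Carrier
  ι φ ψ = record
    { to = combine φ ψ
    ; from = combine (φ PJ.⁻¹) (ψ PG′.⁻¹)
    ; to-cong = combine-cong φ ψ
    ; from-cong = combine-cong (φ PJ.⁻¹) (ψ PG′.⁻¹)
    ; inverse =
        (λ e → trans (combine-cong φ ψ e) (cancel φ ψ (φ PJ.⁻¹) (ψ PG′.⁻¹)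
                 (strictlyInverseˡ φ) (strictlyInverseˡ ψ) _))
      , (λ e → trans (combine-cong (φ PJ.⁻¹) (ψ PG′.⁻¹) e)
                 (cancel (φ PJ.⁻¹) (ψ PG′.⁻¹) φ ψ
                 (strictlyInverseʳ φ) (strictlyInverseʳ ψ) _))
    }
    where
    open Inverse
    combine : PJ.Carrier → PG′.Carrier → Carrier → Carrier
    combine φ ψ g = proj₁ (to φ (πJ g)) ∙ proj₁ (to ψ (πG′ g))
    combine-cong : ∀ φ ψ {g h} → g ≈ h → combine φ ψ g ≈ combine φ ψ h
    combine-cong φ ψ e =
      ∙-cong (to-cong φ (proj₁ (π-cong e))) (to-cong ψ (proj₂ (π-cong e)))
    cancel : ∀ φ ψ φ⁻ ψ⁻ → (∀ x → to φ (to φ⁻ x) Jᴳ.≈ x) →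
             (∀ x → to ψ (to ψ⁻ x) G′ᴳ.≈ x) →
             ∀ g → combine φ ψ (combine φ⁻ ψ⁻ g) ≈ g
    cancel φ ψ φ⁻ ψ⁻ p q g = begin
      combine φ ψ (combine φ⁻ ψ⁻ g)
        ≈⟨ ∙-cong (to-cong φ (proj₁ split)) (to-cong ψ (proj₂ split)) ⟩
      proj₁ (to φ (to φ⁻ (πJ g))) ∙ proj₁ (to ψ (to ψ⁻ (πG′ g)))
        ≈⟨ ∙-cong (p (πJ g)) (q (πG′ g)) ⟩
      proj₁ (πJ g) ∙ proj₁ (πG′ g)
        ≈⟨ factor-≈ g ⟨
      g ∎
      where
      split = π-unique (to φ⁻ (πJ g)) (to ψ⁻ (πG′ g)) refl

  open Inverse using (to; to-cong)

  π-ι : ∀ φ ψ g → πJ (to (ι φ ψ) g) Jᴳ.≈ to φ (πJ g) × πG′ (to (ι φ ψ) g) G′ᴳ.≈ to ψ (πG′ g)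
  π-ι φ ψ g = π-unique (to φ (πJ g)) (to ψ (πG′ g)) refl

  ι-cong : ∀ {φ φ′ ψ ψ′} → φ PJ.≈ φ′ → ψ PG′.≈ ψ′ → ι φ ψ PG.≈ ι φ′ ψ′
  ι-cong p q g = ∙-cong (p (πJ g)) (q (πG′ g))

  ι-∙ : ∀ φ ψ φ′ ψ′ → ι φ ψ PG.∙ ι φ′ ψ′ PG.≈ ι (φ PJ.∙ φ′) (ψ PG′.∙ ψ′)
  ι-∙ φ ψ φ′ ψ′ g = let (p , q) = π-ι φ′ ψ′ g in ∙-cong (to-cong φ p) (to-cong ψ q)

  ι-injective : ∀ φ ψ φ′ ψ′ → ι φ ψ PG.≈ ι φ′ ψ′ → φ PJ.≈ φ′ × ψ PG′.≈ ψ′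
  ι-injective φ ψ φ′ ψ′ e = (λ x → proj₁ (at x G′ᴳ.ε)) , (λ y → proj₂ (at Jᴳ.ε y))
    where
    at : ∀ x y → to φ x Jᴳ.≈ to φ′ x × to ψ y G′ᴳ.≈ to ψ′ y
    at x y =
      let g         = proj₁ x ∙ proj₁ y
          (gx , gy) = π-unique {g} x y refl
          (p , q)   = π-ι φ ψ g
          (p′ , q′) = π-ι φ′ ψ′ g
          (r , s)   = π-cong (e g)
      in trans (sym (to-cong φ gx)) (trans (sym p) (trans r (trans p′ (to-cong φ′ gx))))
       , trans (sym (to-cong ψ gy)) (trans (sym q) (trans s (trans q′ (to-cong ψ′ gy))))

  lam≈ι : ∀ g → lam g PG.≈ ι (lamᶜ g) (lam′ (πG′ g))
  lam≈ι g h = begin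
    g ∙ h                                ≈⟨ ∙-cong (factor-≈ g) (factor-≈ h) ⟩
    (σ ∙ τ) ∙ (σ′ ∙ τ′)                  ≈⟨ assoc _ _ _ ⟩
    σ ∙ (τ ∙ (σ′ ∙ τ′))                  ≈⟨ ∙-congˡ (assoc _ _ _) ⟨
    σ ∙ (τ ∙ σ′ ∙ τ′)                    ≈⟨ ∙-congˡ (∙-congʳ (//-rightDividesˡ τ _)) ⟨
    σ ∙ (τ ∙ σ′ ∙ τ ⁻¹ ∙ τ ∙ τ′)         ≈⟨ ∙-congˡ (assoc _ _ _) ⟩
    σ ∙ (τ ∙ σ′ ∙ τ ⁻¹ ∙ (τ ∙ τ′))       ≈⟨ assoc _ _ _ ⟨
    σ ∙ (τ ∙ σ′ ∙ τ ⁻¹) ∙ (τ ∙ τ′)       ∎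
    where
    σ  = proj₁ (πJ g)
    τ  = proj₁ (πG′ g)
    σ′ = proj₁ (πJ h)
    τ′ = proj₁ (πG′ h)

  module _ (N₁ : Pred PJ.Carrier u) (N₂ : Pred PG′.Carrier u) where

    _ι×_ : Pred PG.Carrier u
    _ι×_ η = ∃₂ λ φ ψ → φ ∈ N₁ × ψ ∈ N₂ × η PG.≈ ι φ ψ

    ι×-regular : IsRegularSubgroup N₁ → IsRegularSubgroup N₂ → IsRegularSubgroup _ι×_
    ι×-regular reg₁ reg₂ = record
      { isSubgroup = record
        { resp = λ η≈θ (φ , ψ , p , q , e) →
            φ , ψ , p , q , λ g → trans (sym (η≈θ g)) (e g)
        ; ε-closed = PJ.ε , PG′.ε , N₁.ε-closed , N₂.ε-closed , factor-≈
        ; ∙-closed = λ {η} {θ} (φ , ψ , p , q , e) (φ′ , ψ′ , p′ , q′ , e′) →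
            φ PJ.∙ φ′ , ψ PG′.∙ ψ′ , N₁.∙-closed p p′ , N₂.∙-closed q q′ ,
            PG.trans {η PG.∙ θ} {ι φ ψ PG.∙ ι φ′ ψ′} {ι (φ PJ.∙ φ′) (ψ PG′.∙ ψ′)}
              (PG.∙-cong {η} {ι φ ψ} {θ} {ι φ′ ψ′} e e′) (ι-∙ φ ψ φ′ ψ′)
        ; ⁻¹-closed = λ {η} (φ , ψ , p , q , e) →
            φ PJ.⁻¹ , ψ PG′.⁻¹ , N₁.⁻¹-closed p , N₂.⁻¹-closed q ,
            PG.⁻¹-cong {η} {ι φ ψ} e
        }
      ; simplyTransitive = λ x y →
          let (φ , (φ∈ , φx≈) , φ!) = T₁ (πJ x) (πJ y)
              (ψ , (ψ∈ , ψx≈) , ψ!) = T₂ (πG′ x) (πG′ y)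
          in ι φ ψ
           , ( (φ , ψ , φ∈ , ψ∈ , PG.refl {ι φ ψ})
             , trans (∙-cong φx≈ ψx≈) (sym (factor-≈ y)) )
           , λ { {θ} ((φ′ , ψ′ , φ′∈ , ψ′∈ , e) , θx≈y) →
               let (p , q) = π-ι φ′ ψ′ x
                   (r , s) = π-cong (trans (sym (e x)) θx≈y)
               in PG.trans {ι φ ψ} {ι φ′ ψ′} {θ}
                    (ι-cong {φ} {φ′} {ψ} {ψ′}
                       (φ! (φ′∈ , trans (sym p) r)) (ψ! (ψ′∈ , trans (sym q) s)))
                    (PG.sym {θ} {ι φ′ ψ′} e) }
      }
      where
      open IsRegularSubgroup reg₁ renaming (isSubgroup to S₁; simplyTransitive to T₁)
      open IsRegularSubgroup reg₂ renaming (isSubgroup to S₂; simplyTransitive to T₂)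
      module N₁ = IsSubgroup S₁
      module N₂ = IsSubgroup S₂

    ι×-normalized : NormalizedBy N₁ lamᶜ → NormalizedBy N₂ lam′ → NormalizedBy _ι×_ lam
    ι×-normalized norm₁ norm₂ g {η} (φ , ψ , φ∈ , ψ∈ , e) =
      α PJ.∙ φ PJ.∙ α PJ.⁻¹ , β PG′.∙ ψ PG′.∙ β PG′.⁻¹ ,
      norm₁ g φ∈ , norm₂ (πG′ g) ψ∈ , λ h → begin
        to (lam g PG.∙ η PG.∙ lam g PG.⁻¹) h
          ≈⟨ PG.∙-cong {lam g PG.∙ η} {ι α β PG.∙ ι φ ψ} {lam g PG.⁻¹} {ι α β PG.⁻¹}
               (PG.∙-cong {lam g} {ι α β} {η} {ι φ ψ} (lam≈ι g) e)
               (PG.⁻¹-cong {lam g} {ι α β} (lam≈ι g)) h ⟩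
        to (ι α β PG.∙ ι φ ψ PG.∙ ι α β PG.⁻¹) h
          ≈⟨ ι-∙ α β φ ψ (to (ι (α PJ.⁻¹) (β PG′.⁻¹)) h) ⟩
        to (ι (α PJ.∙ φ) (β PG′.∙ ψ) PG.∙ ι (α PJ.⁻¹) (β PG′.⁻¹)) h
          ≈⟨ ι-∙ (α PJ.∙ φ) (β PG′.∙ ψ) (α PJ.⁻¹) (β PG′.⁻¹) h ⟩
        to (ι (α PJ.∙ φ PJ.∙ α PJ.⁻¹) (β PG′.∙ ψ PG′.∙ β PG′.⁻¹)) h ∎
      where
      α = lamᶜ g
      β = lam′ (πG′ g)

module _ {u : Level} where

  toCommutativeRing : HeytingField u u u → CommutativeRing u u
  toCommutativeRing = HeytingCommutativeRing.commutativeRing ∘ HeytingField.heytingCommutativeRing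

module _ {u : Level} (K L : CommutativeRing u u)
         (j : CommutativeRing.Carrier K → CommutativeRing.Carrier L) where

  private
    module K = CommutativeRing K
    module L = CommutativeRing L
  open RingMorphisms L.rawRing L.rawRing

  IsFiniteExtension : Set u
  IsFiniteExtension = ∃₂ λ n (v : Vector L.Carrier n) →
    ∀ x → ∃ λ (a : Vector K.Carrier n) → x L.≈ sum (λ i → j (a i) L.* v i)
    where open Sum L.+-commutativeMonoid using (sum)

  IsAutomorphismOver : (L.Carrier → L.Carrier) → Set u
  IsAutomorphismOver f = IsRingIsomorphism f × (∀ k → f (j k) L.≈ j k)

  -- L/K is finite with K the fixed field of Aut(L/K), and _•_ identifies G
  -- with Aut(L/K).
  record IsGaloisWithGroup (G : Group u u)
           (_•_ : Group.Carrier G → L.Carrier → L.Carrier) : Set u where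
    private
      module G = Group G
    field
      finite       : IsFiniteExtension
      automorphism : ∀ g → IsAutomorphismOver (g •_)
      •-congʳ      : ∀ {g h} → g G.≈ h → ∀ x → (g • x) L.≈ (h • x)
      •-ε          : ∀ x → (G.ε • x) L.≈ x
      •-∙          : ∀ g h x → ((g G.∙ h) • x) L.≈ (g • (h • x))
      faithful     : ∀ {g h} → (∀ x → (g • x) L.≈ (h • x)) → g G.≈ h
      full         : ∀ f → IsAutomorphismOver f → ∃ λ g → ∀ x → f x L.≈ (g • x)
      fixedField   : ∀ x → (∀ g → (g • x) L.≈ x) → ∃ λ k → x L.≈ j k

-- The Hopf algebra is the part fixed by Γ of C[N], where C is a subset of L on
-- which Γ acts and N is a regular subgroup of Perm(X) normalized by the image
-- of Γ.  The elements of X act on the extension M through L.  For H₁ we take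
-- C = L, Γ = G, X = J and M = E; for H̄ we take C = F, Γ = X = G′ and M = F; for
-- H we take C = L, Γ = X = G and M = L.
module HopfGalois {u : Level} (L : CommutativeRing u u)
  (C : Pred (CommutativeRing.Carrier L) u)
  {Γ : Set u} (act : Γ → CommutativeRing.Carrier L → CommutativeRing.Carrier L)
  (X : Group u u) (X-finite : Finite (Group.setoid X))
  (eval : Group.Carrier X → CommutativeRing.Carrier L → CommutativeRing.Carrier L)
  (N : Pred (Group.Carrier (Perm (Group.setoid X))) u)
  (N-regular : IsRegularSubgroup N)
  (ρ : Γ → Group.Carrier (Perm (Group.setoid X))) (N-normalized : NormalizedBy N ρ)
  (𝒪ᴹ : Pred (CommutativeRing.Carrier L) u) where

  private
    module L = CommutativeRing L
    module X = Group X
    module P = Group (Perm X.setoid)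
  open Sum L.+-commutativeMonoid using (sum)
  open Inverse using (to)

  Nˢ : Setoid u u
  Nˢ = subsetoid P.setoid N

  -- An element Σ c(n) n of L[N], as its coefficient function n ↦ c(n).
  L[N] : Setoid u u
  L[N] = record
    { Carrier       = Func Nˢ L.setoid
    ; _≈_           = λ a b → ∀ η → Func.to a η L.≈ Func.to b η
    ; isEquivalence = record
      { refl  = λ _ → L.refl
      ; sym   = λ p η → L.sym (p η)
      ; trans = λ p q η → L.trans (p η) (q η)
      }
    }

  conj : Γ → Setoid.Carrier Nˢ → Setoid.Carrier Nˢ
  conj g (η , η∈N) = ρ g P.∙ η P.∙ ρ g P.⁻¹ , N-normalized g η∈N

  H : Pred (Setoid.Carrier L[N]) u
  H c = (∀ η → Func.to c η ∈ C)
      × (∀ g η → act g (Func.to c η) L.≈ Func.to c (conj g η))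

  -- (Σ c(n) n) · x = Σ c(n) n⁻¹(1)(x)
  infixr 8 _·_
  _·_ : Setoid.Carrier L[N] → L.Carrier → L.Carrier
  c · x = sum λ i →
    let (η , η∈N) = to (proj₂ N-finite) i in
    Func.to c (η , η∈N) L.* eval (to (η P.⁻¹) X.ε) x
    where N-finite = regular⇒finite N N-regular X.ε X-finite

  𝔄 : Pred (Setoid.Carrier L[N]) u
  𝔄 = H ∩ λ h → ∀ {x} → x ∈ 𝒪ᴹ → h · x ∈ 𝒪ᴹ

  IsFreeGenerator : Pred L.Carrier u
  IsFreeGenerator β = β ∈ 𝒪ᴹ × BijectiveOn L[N] L.setoid 𝔄 𝒪ᴹ (_· β)

  IsFree : Set u
  IsFree = ∃ IsFreeGenerator

record SemidirectGaloisExtension (u : Level) : Set (suc u) where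
  field
    𝒪ᴷ  : CommutativeRing u u
    K L : HeytingField u u u
    i   : CommutativeRing.Carrier 𝒪ᴷ → HeytingField.Carrier K
    j   : HeytingField.Carrier K → HeytingField.Carrier L
    isPID           : IsPrincipalIdealDomain 𝒪ᴷ
    isQuotientField : IsQuotientField 𝒪ᴷ (toCommutativeRing K) i
    j-hom           : RingMorphisms.IsRingHomomorphism
                        (CommutativeRing.rawRing (toCommutativeRing K))
                        (CommutativeRing.rawRing (toCommutativeRing L)) j

    G    : Group u u
    _•_  : Group.Carrier G → HeytingField.Carrier L → HeytingField.Carrier L
    J G′ : Pred (Group.Carrier G) u
    isGalois     : IsGaloisWithGroup (toCommutativeRing K) (toCommutativeRing L) j G _•_
    isSemidirect : IsSemidirect G J G′

    -- Finiteness of these groups follows from that of L/K; the enumerations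
    -- are needed to write down sums over the groups N.
    G-finite  : Finite (Group.setoid G)
    J-finite  : Finite (subsetoid (Group.setoid G) J)
    G′-finite : Finite (subsetoid (Group.setoid G) G′)

  Kᶜ Lᶜ : CommutativeRing u u
  Kᶜ = toCommutativeRing K
  Lᶜ = toCommutativeRing L

  module 𝒪ᴷ = CommutativeRing 𝒪ᴷ
  module K = CommutativeRing Kᶜ
  module L = CommutativeRing Lᶜ
  module G = Group G
  open Semidirect isSemidirect public

  𝒪ᴷ→L-hom : RingMorphisms.IsRingHomomorphism 𝒪ᴷ.rawRing L.rawRing (j ∘ i)
  𝒪ᴷ→L-hom = isRingHomomorphism L.trans
    (RingMorphisms.IsRingMonomorphism.isRingHomomorphism (proj₁ isQuotientField)) j-hom
    where open import Algebra.Morphism.Construct.Composition using (isRingHomomorphism)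

  E F : Pred L.Carrier u
  E x = ∀ {g} → g ∈ G′ → (g • x) L.≈ x
  F x = ∀ {g} → g ∈ J → (g • x) L.≈ x

  𝒪ᴸ 𝒪ᴱ 𝒪ᶠ : Pred L.Carrier u
  𝒪ᴸ = IsIntegral 𝒪ᴷ Lᶜ (j ∘ i)
  𝒪ᴱ = E ∩ 𝒪ᴸ
  𝒪ᶠ = F ∩ 𝒪ᴸ

  L/K : LeftModule K.ring u u
  L/K = restrictScalars Kᶜ Lᶜ j j-hom

  L/𝒪ᴷ : LeftModule 𝒪ᴷ.ring u u
  L/𝒪ᴷ = restrictScalars 𝒪ᴷ Lᶜ (j ∘ i) 𝒪ᴷ→L-hom

  module E⊗F = Tensor Kᶜ L/K L/K E F
  module 𝒪ᴱ⊗𝒪ᶠ = Tensor 𝒪ᴷ L/𝒪ᴷ L/𝒪ᴷ 𝒪ᴱ 𝒪ᶠ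

  LinearlyDisjoint : Set u
  LinearlyDisjoint = ∀ {s t} →
    E⊗F.extend L/K L._*_ s L.≈ E⊗F.extend L/K L._*_ t → s E⊗F.~ t

  ArithmeticallyDisjoint : Set u
  ArithmeticallyDisjoint =
    LinearlyDisjoint ×
    BijectiveOn 𝒪ᴱ⊗𝒪ᶠ.tensor L.setoid U 𝒪ᴸ (𝒪ᴱ⊗𝒪ᶠ.extend L/𝒪ᴷ L._*_)

record InducedHopfGaloisStructure {u : Level} (S : SemidirectGaloisExtension u) :
       Set (suc u) where
  open SemidirectGaloisExtension S
  field
    N₁ : Pred (Group.Carrier (Perm (Group.setoid Jᴳ))) u
    N₂ : Pred (Group.Carrier (Perm (Group.setoid G′ᴳ))) u
    N₁-regular    : IsRegularSubgroup N₁
    N₁-normalized : NormalizedBy N₁ lamᶜ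
    N₂-regular    : IsRegularSubgroup N₂
    N₂-normalized : NormalizedBy N₂ lam′

  N : Pred (Group.Carrier (Perm G.setoid)) u
  N = N₁ ι× N₂

  module H₁ = HopfGalois Lᶜ U _•_ Jᴳ J-finite (_•_ ∘ proj₁)
    N₁ N₁-regular lamᶜ N₁-normalized 𝒪ᴱ

  module H̄ = HopfGalois Lᶜ F (_•_ ∘ proj₁) G′ᴳ G′-finite (_•_ ∘ proj₁)
    N₂ N₂-regular lam′ N₂-normalized 𝒪ᶠ

  module H = HopfGalois Lᶜ U _•_ G G-finite _•_
    N (ι×-regular N₁ N₂ N₁-regular N₂-regular) lam
    (ι×-normalized N₁ N₂ N₁-normalized N₂-normalized) 𝒪ᴸ

  -- (Σ c(n) n) ⊗ (Σ d(m) m) ↦ Σ c(n) d(m) ι(n , m)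
  _⊠_ : Setoid.Carrier H₁.L[N] → Setoid.Carrier H̄.L[N] → Setoid.Carrier H.L[N]
  c ⊠ d = record
    { to   = λ (_ , φ , ψ , φ∈ , ψ∈ , _) → Func.to c (φ , φ∈) L.* Func.to d (ψ , ψ∈)
    ; cong = λ { {_ , φ , ψ , _ , _ , e} {_ , φ′ , ψ′ , _ , _ , e′} η≈η′ →
        let (φ≈φ′ , ψ≈ψ′) = ι-injective φ ψ φ′ ψ′
              (λ g → G.trans (G.sym (e g)) (G.trans (η≈η′ g) (e′ g)))
        in L.*-cong (Func.cong c φ≈φ′) (Func.cong d ψ≈ψ′) }
    }

  L[N₁] L[N₂] L[N] : LeftModule 𝒪ᴷ.ring u u
  L[N₁] = pointwise {R = 𝒪ᴷ} H₁.Nˢ L/𝒪ᴷ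
  L[N₂] = pointwise {R = 𝒪ᴷ} H̄.Nˢ L/𝒪ᴷ
  L[N]  = pointwise {R = 𝒪ᴷ} H.Nˢ L/𝒪ᴷ

  module 𝔄₁⊗𝔄̄ = Tensor 𝒪ᴷ L[N₁] L[N₂] H₁.𝔄 H̄.𝔄

  𝔄₁⊗𝔄̄→L[N] : 𝔄₁⊗𝔄̄.FormalSum → Setoid.Carrier H.L[N]
  𝔄₁⊗𝔄̄→L[N] = 𝔄₁⊗𝔄̄.extend L[N] _⊠_

{-# OPTIONS --safe #-}

-- As 𝒪ᴷ is a PID, 𝒪ᴸ and 𝔄₁ lie in finitely generated torsion-free modules,
-- so that 𝔄₁ and 𝒪ᶠ are free.  By Galois descent every h in H has a nonzero
-- 𝒪ᴷ-multiple r h in the image of 𝔄₁ ⊗ 𝔄̄.  An element s of 𝔄₁ ⊗ 𝔄̄ whose image maps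
-- 𝒪ᴸ = 𝒪ᴱ ⊗ 𝒪ᶠ into r 𝒪ᴸ is itself divisible by r: write s = Σ aᵢ ⊗ bᵢ with a
-- basis aᵢ of 𝔄₁, apply the coordinates of 𝒪ᶠ to the second factor, and use that
-- an element of 𝔄₁ (or 𝔄̄) mapping the ring of integers into its r-multiples is
-- divisible by r in 𝔄₁ (or 𝔄̄).  For r ≠ 0 this gives surjectivity onto 𝔄_H, for r = 0
-- injectivity.  Free generators γ and δ identify 𝔄₁ ⊗ 𝔄̄ with 𝒪ᴱ ⊗ 𝒪ᶠ = 𝒪ᴸ through
-- the action on γ δ.
module Submission where

open import Defs
open import Level using (Level)
open import Algebra.Apartness.Bundles using (HeytingField)
open import Algebra.Bundles using (CommutativeMonoid; CommutativeRing; Group)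
open import Algebra.Module.Bundles using (LeftModule)
open import Algebra.Morphism.Structures using (module RingMorphisms)
import Algebra.Properties.AbelianGroup as AbelianGroupProperties
import Algebra.Properties.CommutativeMonoid.Sum as Sum
import Algebra.Properties.CommutativeSemigroup as CommutativeSemigroupProperties
import Algebra.Properties.Group as GroupProperties
import Algebra.Properties.Ring as RingProperties
import Algebra.Properties.Semiring.Exp as Exp
import Algebra.Properties.Semiring.Sum as SemiringSum
open import Data.Fin.Base
  using (Fin; zero; suc; toℕ; fromℕ<; combine; remQuot; _↑ˡ_; _↑ʳ_)
open import Data.Fin.Properties using (_≟_; remQuot-combine; *↔×; toℕ-fromℕ<; toℕ<n)
open import Data.List.Base using ([]; _∷_; [_]; _++_; foldr; map)
open import Data.List.Properties using (++-assoc; ++-identityʳ)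
open import Data.Nat.Base as ℕ using (ℕ; zero; suc; _⊔_)
import Data.Nat.Properties as ℕ
open import Data.Product.Base using (∃; ∃₂; _×_; _,_; proj₁; proj₂)
open import Data.Product.Relation.Binary.Pointwise.NonDependent using (×-setoid)
open import Data.Sum.Base using (_⊎_; inj₁; inj₂; [_,_]′)
open import Data.Vec.Functional as Vector using (Vector; tail)
open import Function.Base using (_∘_; id)
open import Function.Bundles using (Func; Inverse; Equivalence)
import Function.Construct.Composition as Composition
import Function.Construct.Symmetry as Symmetry
open import Relation.Binary.Bundles using (Setoid)
open import Relation.Binary.PropositionalEquality.Core as ≡ using (_≡_)
import Relation.Binary.Reasoning.Setoid as SetoidReasoning
open import Relation.Nullary.Decidable.Core using (yes; no)
open import Relation.Nullary.Negation using (¬_; contradiction)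
open import Relation.Unary using (Pred; _∈_; _⊆_; _∩_)

-- The Hopf algebras are given only as fixed subsets of `L[N]`, without bases over `K`, and the
-- tensor products only as formal sums modulo `_~_`. In place of bases and discriminants stands a
-- family `𝐱`, `𝐲` in `L` for which the sum of `g(𝐱ₖ) h(𝐲ₖ)` is 1 if `g = h` and 0 otherwise. It
-- recovers the coefficients of an operator from its values, which yields faithfulness, the finitely
-- generated modules containing `𝒪ᴸ` and `𝔄₁`, an element of nonzero trace, and the descent for `H`.
-- All three actions have the form `c ⊙ x = Σ c(t) κ(t)(x)` with `κ` injective into `G`. For `N₁`
-- the values of `κ` lie in `J`, so these operators are linear over `F`; for `N₂` they lie in `G′`,
-- so these are linear over `E`. Hence what holds on `𝒪ᴱ` or on `𝒪ᶠ` extends to the products that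
-- generate `𝒪ᴸ`. Only `𝔄₁` receives a basis: the second factors of a normal form are arbitrary
-- elements of `𝔄̄`, tested through the coordinates of their values in `𝒪ᶠ`.

private variable
  u : Level

-- Finite sums indexed by enumerated setoids.

module FiniteSum (M : CommutativeMonoid u u) where

  open CommutativeMonoid M
  open Sum M using (sum; sum-cong-≋; sum-permute; sum-replicate-zero)
  open SetoidReasoning setoid

  ∑ : {S : Setoid u u} → Finite S → (Setoid.Carrier S → Carrier) → Carrier
  ∑ fin F = sum (F ∘ Inverse.to (proj₂ fin))

  sum-zero : ∀ {n} {v : Vector Carrier n} → (∀ i → v i ≈ ε) → sum v ≈ ε
  sum-zero {n} v≈0 = trans (sum-cong-≋ v≈0) (sum-replicate-zero n)

  sum-closed : (P : Pred Carrier u) → P ε → (∀ {x y} → x ∈ P → y ∈ P → x ∙ y ∈ P) →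
               ∀ {n} {v : Vector Carrier n} → (∀ i → v i ∈ P) → sum v ∈ P
  sum-closed P 0∈ +∈ {zero}  v∈ = 0∈
  sum-closed P 0∈ +∈ {suc n} v∈ = +∈ (v∈ zero) (sum-closed P 0∈ +∈ (v∈ ∘ suc))

  sum-single : ∀ {n} {v : Vector Carrier n} i → (∀ k → ¬ k ≡ i → v k ≈ ε) → sum v ≈ v i
  sum-single zero    v≈0 = trans (∙-congˡ (sum-zero λ k → v≈0 (suc k) λ ())) (identityʳ _)
  sum-single (suc i) v≈0 =
    trans (∙-cong (v≈0 zero λ ()) (sum-single i λ k k≢i → v≈0 (suc k) λ { ≡.refl → k≢i ≡.refl }))
          (identityˡ _)

  module _ {S : Setoid u u} (fin : Finite S) where
    private module S = Setoid S
    open Inverse (proj₂ fin)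

    ∑-cong : ∀ {F F′} → (∀ s → F s ≈ F′ s) → ∑ {S} fin F ≈ ∑ {S} fin F′
    ∑-cong e = sum-cong-≋ λ i → e (to i)

    ∑-single : ∀ {F} s → (∀ {s t} → s S.≈ t → F s ≈ F t) → (∀ t → ¬ t S.≈ s → F t ≈ ε) →
               ∑ {S} fin F ≈ F s
    ∑-single {F} s F-cong F≈0 = trans
      (sum-single (from s) λ k k≢ →
        F≈0 (to k) λ e → k≢ (≡.trans (≡.sym (strictlyInverseʳ k)) (from-cong e)))
      (F-cong (strictlyInverseˡ s))

  -- One enumeration, followed by `b` and the inverse of the other enumeration, is a bijection of
  -- index sets. The shifts `h ↦ g h` and the conjugations of summation variables below rest on
  -- this.
  ∑-reindex : {S T : Setoid u u} (finS : Finite S) (finT : Finite T) (b : Inverse S T) →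
              ∀ F → (∀ {s t} → Setoid._≈_ T s t → F s ≈ F t) →
              ∑ {T} finT F ≈ ∑ {S} finS (F ∘ Inverse.to b)
  ∑-reindex {T = T} finS finT b F F-cong = trans (sum-permute (F ∘ to (proj₂ finT)) π)
    (sum-cong-≋ λ i → F-cong (strictlyInverseˡ (proj₂ finT) (to b (to (proj₂ finS) i))))
    where
    open Inverse
    π = Composition.inverse (proj₂ finS)
          (Composition.inverse b (Symmetry.inverse (proj₂ finT)))

  sum-++ : ∀ m {n} (v : Vector Carrier (m ℕ.+ n)) →
           sum v ≈ sum (λ i → v (i ↑ˡ n)) ∙ sum (λ j → v (m ↑ʳ j))
  sum-++ zero    v = sym (identityˡ _)
  sum-++ (suc m) v = trans (∙-congˡ (sum-++ m (tail v))) (sym (assoc _ _ _))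

  sum-combine : ∀ m n (v : Vector Carrier (m ℕ.* n)) →
                sum v ≈ sum {m} λ i → sum {n} λ j → v (combine i j)
  sum-combine zero    n v = refl
  sum-combine (suc m) n v =
    trans (sum-++ n v) (∙-congˡ (sum-combine m n (λ k → v (n ↑ʳ k))))

  sum-remQuot : ∀ {m n} (v : Fin m → Fin n → Carrier) →
                (sum {m ℕ.* n} λ k → let (i , j) = remQuot {m} n k in v i j) ≈
                (sum {m} λ i → sum {n} λ j → v i j)
  sum-remQuot {m} {n} v = trans (sum-combine m n _)
    (sum-cong-≋ λ i → sum-cong-≋ {n} λ j →
      reflexive (≡.cong (λ (i , j) → v i j) (remQuot-combine {m} {n} i j)))

  ∑-product : {S T W : Setoid u u} (finS : Finite S) (finT : Finite T) (finW : Finite W)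
              (b : Inverse (×-setoid S T) W) →
              ∀ F → (∀ {s t} → Setoid._≈_ W s t → F s ≈ F t) →
              ∑ {W} finW F ≈ ∑ {S} finS λ s → ∑ {T} finT λ t → F (Inverse.to b (s , t))
  ∑-product {S} {T} {W} finS finT finW b F F-cong =
    trans (∑-reindex fin× finW b F F-cong)
          (sum-remQuot {proj₁ finS} {proj₁ finT} λ i j →
            F (to b (to (proj₂ finS) i , to (proj₂ finT) j)))
    where
    open Inverse
    fin× : Finite (×-setoid S T)
    fin× = proj₁ finS ℕ.* proj₁ finT , Composition.inverse (*↔× {proj₁ finS} {proj₁ finT}) (record
      { to = λ (i , j) → to (proj₂ finS) i , to (proj₂ finT) j
      ; from = λ (s , t) → from (proj₂ finS) s , from (proj₂ finT) t
      ; to-cong = λ { ≡.refl → Setoid.refl S , Setoid.refl T }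
      ; from-cong = λ (e , e′) → ≡.cong₂ _,_ (from-cong (proj₂ finS) e) (from-cong (proj₂ finT) e′)
      ; inverse = (λ { ≡.refl → strictlyInverseˡ (proj₂ finS) _ , strictlyInverseˡ (proj₂ finT) _ })
                , (λ (e , e′) → ≡.cong₂ _,_ (inverseʳ (proj₂ finS) e) (inverseʳ (proj₂ finT) e′))
      })

-- Excluded middle from the principality of all ideals.

module PID {R : CommutativeRing u u} (isPID : IsPrincipalIdealDomain R) where

  open CommutativeRing R
  open IsPrincipalIdealDomain isPID public

  -- The generator `a` lies in its own ideal, which yields `P` or `a ≈ 0#`. In the latter case the
  -- ideal is zero, whereas `P` would put `1#` into it.
  excluded-middle : (P : Set u) → P ⊎ ¬ P
  excluded-middle P with principal (λ x → x ≈ 0# ⊎ P) (record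
    { resp     = λ x≈y → [ inj₁ ∘ trans (sym x≈y) , inj₂ ]′
    ; 0∈       = inj₁ refl
    ; +-closed = λ { (inj₁ x≈0) (inj₁ y≈0) → inj₁ (trans (+-cong x≈0 y≈0) (+-identityˡ 0#))
                   ; (inj₂ p) _ → inj₂ p
                   ; _ (inj₂ p) → inj₂ p }
    ; *-closed = λ r → [ (λ x≈0 → inj₁ (trans (*-congˡ x≈0) (zeroʳ r))) , inj₂ ]′
    })
  ... | a , generates with Equivalence.from (generates a) (1# , sym (*-identityˡ a))
  ...   | inj₂ p   = inj₁ p
  ...   | inj₁ a≈0 = inj₂ λ p →
    let (r , 1≈ra) = Equivalence.to (generates 1#) (inj₂ p)
    in 1≉0 (trans 1≈ra (trans (*-congˡ a≈0) (zeroʳ r)))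

-- Submodules of torsion-free modules over a principal ideal domain

module Submodules {R : CommutativeRing u u} (M : LeftModule (CommutativeRing.ring R) u u) where

  private module R = CommutativeRing R
  open LeftModule M
  open Sum +ᴹ-commutativeMonoid using (sum; sum-cong-≋; ∑-distrib-+) public
  open FiniteSum +ᴹ-commutativeMonoid public
  open SetoidReasoning ≈ᴹ-setoid

  record IsSubmodule (P : Pred Carrierᴹ u) : Set u where
    field
      resp      : ∀ {x y} → x ≈ᴹ y → x ∈ P → y ∈ P
      0∈        : 0ᴹ ∈ P
      +-closed  : ∀ {x y} → x ∈ P → y ∈ P → x +ᴹ y ∈ P
      *ₗ-closed : ∀ r {x} → x ∈ P → r *ₗ x ∈ P

    ∑-closed : ∀ {n} {v : Vector Carrierᴹ n} → (∀ i → v i ∈ P) → sum v ∈ P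
    ∑-closed = sum-closed P 0∈ +-closed

    neg-closed : ∀ {x} → x ∈ P → -ᴹ x ∈ P
    neg-closed {x} x∈ = resp (begin
      (R.- R.1#) *ₗ x                           ≈⟨ +ᴹ-identityʳ _ ⟨
      (R.- R.1#) *ₗ x +ᴹ 0ᴹ                     ≈⟨ +ᴹ-congˡ (-ᴹ‿inverseʳ x) ⟨
      (R.- R.1#) *ₗ x +ᴹ (x +ᴹ -ᴹ x)            ≈⟨ +ᴹ-assoc _ _ _ ⟨
      (R.- R.1#) *ₗ x +ᴹ x +ᴹ -ᴹ x              ≈⟨ +ᴹ-congʳ (+ᴹ-congˡ (*ₗ-identityˡ x)) ⟨
      (R.- R.1#) *ₗ x +ᴹ R.1# *ₗ x +ᴹ -ᴹ x      ≈⟨ +ᴹ-congʳ (*ₗ-distribʳ x _ _) ⟨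
      (R.- R.1# R.+ R.1#) *ₗ x +ᴹ -ᴹ x          ≈⟨ +ᴹ-congʳ (*ₗ-congʳ (R.-‿inverseˡ R.1#)) ⟩
      R.0# *ₗ x +ᴹ -ᴹ x                         ≈⟨ +ᴹ-congʳ (*ₗ-zeroˡ x) ⟩
      0ᴹ +ᴹ -ᴹ x                                ≈⟨ +ᴹ-identityˡ _ ⟩
      -ᴹ x                                      ∎) (*ₗ-closed (R.- R.1#) x∈)

  lin : ∀ {n} → Vector R.Carrier n → Vector Carrierᴹ n → Carrierᴹ
  lin r v = sum λ i → r i *ₗ v i

  Span : ∀ {n} → Vector Carrierᴹ n → Pred Carrierᴹ u
  Span v x = ∃ λ r → x ≈ᴹ lin r v

  lin-+ : ∀ {n} (r s : Vector R.Carrier n) v →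
          lin r v +ᴹ lin s v ≈ᴹ lin (λ i → r i R.+ s i) v
  lin-+ r s v = ≈ᴹ-sym (≈ᴹ-trans (sum-cong-≋ λ i → *ₗ-distribʳ (v i) (r i) (s i))
                                 (∑-distrib-+ (λ i → r i *ₗ v i) (λ i → s i *ₗ v i)))

  *ₗ-sum : ∀ {n} a (v : Vector Carrierᴹ n) → a *ₗ sum v ≈ᴹ sum (λ i → a *ₗ v i)
  *ₗ-sum {zero}  a v = *ₗ-zeroʳ a
  *ₗ-sum {suc n} a v = ≈ᴹ-trans (*ₗ-distribˡ a _ _) (+ᴹ-congˡ (*ₗ-sum a (tail v)))

  *ₗ-lin : ∀ {n} a (r : Vector R.Carrier n) v → a *ₗ lin r v ≈ᴹ lin (λ i → a R.* r i) v
  *ₗ-lin a r v = ≈ᴹ-trans (*ₗ-sum a (λ i → r i *ₗ v i)) (sum-cong-≋ λ i → ≈ᴹ-sym (*ₗ-assoc a (r i) (v i)))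

  Span-isSubmodule : ∀ {n} (v : Vector Carrierᴹ n) → IsSubmodule (Span v)
  Span-isSubmodule v = record
    { resp      = λ x≈y (r , e) → r , ≈ᴹ-trans (≈ᴹ-sym x≈y) e
    ; 0∈        = (λ _ → R.0#) , ≈ᴹ-sym (sum-zero λ i → *ₗ-zeroˡ (v i))
    ; +-closed  = λ (r , e) (s , e′) → _ , ≈ᴹ-trans (+ᴹ-cong e e′) (lin-+ r s v)
    ; *ₗ-closed = λ a (r , e) → _ , ≈ᴹ-trans (*ₗ-congˡ e) (*ₗ-lin a r v)
    }

  module Span {n} (v : Vector Carrierᴹ n) = IsSubmodule (Span-isSubmodule v)

  generator∈Span : ∀ {n} (v : Vector Carrierᴹ n) i → v i ∈ Span v
  generator∈Span v zero =
    let (r , e) = Span.0∈ (tail v)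
    in R.1# Vector.∷ r , ≈ᴹ-trans (≈ᴹ-sym (+ᴹ-identityʳ _)) (+ᴹ-cong (≈ᴹ-sym (*ₗ-identityˡ _)) e)
  generator∈Span v (suc i) =
    let (r , e) = generator∈Span (tail v) i
    in R.0# Vector.∷ r , ≈ᴹ-trans (≈ᴹ-sym (+ᴹ-identityˡ _)) (+ᴹ-cong (≈ᴹ-sym (*ₗ-zeroˡ _)) e)

  module _ {P : Pred Carrierᴹ u} (isSubmodule : IsSubmodule P) where
    private module P = IsSubmodule isSubmodule

    Span⊆ : ∀ {n} {v : Vector Carrierᴹ n} → (∀ i → v i ∈ P) → Span v ⊆ P
    Span⊆ v∈P (r , e) = P.resp (≈ᴹ-sym e) (P.∑-closed λ i → P.*ₗ-closed (r i) (v∈P i))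

  record Basis (P : Pred Carrierᴹ u) : Set u where
    field
      rank        : ℕ
      vector      : Vector Carrierᴹ rank
      vector∈     : ∀ i → vector i ∈ P
      span        : P ⊆ Span vector
      independent : ∀ r → lin r vector ≈ᴹ 0ᴹ → ∀ i → r i R.≈ R.0#

  module FreeSubmodules (isPID : IsPrincipalIdealDomain R)
    (torsionFree : ∀ {r x} → ¬ r R.≈ R.0# → r *ₗ x ≈ᴹ 0ᴹ → x ≈ᴹ 0ᴹ) where

    open PID isPID
    open AbelianGroupProperties +ᴹ-abelianGroup using (⁻¹-∙-comm)
    open CommutativeSemigroupProperties
      (CommutativeMonoid.commutativeSemigroup +ᴹ-commutativeMonoid) using (interchange)

    *ₗ-cancel : ∀ {a x y} → ¬ a R.≈ R.0# → a *ₗ x ≈ᴹ a *ₗ y → x ≈ᴹ y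
    *ₗ-cancel {a} {x} {y} a≉0 e = begin
      x                   ≈⟨ +ᴹ-identityʳ x ⟨
      x +ᴹ 0ᴹ             ≈⟨ +ᴹ-congˡ (-ᴹ‿inverseˡ y) ⟨
      x +ᴹ (-ᴹ y +ᴹ y)    ≈⟨ +ᴹ-assoc _ _ _ ⟨
      x +ᴹ -ᴹ y +ᴹ y      ≈⟨ +ᴹ-congʳ (torsionFree a≉0 (begin
        a *ₗ (x +ᴹ -ᴹ y)        ≈⟨ *ₗ-distribˡ a _ _ ⟩
        a *ₗ x +ᴹ a *ₗ (-ᴹ y)   ≈⟨ +ᴹ-congʳ e ⟩
        a *ₗ y +ᴹ a *ₗ (-ᴹ y)   ≈⟨ *ₗ-distribˡ a _ _ ⟨
        a *ₗ (y +ᴹ -ᴹ y)        ≈⟨ *ₗ-congˡ (-ᴹ‿inverseʳ y) ⟩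
        a *ₗ 0ᴹ                 ≈⟨ *ₗ-zeroʳ a ⟩
        0ᴹ                      ∎)) ⟩
      0ᴹ +ᴹ y             ≈⟨ +ᴹ-identityˡ y ⟩
      y                   ∎

    -- The product of the single multipliers works, being nonzero in a domain. The later clearing of
    -- denominators rests on it.
    commonMultiple : ∀ {P} → IsSubmodule P → ∀ {n} (v : Vector Carrierᴹ n) →
      (∀ i → ∃ λ a → ¬ a R.≈ R.0# × a *ₗ v i ∈ P) →
      ∃ λ a → ¬ a R.≈ R.0# × ∀ i → a *ₗ v i ∈ P
    commonMultiple isSub {zero}  v multiple = R.1# , 1≉0 , λ ()
    commonMultiple {P} isSub {suc n} v multiple =
      let (a , a≉0 , av₀∈) = multiple zero
          (b , b≉0 , bv∈)  = commonMultiple isSub (tail v) (multiple ∘ suc)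
      in b R.* a
       , (λ ba≈0 → [ b≉0 , a≉0 ]′ (domain ba≈0))
       , λ { zero    → P.resp (≈ᴹ-sym (*ₗ-assoc b a _)) (P.*ₗ-closed b av₀∈)
           ; (suc i) → P.resp (≈ᴹ-trans (≈ᴹ-sym (*ₗ-assoc a b _)) (*ₗ-congʳ (R.*-comm a b)))
                              (P.*ₗ-closed a (bv∈ i)) }
      where module P = IsSubmodule isSub

    private
      inverseOf : ∀ x y → x +ᴹ y ≈ᴹ 0ᴹ → x ≈ᴹ -ᴹ y
      inverseOf x y e = begin
        x                  ≈⟨ +ᴹ-identityʳ x ⟨
        x +ᴹ 0ᴹ            ≈⟨ +ᴹ-congˡ (-ᴹ‿inverseʳ y) ⟨
        x +ᴹ (y +ᴹ -ᴹ y)   ≈⟨ +ᴹ-assoc x y _ ⟨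
        x +ᴹ y +ᴹ -ᴹ y     ≈⟨ +ᴹ-congʳ e ⟩
        0ᴹ +ᴹ -ᴹ y         ≈⟨ +ᴹ-identityˡ _ ⟩
        -ᴹ y               ∎

    -- If a nonzero multiple a v₀ lies in the span of the remaining generators,
    -- then so does a P, which is isomorphic to P.  Otherwise the coefficient of v₀
    -- of an element of P is well defined, and P splits as P ∩ span of the rest
    -- and the multiples of an element whose coefficient generates the ideal of
    -- all coefficients.
    basis : ∀ {n} {P} (v : Vector Carrierᴹ n) → IsSubmodule P → P ⊆ Span v → Basis P
    basis {zero} v isSub P⊆ = record
      { rank = 0 ; vector = λ () ; vector∈ = λ () ; independent = λ _ _ ()
      ; span = λ x∈P → (λ ()) , proj₂ (P⊆ x∈P) }
    basis {suc n} {P} v isSub P⊆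
      with excluded-middle (∃ λ a → ¬ a R.≈ R.0# × a *ₗ v zero ∈ Span (tail v))
    ... | inj₁ (a , a≉0 , av₀∈) = record
      { rank        = B.rank
      ; vector      = λ i → proj₁ (B.vector∈ i)
      ; vector∈     = λ i → proj₁ (proj₂ (B.vector∈ i))
      ; span        = λ {x} x∈P →
          let (r , e) = B.span (x , x∈P , ≈ᴹ-refl)
          in r , *ₗ-cancel a≉0 (≈ᴹ-trans e (≈ᴹ-sym (scale r)))
      ; independent = λ r e → B.independent r
          (≈ᴹ-trans (≈ᴹ-sym (scale r)) (≈ᴹ-trans (*ₗ-congˡ e) (*ₗ-zeroʳ a)))
      }
      where
      module P = IsSubmodule isSub
      aP : Pred Carrierᴹ u
      aP y = ∃ λ x → x ∈ P × y ≈ᴹ a *ₗ x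
      aP-isSub : IsSubmodule aP
      aP-isSub = record
        { resp      = λ y≈z (x , x∈ , e) → x , x∈ , ≈ᴹ-trans (≈ᴹ-sym y≈z) e
        ; 0∈        = 0ᴹ , P.0∈ , ≈ᴹ-sym (*ₗ-zeroʳ a)
        ; +-closed  = λ (x , x∈ , e) (x′ , x′∈ , e′) →
            x +ᴹ x′ , P.+-closed x∈ x′∈ , ≈ᴹ-trans (+ᴹ-cong e e′) (≈ᴹ-sym (*ₗ-distribˡ a x x′))
        ; *ₗ-closed = λ r (x , x∈ , e) → r *ₗ x , P.*ₗ-closed r x∈ , (begin
            r *ₗ _             ≈⟨ *ₗ-congˡ e ⟩
            r *ₗ a *ₗ x        ≈⟨ *ₗ-assoc r a x ⟨
            (r R.* a) *ₗ x     ≈⟨ *ₗ-congʳ (R.*-comm r a) ⟩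
            (a R.* r) *ₗ x     ≈⟨ *ₗ-assoc a r x ⟩
            a *ₗ r *ₗ x        ∎)
        }
      aP⊆ : aP ⊆ Span (tail v)
      aP⊆ (x , x∈ , e) with P⊆ x∈
      ... | r , e′ = Span.resp (tail v)
        (begin
          r zero *ₗ (a *ₗ v zero) +ᴹ a *ₗ lin (tail r) (tail v)
            ≈⟨ +ᴹ-congʳ (*ₗ-assoc _ _ _) ⟨
          (r zero R.* a) *ₗ v zero +ᴹ a *ₗ lin (tail r) (tail v)
            ≈⟨ +ᴹ-congʳ (*ₗ-congʳ (R.*-comm _ _)) ⟩
          (a R.* r zero) *ₗ v zero +ᴹ a *ₗ lin (tail r) (tail v)
            ≈⟨ +ᴹ-congʳ (*ₗ-assoc _ _ _) ⟩
          a *ₗ (r zero *ₗ v zero) +ᴹ a *ₗ lin (tail r) (tail v)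
            ≈⟨ *ₗ-distribˡ a _ _ ⟨
          a *ₗ lin r v
            ≈⟨ *ₗ-congˡ e′ ⟨
          a *ₗ x
            ≈⟨ e ⟨
          _ ∎)
        (Span.+-closed (tail v) (Span.*ₗ-closed (tail v) (r zero) av₀∈)
                                (Span.*ₗ-closed (tail v) a (tail r , ≈ᴹ-refl)))
      module B = Basis (basis (tail v) aP-isSub aP⊆)
      scale : ∀ r → a *ₗ lin r (λ i → proj₁ (B.vector∈ i)) ≈ᴹ lin r B.vector
      scale r = ≈ᴹ-trans (*ₗ-sum a (λ i → r i *ₗ proj₁ (B.vector∈ i))) (sum-cong-≋ λ i → begin
        a *ₗ (r i *ₗ x i)       ≈⟨ *ₗ-assoc a (r i) _ ⟨
        (a R.* r i) *ₗ x i      ≈⟨ *ₗ-congʳ (R.*-comm a (r i)) ⟩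
        (r i R.* a) *ₗ x i      ≈⟨ *ₗ-assoc (r i) a _ ⟩
        r i *ₗ (a *ₗ x i)       ≈⟨ *ₗ-congˡ (proj₂ (proj₂ (B.vector∈ i))) ⟨
        r i *ₗ B.vector i       ∎)
        where
        x = λ i → proj₁ (B.vector∈ i)
    ... | inj₂ v₀-free = result (excluded-middle (d R.≈ R.0#))
      where
      module P = IsSubmodule isSub
      P′ : Pred Carrierᴹ u
      P′ x = x ∈ P × x ∈ Span (tail v)
      P′-isSub : IsSubmodule P′
      P′-isSub = record
        { resp      = λ x≈y (p , q) → P.resp x≈y p , Span.resp (tail v) x≈y q
        ; 0∈        = P.0∈ , Span.0∈ (tail v)
        ; +-closed  = λ (p , q) (p′ , q′) → P.+-closed p p′ , Span.+-closed (tail v) q q′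
        ; *ₗ-closed = λ r (p , q) → P.*ₗ-closed r p , Span.*ₗ-closed (tail v) r q
        }
      module B = Basis (basis (tail v) P′-isSub proj₂)

      -- Coefficients at `v zero` are collected through the mere existence of a decomposition; their
      -- uniqueness is proved only where independence needs it, in `leading≈0`.
      leading : Pred R.Carrier u
      leading a = ∃₂ λ x y → x ∈ P × y ∈ Span (tail v) × x ≈ᴹ a *ₗ v zero +ᴹ y
      I : IsIdeal R leading
      I = record
        { resp     = λ a≈b (x , y , x∈ , y∈ , e) →
            x , y , x∈ , y∈ , ≈ᴹ-trans e (+ᴹ-congʳ (*ₗ-congʳ a≈b))
        ; 0∈       = 0ᴹ , 0ᴹ , P.0∈ , Span.0∈ (tail v) ,
            ≈ᴹ-sym (≈ᴹ-trans (+ᴹ-identityʳ _) (*ₗ-zeroˡ _))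
        ; +-closed = λ {a} {b} (x , y , x∈ , y∈ , e) (x′ , y′ , x′∈ , y′∈ , e′) →
            x +ᴹ x′ , y +ᴹ y′ , P.+-closed x∈ x′∈ , Span.+-closed (tail v) y∈ y′∈ , (begin
              x +ᴹ x′                                          ≈⟨ +ᴹ-cong e e′ ⟩
              (a *ₗ v zero +ᴹ y) +ᴹ (b *ₗ v zero +ᴹ y′)        ≈⟨ interchange _ _ _ _ ⟩
              (a *ₗ v zero +ᴹ b *ₗ v zero) +ᴹ (y +ᴹ y′)        ≈⟨ +ᴹ-congʳ (*ₗ-distribʳ _ a b) ⟨
              (a R.+ b) *ₗ v zero +ᴹ (y +ᴹ y′)                 ∎)
        ; *-closed = λ r {a} (x , y , x∈ , y∈ , e) →
            r *ₗ x , r *ₗ y , P.*ₗ-closed r x∈ , Span.*ₗ-closed (tail v) r y∈ , (begin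
              r *ₗ x                           ≈⟨ *ₗ-congˡ e ⟩
              r *ₗ (a *ₗ v zero +ᴹ y)          ≈⟨ *ₗ-distribˡ r _ _ ⟩
              r *ₗ (a *ₗ v zero) +ᴹ r *ₗ y     ≈⟨ +ᴹ-congʳ (*ₗ-assoc r a _) ⟨
              (r R.* a) *ₗ v zero +ᴹ r *ₗ y    ∎)
        }

      d = proj₁ (principal leading I)
      leading-d : leading d
      leading-d = Equivalence.from (proj₂ (principal leading I) d) (R.1# , R.sym (R.*-identityˡ d))

      result : d R.≈ R.0# ⊎ ¬ d R.≈ R.0# → Basis P
      result (inj₁ d≈0) = record
        { rank = B.rank ; vector = B.vector ; vector∈ = proj₁ ∘ B.vector∈
        ; independent = B.independent
        ; span = λ {x} x∈P → B.span (x∈P ,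
            let (r , e)  = P⊆ x∈P
                (s , e′) = Equivalence.to (proj₂ (principal leading I) (r zero))
                             (x , lin (tail r) (tail v) , x∈P , (tail r , ≈ᴹ-refl) , e)
            in tail r , (begin
              x                                             ≈⟨ e ⟩
              r zero *ₗ v zero +ᴹ lin (tail r) (tail v)
                ≈⟨ +ᴹ-congʳ (*ₗ-congʳ (R.trans e′ (R.trans (R.*-congˡ d≈0) (R.zeroʳ s)))) ⟩
              R.0# *ₗ v zero +ᴹ lin (tail r) (tail v)       ≈⟨ +ᴹ-congʳ (*ₗ-zeroˡ _) ⟩
              0ᴹ +ᴹ lin (tail r) (tail v)                   ≈⟨ +ᴹ-identityˡ _ ⟩
              lin (tail r) (tail v)                         ∎)) }
      result (inj₂ d≉0) = let (b , y , b∈P , y∈ , b≈) = leading-d in record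
        { rank        = suc B.rank
        ; vector      = b Vector.∷ B.vector
        ; vector∈     = λ { zero → b∈P ; (suc i) → proj₁ (B.vector∈ i) }
        ; span        = λ {x} x∈P →
            let (r , e)  = P⊆ x∈P
                (s , e′) = Equivalence.to (proj₂ (principal leading I) (r zero))
                             (x , lin (tail r) (tail v) , x∈P , (tail r , ≈ᴹ-refl) , e)
                -- As `r zero = s d`, subtracting `s` times `b` cancels the term at `v zero`, so the
                -- difference falls into `P′`.
                x-sb∈    = P.+-closed x∈P (P.neg-closed (P.*ₗ-closed s b∈P))
                y′       = lin (tail r) (tail v) +ᴹ -ᴹ (s *ₗ y)
                (t , e″) = B.span
                  ( x-sb∈
                  , Span.resp (tail v) (≈ᴹ-sym (begin
                      x +ᴹ -ᴹ (s *ₗ b)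
                        ≈⟨ +ᴹ-cong e (-ᴹ‿cong (≈ᴹ-trans (*ₗ-congˡ b≈) (*ₗ-distribˡ s _ _))) ⟩
                      r zero *ₗ v zero +ᴹ lin (tail r) (tail v) +ᴹ -ᴹ (s *ₗ d *ₗ v zero +ᴹ s *ₗ y)
                        ≈⟨ +ᴹ-cong (+ᴹ-comm _ _) (≈ᴹ-trans (-ᴹ‿cong (+ᴹ-comm _ _)) (≈ᴹ-sym (⁻¹-∙-comm _ _))) ⟩
                      lin (tail r) (tail v) +ᴹ r zero *ₗ v zero +ᴹ (-ᴹ (s *ₗ y) +ᴹ -ᴹ (s *ₗ d *ₗ v zero))
                        ≈⟨ interchange _ _ _ _ ⟩
                      y′ +ᴹ (r zero *ₗ v zero +ᴹ -ᴹ (s *ₗ d *ₗ v zero))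
                        ≈⟨ +ᴹ-congˡ (+ᴹ-congʳ (≈ᴹ-trans (*ₗ-congʳ e′) (*ₗ-assoc s d _))) ⟩
                      y′ +ᴹ (s *ₗ d *ₗ v zero +ᴹ -ᴹ (s *ₗ d *ₗ v zero))
                        ≈⟨ +ᴹ-congˡ (-ᴹ‿inverseʳ _) ⟩
                      y′ +ᴹ 0ᴹ
                        ≈⟨ +ᴹ-identityʳ _ ⟩
                      y′ ∎))
                      (Span.+-closed (tail v) (tail r , ≈ᴹ-refl)
                        (Span.neg-closed (tail v) (Span.*ₗ-closed (tail v) s y∈))) )
            in s Vector.∷ t , (begin
                 x                                  ≈⟨ +ᴹ-identityˡ x ⟨
                 0ᴹ +ᴹ x                            ≈⟨ +ᴹ-congʳ (-ᴹ‿inverseʳ (s *ₗ b)) ⟨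
                 s *ₗ b +ᴹ -ᴹ (s *ₗ b) +ᴹ x         ≈⟨ +ᴹ-assoc _ _ _ ⟩
                 s *ₗ b +ᴹ (-ᴹ (s *ₗ b) +ᴹ x)       ≈⟨ +ᴹ-congˡ (+ᴹ-comm _ _) ⟩
                 s *ₗ b +ᴹ (x +ᴹ -ᴹ (s *ₗ b))       ≈⟨ +ᴹ-congˡ e″ ⟩
                 s *ₗ b +ᴹ lin t B.vector           ∎)
        ; independent = λ r e →
            let r₀≈0 = leading≈0 (r zero) b y (lin (tail r) B.vector) y∈ b≈
                         (Span⊆ (Span-isSubmodule (tail v)) (proj₂ ∘ B.vector∈) (tail r , ≈ᴹ-refl)) e
            in λ { zero → r₀≈0
                 ; (suc i) → B.independent (tail r)
                     (≈ᴹ-trans (≈ᴹ-sym (+ᴹ-identityˡ _))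
                       (≈ᴹ-trans (+ᴹ-congʳ (≈ᴹ-sym (≈ᴹ-trans (*ₗ-congʳ r₀≈0) (*ₗ-zeroˡ b)))) e)) i }
        }
        where
        -- If `s` were nonzero, the relation would put the nonzero multiple `s d` of `v zero` into
        -- the span of the other generators, contrary to `v₀-free`.
        leading≈0 : ∀ s b y z → y ∈ Span (tail v) → b ≈ᴹ d *ₗ v zero +ᴹ y → z ∈ Span (tail v) →
                    s *ₗ b +ᴹ z ≈ᴹ 0ᴹ → s R.≈ R.0#
        leading≈0 s b y z y∈ b≈ z∈ e with excluded-middle (s R.≈ R.0#)
        ... | inj₁ s≈0 = s≈0
        ... | inj₂ s≉0 = contradiction
          ( s R.* d
          , (λ sd≈0 → [ s≉0 , d≉0 ]′ (domain sd≈0))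
          , Span.resp (tail v) (≈ᴹ-sym (inverseOf _ _ (begin
              (s R.* d) *ₗ v zero +ᴹ (s *ₗ y +ᴹ z)      ≈⟨ +ᴹ-assoc _ _ _ ⟨
              (s R.* d) *ₗ v zero +ᴹ s *ₗ y +ᴹ z        ≈⟨ +ᴹ-congʳ (+ᴹ-congʳ (*ₗ-assoc s d _)) ⟩
              s *ₗ d *ₗ v zero +ᴹ s *ₗ y +ᴹ z           ≈⟨ +ᴹ-congʳ (*ₗ-distribˡ s _ _) ⟨
              s *ₗ (d *ₗ v zero +ᴹ y) +ᴹ z              ≈⟨ +ᴹ-congʳ (*ₗ-congˡ b≈) ⟨
              s *ₗ b +ᴹ z                               ≈⟨ e ⟩
              0ᴹ                                        ∎)))
              (Span.neg-closed (tail v) (Span.+-closed (tail v) (Span.*ₗ-closed (tail v) s y∈) z∈)) )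
          v₀-free

-- Integral elements of a field extension

module Integrality {R L : CommutativeRing u u}
  {f : CommutativeRing.Carrier R → CommutativeRing.Carrier L}
  (f-hom : RingMorphisms.IsRingHomomorphism
             (CommutativeRing.rawRing R) (CommutativeRing.rawRing L) f)
  (isPID : IsPrincipalIdealDomain R)
  (f-injective : ∀ {r} → CommutativeRing._≈_ L (f r) (CommutativeRing.0# L) →
                 CommutativeRing._≈_ R r (CommutativeRing.0# R))
  (inverse : ∀ {x} → ¬ CommutativeRing._≈_ L x (CommutativeRing.0# L) →
             ∃ λ y → CommutativeRing._≈_ L (CommutativeRing._*_ L x y) (CommutativeRing.1# L))
  where

  private module R = CommutativeRing R
  open CommutativeRing L hiding (zero)
  open RingMorphisms.IsRingHomomorphism f-hom
  open Exp semiring using (_^_)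
  open CommutativeSemigroupProperties *-commutativeSemigroup using (x∙yz≈y∙xz; interchange)
  open SetoidReasoning setoid

  L/R : LeftModule R.ring u u
  L/R = restrictScalars R L f f-hom

  open Submodules {R = R} L/R

  *-cancelˡ : ∀ {x y z} → ¬ x ≈ 0# → x * y ≈ x * z → y ≈ z
  *-cancelˡ {x} {y} {z} x≉0 e = let (x⁻¹ , xx⁻¹≈1) = inverse x≉0 in begin
    y               ≈⟨ *-identityˡ y ⟨
    1# * y          ≈⟨ *-congʳ (trans (*-comm _ _) xx⁻¹≈1) ⟨
    x⁻¹ * x * y     ≈⟨ *-assoc _ _ _ ⟩
    x⁻¹ * (x * y)   ≈⟨ *-congˡ e ⟩
    x⁻¹ * (x * z)   ≈⟨ *-assoc _ _ _ ⟨
    x⁻¹ * x * z     ≈⟨ *-congʳ (trans (*-comm _ _) xx⁻¹≈1) ⟩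
    1# * z          ≈⟨ *-identityˡ z ⟩
    z               ∎

  f-nonzero : ∀ {r} → ¬ r R.≈ R.0# → ¬ f r ≈ 0#
  f-nonzero r≉0 = r≉0 ∘ f-injective

  f-inverse : ∀ {r} → ¬ r R.≈ R.0# → ∃ λ y → f r * y ≈ 1#
  f-inverse r≉0 = inverse (f-nonzero r≉0)

  torsionFree : ∀ {r x} → ¬ r R.≈ R.0# → f r * x ≈ 0# → x ≈ 0#
  torsionFree r≉0 e = *-cancelˡ (f-nonzero r≉0) (trans e (sym (zeroʳ _)))

  open PID isPID using (principal)
  open FreeSubmodules isPID torsionFree public

  1≉0 : ¬ 1# ≈ 0#
  1≉0 1≈0 = PID.1≉0 isPID (f-injective (trans 1#-homo 1≈0))

  Integral : Pred Carrier u
  Integral = IsIntegral R L f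

  preimage : ∀ {P} y → IsSubmodule P → IsSubmodule (λ x → y * x ∈ P)
  preimage y isSub = record
    { resp      = λ e → P.resp (*-congˡ e)
    ; 0∈        = P.resp (sym (zeroʳ y)) P.0∈
    ; +-closed  = λ p q → P.resp (sym (distribˡ y _ _)) (P.+-closed p q)
    ; *ₗ-closed = λ r p → P.resp (x∙yz≈y∙xz _ _ _) (P.*ₗ-closed r p)
    }
    where module P = IsSubmodule isSub

  -- The submodules spanned by s, s z, …, s zᵏ⁻¹ have a finitely generated union,
  -- hence become stationary.
  integral : ∀ {n} (v : Vector Carrier n) s {z} → ¬ s ≈ 0# →
             (∀ k → s * z ^ k ∈ Span v) → z ∈ Integral
  integral v s {z} s≉0 powers∈ = N , R.-_ ∘ r , (begin
    z ^ N + sum (λ i → f (R.- r i) * z ^ toℕ i)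
      ≈⟨ +-cong (*-cancelˡ s≉0 szᴺ≈) (sum-cong-≋ λ i →
           trans (*-congʳ (-‿homo (r i))) (*-congʳ {z ^ toℕ i} refl)) ⟩
    sum (λ i → f (r i) * z ^ toℕ i) + sum (λ i → - f (r i) * z ^ toℕ i)
      ≈⟨ ∑-distrib-+ (λ i → f (r i) * z ^ toℕ i) (λ i → - f (r i) * z ^ toℕ i) ⟨
    sum (λ i → f (r i) * z ^ toℕ i + - f (r i) * z ^ toℕ i)
      ≈⟨ sum-zero {N} (λ i → trans (sym (distribʳ _ _ _)) (trans (*-congʳ (-‿inverseʳ _)) (zeroˡ _))) ⟩
    0# ∎)
    where
    gens : ∀ k → Vector Carrier k
    gens k i = s * z ^ toℕ i

    gen∈ : ∀ {i k} → i ℕ.< k → s * z ^ i ∈ Span (gens k)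
    gen∈ {i} {k} i<k = Span.resp (gens k)
      (reflexive (≡.cong (λ m → s * z ^ m) (toℕ-fromℕ< i<k))) (generator∈Span (gens k) (fromℕ< i<k))

    mono : ∀ {k l} → k ℕ.≤ l → Span (gens k) ⊆ Span (gens l)
    mono {k} {l} k≤l = Span⊆ (Span-isSubmodule (gens l)) λ i → gen∈ (ℕ.≤-trans (toℕ<n i) k≤l)

    P : Pred Carrier _
    P x = ∃ λ k → x ∈ Span (gens k)

    P-isSub : IsSubmodule P
    P-isSub = record
      { resp      = λ e (k , p) → k , Span.resp (gens k) e p
      ; 0∈        = 0 , Span.0∈ (gens 0)
      ; +-closed  = λ (k , p) (l , q) → k ⊔ l ,
          Span.+-closed (gens (k ⊔ l)) (mono (ℕ.m≤m⊔n k l) p) (mono (ℕ.m≤n⊔m k l) q)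
      ; *ₗ-closed = λ r (k , p) → k , Span.*ₗ-closed (gens k) r p
      }

    module B = Basis (basis v P-isSub λ (k , p) →
      Span⊆ (Span-isSubmodule v) (λ i → powers∈ (toℕ i)) p)

    bound : ∀ {m} (w : Vector Carrier m) → (∀ i → w i ∈ P) → ∃ λ N → ∀ i → w i ∈ Span (gens N)
    bound {zero}  w w∈ = 0 , λ ()
    bound {suc m} w w∈ =
      let (k , p) = w∈ zero
          (l , q) = bound (tail w) (w∈ ∘ suc)
      in k ⊔ l , λ { zero → mono (ℕ.m≤m⊔n k l) p ; (suc i) → mono (ℕ.m≤n⊔m k l) (q i) }

    N = proj₁ (bound B.vector B.vector∈)

    -- `suc N` is the first stage that has `s * z ^ N` among its generators. As the whole union
    -- already lies in stage `N`, this power is a combination of lower ones.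
    szᴺ∈ : s * z ^ N ∈ Span (gens N)
    szᴺ∈ = Span⊆ (Span-isSubmodule (gens N)) (proj₂ (bound B.vector B.vector∈))
             (B.span (suc N , gen∈ ℕ.≤-refl))

    r = proj₁ szᴺ∈

    szᴺ≈ : s * z ^ N ≈ s * sum (λ i → f (r i) * z ^ toℕ i)
    szᴺ≈ = begin
      s * z ^ N                              ≈⟨ proj₂ szᴺ∈ ⟩
      sum (λ i → f (r i) * (s * z ^ toℕ i))  ≈⟨ sum-cong-≋ {N} (λ i → x∙yz≈y∙xz _ _ _) ⟩
      sum (λ i → s * (f (r i) * z ^ toℕ i))  ≈⟨ *-distribˡ-sum s (λ i → f (r i) * z ^ toℕ i) ⟨
      s * sum (λ i → f (r i) * z ^ toℕ i)    ∎
      where open SemiringSum semiring using (*-distribˡ-sum)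

  -- All `s * z ^ k` stay in the span, so `integral` applies. The start `s` need not be 1, because a
  -- module that spans only up to denominators may contain just a multiple of 1.
  integral-stable : ∀ {n} (v : Vector Carrier n) {s z} → ¬ s ≈ 0# → s ∈ Span v →
                    (∀ {y} → y ∈ Span v → z * y ∈ Span v) → z ∈ Integral
  integral-stable v {s} {z} s≉0 s∈ stable = integral v s s≉0 powers∈
    where
    powers∈ : ∀ k → s * z ^ k ∈ Span v
    powers∈ zero    = Span.resp v (sym (*-identityʳ s)) s∈
    powers∈ (suc k) = Span.resp v (x∙yz≈y∙xz z s _) (stable (powers∈ k))

  module _ {x : Carrier} where

    powers : ∀ n → Vector Carrier n
    powers n i = x ^ toℕ i

    module _ (x∈ : x ∈ Integral) where

      private
        n = proj₁ x∈
        a = proj₁ (proj₂ x∈)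
        eq = proj₂ (proj₂ x∈)

      -- The bound includes `k = n`, where the integral equation itself expresses the power. This is
      -- what makes the span stable under `x`, and it puts 1 into the span even for `n = 0`.
      integral⇒power∈ : ∀ {k} → k ℕ.≤ n → x ^ k ∈ Span (powers n)
      integral⇒power∈ {k} k≤n with ℕ.m≤n⇒m<n∨m≡n k≤n
      ... | inj₁ k<n = Span.resp (powers n)
        (reflexive (≡.cong (x ^_) (toℕ-fromℕ< k<n))) (generator∈Span (powers n) (fromℕ< k<n))
      ... | inj₂ ≡.refl = Span.resp (powers n) (begin
          - y                ≈⟨ +-identityˡ _ ⟨
          0# + - y           ≈⟨ +-congʳ eq ⟨
          x ^ n + y + - y    ≈⟨ +-assoc _ _ _ ⟩
          x ^ n + (y + - y)  ≈⟨ +-congˡ (-‿inverseʳ y) ⟩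
          x ^ n + 0#         ≈⟨ +-identityʳ _ ⟩
          x ^ n              ∎)
        (Span.neg-closed (powers n) (a , refl))
        where y = sum λ i → f (a i) * x ^ toℕ i

      integral⇒1∈ : 1# ∈ Span (powers n)
      integral⇒1∈ = integral⇒power∈ {zero} ℕ.z≤n

      integral⇒stable : ∀ {y} → y ∈ Span (powers n) → x * y ∈ Span (powers n)
      integral⇒stable = Span⊆ (preimage x (Span-isSubmodule (powers n)))
                              (λ i → integral⇒power∈ (toℕ<n i))

  infixl 7 _⊗_
  _⊗_ : ∀ {m n} → Vector Carrier m → Vector Carrier n → Vector Carrier (m ℕ.* n)
  _⊗_ {m} {n} v w k = let (i , j) = remQuot {m} n k in v i * w j

  *∈Span-⊗ : ∀ {m n} (v : Vector Carrier m) (w : Vector Carrier n) {x y} →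
             x ∈ Span v → y ∈ Span w → x * y ∈ Span (v ⊗ w)
  *∈Span-⊗ {m} {n} v w {x} {y} x∈ y∈ =
    resp (*-comm y x) (Span⊆ (preimage y vw) (λ i →
      resp (*-comm (v i) y) (Span⊆ (preimage (v i) vw) (λ j →
        resp (reflexive (≡.cong (λ (i , j) → v i * w j) (remQuot-combine {m} {n} i j)))
             (generator∈Span (v ⊗ w) (combine i j))) y∈)) x∈)
    where
    vw = Span-isSubmodule (v ⊗ w)
    open IsSubmodule vw using (resp)

  module _ {x y : Carrier} (x∈ : x ∈ Integral) (y∈ : y ∈ Integral) where

    private
      n = proj₁ x∈
      m = proj₁ y∈
      v = powers {x} n
      w = powers {y} m
      vw = Span-isSubmodule (v ⊗ w)
      open IsSubmodule vw

      1∈ : 1# ∈ Span (v ⊗ w)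
      1∈ = resp (*-identityʳ 1#) (*∈Span-⊗ v w (integral⇒1∈ x∈) (integral⇒1∈ y∈))

      x-stable : ∀ {z} → z ∈ Span (v ⊗ w) → x * z ∈ Span (v ⊗ w)
      x-stable = Span⊆ (preimage x vw) λ k → let (i , j) = remQuot {n} m k in
        resp (*-assoc x (v i) (w j))
          (*∈Span-⊗ v w (integral⇒stable x∈ (generator∈Span v i)) (generator∈Span w j))

      y-stable : ∀ {z} → z ∈ Span (v ⊗ w) → y * z ∈ Span (v ⊗ w)
      y-stable = Span⊆ (preimage y vw) λ k → let (i , j) = remQuot {n} m k in
        resp (x∙yz≈y∙xz (v i) y (w j))
          (*∈Span-⊗ v w (generator∈Span v i) (integral⇒stable y∈ (generator∈Span w j)))

    -- The products of powers of `x` and `y` span a module that contains 1 and is stable under both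
    -- elements, hence under their product and their sum.
    integral-* : x * y ∈ Integral
    integral-* = integral-stable (v ⊗ w) 1≉0 1∈ λ z∈ →
      resp (sym (*-assoc x y _)) (x-stable (y-stable z∈))

    integral-+ : x + y ∈ Integral
    integral-+ = integral-stable (v ⊗ w) 1≉0 1∈ λ z∈ →
      resp (sym (distribʳ _ x y)) (+-closed (x-stable z∈) (y-stable z∈))

  integral-resp : ∀ {x y} → x ≈ y → x ∈ Integral → y ∈ Integral
  integral-resp {x} {y} x≈y (n , a , e) = n , a , (begin
    y ^ n + sum (λ i → f (a i) * y ^ toℕ i)
      ≈⟨ +-cong (Exp.^-congˡ semiring n x≈y)
                (sum-cong-≋ {n} λ i → *-congˡ {f (a i)} (Exp.^-congˡ semiring (toℕ i) x≈y)) ⟨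
    x ^ n + sum (λ i → f (a i) * x ^ toℕ i)   ≈⟨ e ⟩
    0#                                        ∎)

  integral-f : ∀ r → f r ∈ Integral
  integral-f r = 1 , (λ _ → R.- r) , (begin
    f r * 1# + (f (R.- r) * 1# + 0#)   ≈⟨ +-cong (*-identityʳ _) (trans (+-identityʳ _) (*-identityʳ _)) ⟩
    f r + f (R.- r)                    ≈⟨ +-congˡ (-‿homo r) ⟩
    f r + - f r                        ≈⟨ -‿inverseʳ _ ⟩
    0#                                 ∎)

  integral-isSubmodule : IsSubmodule Integral
  integral-isSubmodule = record
    { resp      = integral-resp
    ; 0∈        = integral-resp 0#-homo (integral-f R.0#)
    ; +-closed  = integral-+
    ; *ₗ-closed = λ r → integral-* (integral-f r)
    }

  image-isSubmodule : IsSubmodule (λ x → ∃ λ r → x ≈ f r)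
  image-isSubmodule = record
    { resp      = λ x≈y (r , e) → r , trans (sym x≈y) e
    ; 0∈        = R.0# , sym 0#-homo
    ; +-closed  = λ (r , e) (s , e′) → r R.+ s , trans (+-cong e e′) (sym (+-homo r s))
    ; *ₗ-closed = λ a (r , e) → a R.* r , trans (*-congˡ e) (sym (*-homo a r))
    }

  -- Let M = R[x] and D M ⊆ R with D ≠ 0.  As x M ⊆ M, the element x
  -- multiplies the principal ideal D M into itself, so that x ∈ R.
  integrallyClosed : ∀ {x b a} → ¬ b R.≈ R.0# → f b * x ≈ f a → x ∈ Integral →
                     ∃ λ r → x ≈ f r
  integrallyClosed {x} {b} {a} b≉0 bx≈a x∈ =
    s , *-cancelˡ (f-nonzero c≉0) (begin
      f c * x          ≈⟨ *-comm _ _ ⟩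
      x * f c          ≈⟨ *-congˡ fc≈ ⟩
      x * (f D * y)    ≈⟨ x∙yz≈y∙xz _ _ _ ⟩
      f D * (x * y)    ≈⟨ proj₂ Dxy ⟩
      f (proj₁ Dxy)    ≈⟨ ⟦⟧-cong s≈ ⟩
      f (s R.* c)      ≈⟨ *-homo s c ⟩
      f s * f c        ≈⟨ *-comm _ _ ⟩
      f c * f s        ∎)
    where
    v = powers {x} (proj₁ x∈)

    image = λ z → ∃ λ r → z ≈ f r

    power-denominator : ∀ k → ∃ λ d → ¬ d R.≈ R.0# × f d * x ^ k ∈ image
    power-denominator zero    = R.1# , PID.1≉0 isPID , R.1# , *-identityʳ _
    power-denominator (suc k) =
      let (d , d≉0 , r , e) = power-denominator k
      in b R.* d , (λ bd≈0 → [ b≉0 , d≉0 ]′ (PID.domain isPID bd≈0)) , a R.* r , (begin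
        f (b R.* d) * (x * x ^ k)    ≈⟨ *-congʳ (*-homo b d) ⟩
        f b * f d * (x * x ^ k)      ≈⟨ interchange _ _ _ _ ⟩
        f b * x * (f d * x ^ k)      ≈⟨ *-cong bx≈a e ⟩
        f a * f r                    ≈⟨ *-homo a r ⟨
        f (a R.* r)                  ∎)

    common = commonMultiple image-isSubmodule v (power-denominator ∘ toℕ)
    D = proj₁ common

    DM⊆ : ∀ {z} → z ∈ Span v → f D * z ∈ image
    DM⊆ = Span⊆ (preimage (f D) image-isSubmodule) (proj₂ (proj₂ common))

    I : Pred R.Carrier _
    I r = ∃ λ y → y ∈ Span v × f r ≈ f D * y
    I-isIdeal : IsIdeal R I
    I-isIdeal = record
      { resp     = λ r≈s (y , y∈ , e) → y , y∈ , trans (⟦⟧-cong (R.sym r≈s)) e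
      ; 0∈       = 0# , Span.0∈ v , trans 0#-homo (sym (zeroʳ _))
      ; +-closed = λ (y , y∈ , e) (z , z∈ , e′) → y + z , Span.+-closed v y∈ z∈ ,
          trans (+-homo _ _) (trans (+-cong e e′) (sym (distribˡ _ _ _)))
      ; *-closed = λ r (y , y∈ , e) → f r * y , Span.*ₗ-closed v r y∈ ,
          trans (*-homo _ _) (trans (*-congˡ e) (x∙yz≈y∙xz _ _ _))
      }

    c = proj₁ (principal I I-isIdeal)
    c∈I = Equivalence.from (proj₂ (principal I I-isIdeal) c) (R.1# , R.sym (R.*-identityˡ c))
    y = proj₁ c∈I
    y∈ = proj₁ (proj₂ c∈I)
    fc≈ = proj₂ (proj₂ c∈I)

    Dxy = DM⊆ (integral⇒stable x∈ y∈)
    multiple = Equivalence.to (proj₂ (principal I I-isIdeal) (proj₁ Dxy))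
                 (x * y , integral⇒stable x∈ y∈ , sym (proj₂ Dxy))
    s = proj₁ multiple
    s≈ = proj₂ multiple

    c≉0 : ¬ c R.≈ R.0#
    -- `D` lies in the ideal because 1 lies in the span of `v`; a zero generator would make `D`
    -- vanish.
    c≉0 c≈0 =
      let (t , e) = Equivalence.to (proj₂ (principal I I-isIdeal) D)
                      (1# , integral⇒1∈ x∈ , sym (*-identityʳ _))
      in proj₁ (proj₂ common) (R.trans e (R.trans (R.*-congˡ c≈0) (R.zeroʳ t)))

  -- Clearing the denominators of the finitely many `x * v i` gives `a` for which `f a * x` maps the
  -- span of `v` into itself. No minimal polynomial enters. The starting vector is a multiple of 1.
  integralMultiple : ∀ {n} (v : Vector Carrier n) →
    (∀ x → ∃ λ a → ¬ a R.≈ R.0# × f a * x ∈ Span v) →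
    ∀ x → ∃ λ a → ¬ a R.≈ R.0# × f a * x ∈ Integral
  integralMultiple v spans x =
    let (a , a≉0 , a∈) = commonMultiple (Span-isSubmodule v) (λ i → x * v i) (λ i → spans (x * v i))
        (b , b≉0 , b∈) = spans 1#
    in a , a≉0 , integral-stable v (f-nonzero b≉0) (Span.resp v (*-identityʳ _) b∈)
         (Span⊆ (preimage (f a * x) (Span-isSubmodule v)) λ i →
            Span.resp v (sym (*-assoc _ _ _)) (a∈ i))

  module _ {g : Carrier → Carrier} (g-hom : RingMorphisms.IsRingHomomorphism rawRing rawRing g) where

    private module g = RingMorphisms.IsRingHomomorphism g-hom

    hom-^ : ∀ x n → g (x ^ n) ≈ g x ^ n
    hom-^ x zero    = g.1#-homo
    hom-^ x (suc n) = trans (g.*-homo x (x ^ n)) (*-congˡ (hom-^ x n))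

    hom-sum : ∀ {n} (v : Vector Carrier n) → g (sum v) ≈ sum (g ∘ v)
    hom-sum {zero}  v = g.0#-homo
    hom-sum {suc n} v = trans (g.+-homo _ _) (+-congˡ (hom-sum (tail v)))

    integral-hom : (∀ r → g (f r) ≈ f r) → ∀ {x} → x ∈ Integral → g x ∈ Integral
    integral-hom g-fixes {x} (n , a , e) = n , a , (begin
      g x ^ n + sum (λ i → f (a i) * g x ^ toℕ i)
        ≈⟨ +-cong (hom-^ x n) (trans (hom-sum (λ i → f (a i) * x ^ toℕ i)) (sum-cong-≋ λ i →
             trans (g.*-homo _ _) (*-cong (g-fixes (a i)) (hom-^ x (toℕ i))))) ⟨
      g (x ^ n) + g (sum λ i → f (a i) * x ^ toℕ i)
        ≈⟨ g.+-homo _ _ ⟨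
      g (x ^ n + sum λ i → f (a i) * x ^ toℕ i)
        ≈⟨ g.⟦⟧-cong e ⟩
      g 0#
        ≈⟨ g.0#-homo ⟩
      0# ∎)

module FieldProperties (excluded-middle : (P : Set u) → P ⊎ ¬ P) (F : HeytingField u u u) where

  open HeytingField F
  open CommutativeRing (toCommutativeRing F) using (ring)
  open RingProperties ring using (-0#≈0#)

  -- A Heyting field inverts elements apart from zero. Excluded middle and tightness turn inequality
  -- with zero into apartness.
  inverse : ∀ {x} → ¬ x ≈ 0# → ∃ λ y → x * y ≈ 1#
  inverse {x} x≉0 with excluded-middle (x # 0#)
  ... | inj₂ ¬x#0 = contradiction (proj₁ (tight x 0#) ¬x#0) x≉0
  ... | inj₁ x#0 = let (y , _ , e) = #⇒invertible x#0 in y , trans (sym (*-congʳ x-0≈x)) e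
    where
    x-0≈x : x - 0# ≈ x
    x-0≈x = trans (+-congˡ -0#≈0#) (+-identityʳ x)

  1≉0 : ¬ 1# ≈ 0#
  1≉0 1≈0 = proj₂ (tight 0# 0#) refl
    (invertible⇒# (0# , trans (zeroˡ _) (sym 1≈0) , trans (zeroʳ _) (sym 1≈0)))

-- Dual bases and the trace of a Galois extension

module Galois (S : SemidirectGaloisExtension u) where

  open SemidirectGaloisExtension S hiding (L/𝒪ᴷ)
  open PID isPID using (excluded-middle)

  f : 𝒪ᴷ.Carrier → L.Carrier
  f = j ∘ i

  private
    module i = RingMorphisms.IsRingMonomorphism (proj₁ isQuotientField)
    module j = RingMorphisms.IsRingHomomorphism j-hom
    module Kᶠ = FieldProperties excluded-middle K
    module Lᶠ = FieldProperties excluded-middle L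

  j-injective : ∀ {k} → j k L.≈ L.0# → k K.≈ K.0#
  j-injective {k} jk≈0 with excluded-middle (k K.≈ K.0#)
  ... | inj₁ k≈0 = k≈0
  ... | inj₂ k≉0 = let (k⁻¹ , e) = Kᶠ.inverse k≉0 in contradiction
    (L.trans (L.sym (L.trans (j.⟦⟧-cong e) j.1#-homo))
      (L.trans (j.*-homo k k⁻¹) (L.trans (L.*-congʳ jk≈0) (L.zeroˡ _))))
    Lᶠ.1≉0

  f-injective : ∀ {r} → f r L.≈ L.0# → r 𝒪ᴷ.≈ 𝒪ᴷ.0#
  f-injective e = i.injective (K.trans (j-injective e) (K.sym i.0#-homo))

  open Integrality {R = 𝒪ᴷ} {L = Lᶜ} 𝒪ᴷ→L-hom isPID f-injective Lᶠ.inverse public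
  open Submodules {R = 𝒪ᴷ} L/R public
  open RingMorphisms.IsRingHomomorphism 𝒪ᴷ→L-hom public
    using () renaming (⟦⟧-cong to f-cong; 0#-homo to f-0; +-homo to f-+; *-homo to f-*)
  open IsGaloisWithGroup isGalois public hiding (finite)
  open SemiringSum L.semiring using (*-distribˡ-sum; *-distribʳ-sum; ∑-comm)
  open CommutativeSemigroupProperties L.*-commutativeSemigroup using (interchange; x∙yz≈y∙xz)
  open SetoidReasoning L.setoid

  integralDenominator : ∀ x → ∃ λ a → ¬ a 𝒪ᴷ.≈ 𝒪ᴷ.0# × f a L.* x ∈ 𝒪ᴸ
  integralDenominator =
    let (n , v , spans) = IsGaloisWithGroup.finite isGalois
    in integralMultiple v λ x →
      let (c , e)        = spans x
          (a , a≉0 , a∈) = commonMultiple (Span-isSubmodule v) (λ m → j (c m) L.* v m) λ m →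
            let (num , den , den≉0 , e) = proj₂ isQuotientField (c m)
            in den , den≉0 , Span.resp v (begin
                 f num L.* v m                  ≈⟨ L.*-congʳ (j.⟦⟧-cong e) ⟨
                 j (c m K.* i den) L.* v m      ≈⟨ L.*-congʳ (j.*-homo (c m) (i den)) ⟩
                 j (c m) L.* f den L.* v m      ≈⟨ L.*-congʳ (L.*-comm _ _) ⟩
                 f den L.* j (c m) L.* v m      ≈⟨ L.*-assoc _ _ _ ⟩
                 f den L.* (j (c m) L.* v m)    ∎)
               (Span.*ₗ-closed v num (generator∈Span v m))
      in a , a≉0 , Span.resp v (begin
           sum (λ m → f a L.* (j (c m) L.* v m))   ≈⟨ *-distribˡ-sum (f a) (λ m → j (c m) L.* v m) ⟨
           f a L.* sum (λ m → j (c m) L.* v m)     ≈⟨ L.*-congˡ e ⟨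
           f a L.* x                               ∎)
         (Span.∑-closed v a∈)

  module • (g : G.Carrier) = RingMorphisms.IsRingIsomorphism (proj₁ (automorphism g))

  •-f : ∀ g r → (g • f r) L.≈ f r
  •-f g r = proj₂ (automorphism g) (i r)

  •-sum : ∀ g {n} (v : Vector L.Carrier n) → (g • sum v) L.≈ sum (λ k → g • v k)
  •-sum g = hom-sum (•.isRingHomomorphism g)

  •-inverse : ∀ g x → (g • ((g G.⁻¹) • x)) L.≈ x
  •-inverse g x = L.trans (L.sym (•-∙ g (g G.⁻¹) x)) (L.trans (•-congʳ (G.inverseʳ g) x) (•-ε x))

  𝒪ᴸ-• : ∀ g {x} → x ∈ 𝒪ᴸ → (g • x) ∈ 𝒪ᴸ
  𝒪ᴸ-• g = integral-hom (•.isRingHomomorphism g) (•-f g)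

  Tr : L.Carrier → L.Carrier
  Tr x = ∑ {G.setoid} G-finite (_• x)

  Tr-cong : ∀ {x y} → x L.≈ y → Tr x L.≈ Tr y
  Tr-cong e = ∑-cong {G.setoid} G-finite λ g → •.⟦⟧-cong g e

  Tr-fixed : ∀ g x → (g • Tr x) L.≈ Tr x
  Tr-fixed g x = begin
    (g • Tr x)                                    ≈⟨ •-sum g (λ k → Inverse.to (proj₂ G-finite) k • x) ⟩
    ∑ {G.setoid} G-finite (λ h → g • (h • x))     ≈⟨ ∑-cong {G.setoid} G-finite (λ h → •-∙ g h x) ⟨
    ∑ {G.setoid} G-finite (λ h → (g G.∙ h) • x)
      ≈⟨ ∑-reindex {G.setoid} {G.setoid} G-finite G-finite (leftMult G g) (_• x) (λ e → •-congʳ e x) ⟨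
    Tr x                                          ∎

  -- The trace is fixed by `G`, hence lies in `K`, and it is a sum of integral conjugates; `𝒪ᴷ` is
  -- integrally closed.
  Tr∈ : ∀ {x} → x ∈ 𝒪ᴸ → ∃ λ r → Tr x L.≈ f r
  Tr∈ {x} x∈ =
    let (k , Tr≈k)        = fixedField (Tr x) (λ g → Tr-fixed g x)
        (a , b , b≉0 , e) = proj₂ isQuotientField k
    in integrallyClosed b≉0 (begin
         f b L.* Tr x      ≈⟨ L.*-comm _ _ ⟩
         Tr x L.* f b      ≈⟨ L.*-congʳ Tr≈k ⟩
         j k L.* f b       ≈⟨ j.*-homo k (i b) ⟨
         j (k K.* i b)     ≈⟨ j.⟦⟧-cong e ⟩
         f a               ∎)
       (IsSubmodule.∑-closed integral-isSubmodule λ m → 𝒪ᴸ-• (Inverse.to (proj₂ G-finite) m) x∈)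

  -- The vectors `x`, `y` stand for the tensor `Σ xₖ ⊗ yₖ` in `L ⊗ L` over `K`. Its image under the
  -- classical map to functions on `G`, sending `x ⊗ y` to `g ↦ x g(y)`, is `ev x y`.
  ev : ∀ {n} → Vector L.Carrier n → Vector L.Carrier n → G.Carrier → L.Carrier
  ev x y g = sum λ k → x k L.* (g • y k)

  ev-cong : ∀ {n} (x y : Vector L.Carrier n) {g h} → g G.≈ h → ev x y g L.≈ ev x y h
  ev-cong {n} x y g≈h = sum-cong-≋ {n} λ k → L.*-congˡ (•-congʳ g≈h (y k))

  -- The map from `L ⊗ L` to functions on `G` is multiplicative, each `g` being a ring homomorphism.
  ev-⊗ : ∀ {m n} (x y : Vector L.Carrier m) (x′ y′ : Vector L.Carrier n) g →
         ev (x ⊗ x′) (y ⊗ y′) g L.≈ ev x y g L.* ev x′ y′ g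
  ev-⊗ {m} {n} x y x′ y′ g = begin
    ev (x ⊗ x′) (y ⊗ y′) g
      ≈⟨ sum-remQuot {m} {n} (λ k l → x k L.* x′ l L.* (g • (y k L.* y′ l))) ⟩
    (sum {m} λ k → sum {n} λ l → x k L.* x′ l L.* (g • (y k L.* y′ l)))
      ≈⟨ sum-cong-≋ {m} (λ k → sum-cong-≋ {n} λ l →
           L.trans (L.*-congˡ (•.*-homo g (y k) (y′ l))) (interchange _ _ _ _)) ⟩
    (sum {m} λ k → sum {n} λ l → x k L.* (g • y k) L.* (x′ l L.* (g • y′ l)))
      ≈⟨ sum-cong-≋ {m} (λ k → L.sym (*-distribˡ-sum (x k L.* (g • y k)) (λ l → x′ l L.* (g • y′ l)))) ⟩
    (sum {m} λ k → x k L.* (g • y k) L.* ev x′ y′ g)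
      ≈⟨ *-distribʳ-sum (ev x′ y′ g) (λ k → x k L.* (g • y k)) ⟨
    ev x y g L.* ev x′ y′ g
      ∎

  record Separates (P : Pred G.Carrier u) : Set u where
    field
      size : ℕ
      x y  : Vector L.Carrier size
      at-ε : ev x y G.ε L.≈ L.1#
      at-P : ∀ {g} → g ∈ P → ev x y g L.≈ L.0#

  -- For z with g z ≠ z, the function h ↦ (h z - g z) / (z - g z).
  separate₁ : ∀ g → Separates λ h → h G.≈ g × ¬ g G.≈ G.ε
  separate₁ g with excluded-middle (g G.≈ G.ε)
  -- An enumeration of `G` also lists the neutral element. There the predicate is empty, and the
  -- tensor `1 ⊗ 1` suffices.
  ... | inj₁ g≈ε = record
    { size = 1 ; x = λ _ → L.1# ; y = λ _ → L.1#
    ; at-ε = L.trans (L.+-identityʳ _) (L.trans (L.*-identityˡ _) (•.1#-homo G.ε))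
    ; at-P = λ (_ , g≉ε) → contradiction g≈ε g≉ε }
  ... | inj₂ g≉ε with excluded-middle (∃ λ z → ¬ (g • z) L.≈ z)
  ...   | inj₂ fixes = contradiction (faithful λ z → L.trans (fixed z) (L.sym (•-ε z))) g≉ε
    where
    fixed : ∀ z → (g • z) L.≈ z
    fixed z with excluded-middle ((g • z) L.≈ z)
    ... | inj₁ e = e
    ... | inj₂ z≉ = contradiction (z , z≉) fixes
  ...   | inj₁ (z , gz≉z) = record
    { size = 2
    ; x = x
    ; y = y
    ; at-ε = L.trans (value G.ε)
        (L.trans (L.*-congˡ (L.+-congʳ (•-ε z))) (L.trans (L.*-comm _ _) (proj₂ w-inv)))
    ; at-P = λ {h} (h≈g , _) → L.trans (value h) (L.trans
        (L.*-congˡ (L.trans (L.+-congʳ (•-congʳ h≈g z)) (L.-‿inverseʳ _))) (L.zeroʳ _))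
    }
    where
    open RingProperties L.ring using (x[y-z]≈xy-xz)
    open GroupProperties L.+-group using (x∙y⁻¹≈ε⇒x≈y)
    w-inv = Lᶠ.inverse {z L.- (g • z)} (λ e → gz≉z (L.sym (x∙y⁻¹≈ε⇒x≈y _ _ e)))
    w = proj₁ w-inv
    x y : Vector L.Carrier 2
    x = w Vector.∷ L.- (w L.* (g • z)) Vector.∷ Vector.[]
    y = z Vector.∷ L.1# Vector.∷ Vector.[]
    value : ∀ h → ev x y h L.≈ w L.* ((h • z) L.- (g • z))
    value h = begin
      w L.* (h • z) L.+ (L.- (w L.* (g • z)) L.* (h • L.1#) L.+ L.0#)
        ≈⟨ L.+-congˡ (L.trans (L.+-identityʳ _) (L.trans (L.*-congˡ (•.1#-homo h)) (L.*-identityʳ _))) ⟩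
      w L.* (h • z) L.- w L.* (g • z)
        ≈⟨ x[y-z]≈xy-xz _ _ _ ⟨
      w L.* ((h • z) L.- (g • z)) ∎

  -- The product of the functions from `separate₁` is 1 at the neutral element and vanishes at every
  -- other listed element. For a full enumeration of `G` this represents an idempotent of `L ⊗ L`.
  separate : ∀ {m} (gs : Vector G.Carrier m) →
             Separates λ h → ¬ h G.≈ G.ε × ∃ λ k → h G.≈ gs k
  separate {zero}  gs = record
    { size = 1 ; x = λ _ → L.1# ; y = λ _ → L.1#
    ; at-ε = L.trans (L.+-identityʳ _) (L.trans (L.*-identityˡ _) (•.1#-homo G.ε))
    ; at-P = λ () }
  separate {suc m} gs = record
    { size = A.size ℕ.* B.size ; x = A.x ⊗ B.x ; y = A.y ⊗ B.y
    ; at-ε = L.trans (ev-⊗ A.x A.y B.x B.y G.ε) (L.trans (L.*-cong A.at-ε B.at-ε) (L.*-identityˡ _))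
    ; at-P = λ { {h} (h≉ε , zero , h≈g) → L.trans (ev-⊗ A.x A.y B.x B.y h)
                   (L.trans (L.*-congʳ (A.at-P (h≈g , λ g≈ε → h≉ε (G.trans h≈g g≈ε)))) (L.zeroˡ _))
               ; {h} (h≉ε , suc k , h≈g) → L.trans (ev-⊗ A.x A.y B.x B.y h)
                   (L.trans (L.*-congˡ (B.at-P (h≉ε , k , h≈g))) (L.zeroʳ _)) }
    }
    where
    module A = Separates (separate₁ (gs zero))
    module B = Separates (separate (tail gs))

  private
    module D = Separates (separate (Inverse.to (proj₂ G-finite)))

  dim : ℕ
  dim = D.size

  -- They behave like a basis and its dual for the trace form: `z = Σ 𝐱ₖ Tr(𝐲ₖ z)`. They need not be
  -- independent, and `dim` counts the terms of the separating tensor, which in general is not the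
  -- degree of `L/K`.
  𝐱 𝐲 : Vector L.Carrier dim
  𝐱 = D.x
  𝐲 = D.y

  private
    dual-shift : ∀ g h → sum (λ k → (g • 𝐱 k) L.* (h • 𝐲 k)) L.≈ (g • ev 𝐱 𝐲 (g G.⁻¹ G.∙ h))
    dual-shift g h = L.sym (L.trans (•-sum g (λ k → 𝐱 k L.* ((g G.⁻¹ G.∙ h) • 𝐲 k)))
      (sum-cong-≋ {dim} λ k → L.trans (•.*-homo g _ _) (L.*-congˡ (begin
        (g • ((g G.⁻¹ G.∙ h) • 𝐲 k))     ≈⟨ •-∙ g _ _ ⟨
        ((g G.∙ (g G.⁻¹ G.∙ h)) • 𝐲 k)   ≈⟨ •-congʳ (\\-leftDividesˡ g h) (𝐲 k) ⟩
        (h • 𝐲 k)                        ∎))))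
      where open GroupProperties G using (\\-leftDividesˡ)

  dual-≈ : ∀ {g h} → g G.≈ h → sum (λ k → (g • 𝐱 k) L.* (h • 𝐲 k)) L.≈ L.1#
  dual-≈ {g} {h} g≈h = L.trans (dual-shift g h) (L.trans (•.⟦⟧-cong g (L.trans
    (ev-cong 𝐱 𝐲 (G.trans (G.∙-congˡ (G.sym g≈h)) (G.inverseˡ g))) D.at-ε)) (•.1#-homo g))

  dual-≉ : ∀ {g h} → ¬ h G.≈ g → sum (λ k → (g • 𝐱 k) L.* (h • 𝐲 k)) L.≈ L.0#
  dual-≉ {g} {h} h≉g = L.trans (dual-shift g h) (L.trans (•.⟦⟧-cong g (D.at-P
    ( (λ e → h≉g (G.trans (inverseʳ-unique _ _ e) (⁻¹-involutive g)))
    , Inverse.from (proj₂ G-finite) _ , G.sym (Inverse.strictlyInverseˡ (proj₂ G-finite) _) )))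
    (•.0#-homo g))
    where open GroupProperties G using (inverseʳ-unique; ⁻¹-involutive)

  dualDenominator : ∃ λ d → ¬ d 𝒪ᴷ.≈ 𝒪ᴷ.0# × ∀ k → f d L.* 𝐲 k ∈ 𝒪ᴸ
  dualDenominator = commonMultiple integral-isSubmodule 𝐲 (integralDenominator ∘ 𝐲)

  d : 𝒪ᴷ.Carrier
  d = proj₁ dualDenominator

  fd⁻¹ : L.Carrier
  fd⁻¹ = proj₁ (Lᶠ.inverse (f-nonzero (proj₁ (proj₂ dualDenominator))))

  fd⁻¹-cancel : ∀ z → fd⁻¹ L.* (f d L.* z) L.≈ z
  fd⁻¹-cancel z = L.trans (L.sym (L.*-assoc _ _ _)) (L.trans
    (L.*-congʳ (L.trans (L.*-comm _ _) (proj₂ (Lᶠ.inverse (f-nonzero (proj₁ (proj₂ dualDenominator)))))))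
    (L.*-identityˡ z))

  dy∈ : ∀ k → f d L.* 𝐲 k ∈ 𝒪ᴸ
  dy∈ = proj₂ (proj₂ dualDenominator)

  pointwise-sum : {T : Setoid u u} → let module M = LeftModule (pointwise {R = 𝒪ᴷ} T L/R) in
    ∀ {n} (v : Vector M.Carrierᴹ n) t →
    Func.to (Sum.sum M.+ᴹ-commutativeMonoid v) t L.≈ sum λ k → Func.to (v k) t
  pointwise-sum {n = zero}  v t = L.refl
  pointwise-sum {n = suc n} v t = L.+-congˡ (pointwise-sum (tail v) t)

  -- A common frame for the three Hopf actions: with `κ` sending `η` to the preimage of the neutral
  -- element under `η`, the action in `HopfGalois` unfolds to `_⊙_`.
  module Coefficients {T : Setoid u u} (fin : Finite T) (κ : Setoid.Carrier T → G.Carrier)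
    (κ-cong : ∀ s t → Setoid._≈_ T s t → κ s G.≈ κ t)
    (κ-injective : ∀ s t → κ s G.≈ κ t → Setoid._≈_ T s t) where

    private module T = Setoid T

    infixr 8 _⊙_
    _⊙_ : Func T L.setoid → L.Carrier → L.Carrier
    c ⊙ x = ∑ {T} fin λ t → Func.to c t L.* (κ t • x)

    ⊙-congʳ : ∀ {c c′} x → (∀ t → Func.to c t L.≈ Func.to c′ t) → c ⊙ x L.≈ c′ ⊙ x
    ⊙-congʳ x e = ∑-cong {T} fin λ t → L.*-congʳ {κ t • x} (e t)

    ⊙-congˡ : ∀ c {x y} → x L.≈ y → c ⊙ x L.≈ c ⊙ y
    ⊙-congˡ c e = ∑-cong {T} fin λ t → L.*-congˡ {Func.to c t} (•.⟦⟧-cong (κ t) e)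

    ⊙-+ : ∀ c x y → c ⊙ (x L.+ y) L.≈ c ⊙ x L.+ c ⊙ y
    ⊙-+ c x y = L.trans
      (∑-cong {T} fin λ t →
        L.trans (L.*-congˡ {Func.to c t} (•.+-homo (κ t) x y)) (L.distribˡ _ (κ t • x) (κ t • y)))
      (∑-distrib-+ (λ m → Func.to c (to m) L.* (κ (to m) • x)) (λ m → Func.to c (to m) L.* (κ (to m) • y)))
      where to = Inverse.to (proj₂ fin)

    ⊙-0 : ∀ c → c ⊙ L.0# L.≈ L.0#
    ⊙-0 c = sum-zero {proj₁ fin} λ m →
      L.trans (L.*-congˡ {Func.to c (to m)} (•.0#-homo (κ (to m)))) (L.zeroʳ _)
      where to = Inverse.to (proj₂ fin)

    ⊙-*-fixed : ∀ c x {z} → (∀ t → (κ t • z) L.≈ z) → c ⊙ (x L.* z) L.≈ (c ⊙ x) L.* z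
    ⊙-*-fixed c x {z} fixed = L.trans
      (∑-cong {T} fin λ t → L.trans
        (L.*-congˡ {Func.to c t} (L.trans (•.*-homo (κ t) x z) (L.*-congˡ {κ t • x} (fixed t))))
        (L.sym (L.*-assoc _ _ _)))
      (L.sym (*-distribʳ-sum z λ m → Func.to c (to m) L.* (κ (to m) • x)))
      where to = Inverse.to (proj₂ fin)

    ⊙-f : ∀ c a x → c ⊙ (f a L.* x) L.≈ f a L.* (c ⊙ x)
    ⊙-f c a x = L.trans (⊙-congˡ c (L.*-comm _ _))
      (L.trans (⊙-*-fixed c x (λ t → •-f (κ t) a)) (L.*-comm _ _))

    ⊙-distribʳ : ∀ {c c′ c″} x → (∀ t → Func.to c″ t L.≈ Func.to c t L.+ Func.to c′ t) →
                 c″ ⊙ x L.≈ c ⊙ x L.+ c′ ⊙ x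
    ⊙-distribʳ {c} {c′} {c″} x e = L.trans
      (∑-cong {T} fin λ t → L.trans (L.*-congʳ {κ t • x} (e t)) (L.distribʳ _ _ _))
      (∑-distrib-+ (λ m → Func.to c (to m) L.* (κ (to m) • x)) (λ m → Func.to c′ (to m) L.* (κ (to m) • x)))
      where to = Inverse.to (proj₂ fin)

    ⊙-scale : ∀ {c c′} a x → (∀ t → Func.to c′ t L.≈ a L.* Func.to c t) →
              c′ ⊙ x L.≈ a L.* (c ⊙ x)
    ⊙-scale {c} a x e = L.trans
      (∑-cong {T} fin λ t → L.trans (L.*-congʳ {κ t • x} (e t)) (L.*-assoc _ _ _))
      (L.sym (*-distribˡ-sum a λ m → Func.to c (to m) L.* (κ (to m) • x)))
      where to = Inverse.to (proj₂ fin)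

    -- Exchanging the sums leaves `Σₛ c(s) Σₖ κ(t)(𝐱ₖ) κ(s)(𝐲ₖ)`, and duality together with
    -- injectivity of `κ` keeps only `s = t`. This is Dedekind independence of automorphisms in
    -- explicit form.
    coefficient : ∀ c t → Func.to c t L.≈ sum λ k → (κ t • 𝐱 k) L.* (c ⊙ 𝐲 k)
    coefficient c t = L.sym (begin
      sum (λ k → (κ t • 𝐱 k) L.* (c ⊙ 𝐲 k))
        ≈⟨ sum-cong-≋ {dim} (λ k → *-distribˡ-sum (κ t • 𝐱 k) (λ m → Func.to c (to m) L.* (κ (to m) • 𝐲 k))) ⟩
      (sum {dim} λ k → ∑ {T} fin λ s → (κ t • 𝐱 k) L.* (Func.to c s L.* (κ s • 𝐲 k)))
        ≈⟨ ∑-comm {dim} {proj₁ fin} (λ k m → (κ t • 𝐱 k) L.* (Func.to c (to m) L.* (κ (to m) • 𝐲 k))) ⟩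
      (∑ {T} fin λ s → sum {dim} λ k → (κ t • 𝐱 k) L.* (Func.to c s L.* (κ s • 𝐲 k)))
        ≈⟨ ∑-cong {T} fin (λ s → L.trans (sum-cong-≋ {dim} (λ k → x∙yz≈y∙xz _ _ _))
             (L.sym (*-distribˡ-sum (Func.to c s) (λ k → (κ t • 𝐱 k) L.* (κ s • 𝐲 k))))) ⟩
      (∑ {T} fin λ s → Func.to c s L.* sum {dim} λ k → (κ t • 𝐱 k) L.* (κ s • 𝐲 k))
        ≈⟨ ∑-single {T} fin t
             (λ e → L.*-cong (Func.cong c e)
               (sum-cong-≋ {dim} λ k → L.*-congˡ (•-congʳ (κ-cong _ _ e) (𝐲 k))))
             (λ s s≉t → L.trans (L.*-congˡ (dual-≉ (s≉t ∘ κ-injective s t))) (L.zeroʳ _)) ⟩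
      Func.to c t L.* sum (λ k → (κ t • 𝐱 k) L.* (κ t • 𝐲 k))
        ≈⟨ L.trans (L.*-congˡ (dual-≈ G.refl)) (L.*-identityʳ _) ⟩
      Func.to c t ∎)
      where to = Inverse.to (proj₂ fin)

    ⊙-𝐲 : ∀ c k → c ⊙ 𝐲 k L.≈ fd⁻¹ L.* (c ⊙ (f d L.* 𝐲 k))
    ⊙-𝐲 c k = L.trans (L.sym (fd⁻¹-cancel _)) (L.*-congˡ (L.sym (⊙-f c d (𝐲 k))))

    ⊙-faithful : ∀ c → (∀ {x} → x ∈ 𝒪ᴸ → c ⊙ x L.≈ L.0#) → ∀ t → Func.to c t L.≈ L.0#
    ⊙-faithful c c⊙≈0 t = L.trans (coefficient c t) (sum-zero {dim} λ k → L.trans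
      (L.*-congˡ (L.trans (⊙-𝐲 c k) (L.trans (L.*-congˡ (c⊙≈0 (dy∈ k))) (L.zeroʳ _)))) (L.zeroʳ _))

  𝐰 : Vector L.Carrier dim
  𝐰 k = 𝐱 k L.* fd⁻¹

  -- For `c(g) = g • z` one has `c ⊙ y = Tr(z y)`, and `coefficient` at the neutral element reads
  -- `z = Σ 𝐰ₖ Tr(z d 𝐲ₖ)`. These traces lie in `𝒪ᴷ`.
  𝒪ᴸ⊆Span : 𝒪ᴸ ⊆ Span 𝐰
  𝒪ᴸ⊆Span {z} z∈ = Span.resp 𝐰 (L.sym (begin
      z                                                ≈⟨ •-ε z ⟨
      (G.ε • z)                                        ≈⟨ coefficient c G.ε ⟩
      sum (λ k → (G.ε • 𝐱 k) L.* (c ⊙ 𝐲 k))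
        ≈⟨ sum-cong-≋ {dim} (λ k → L.*-cong (•-ε (𝐱 k)) (⊙-𝐲 c k)) ⟩
      sum (λ k → 𝐱 k L.* (fd⁻¹ L.* (c ⊙ (f d L.* 𝐲 k)))) ∎))
    (Span.∑-closed 𝐰 λ k →
      let (r , e) = Tr∈ (integral-* z∈ (dy∈ k)) in
      Span.resp 𝐰 (begin
        f r L.* (𝐱 k L.* fd⁻¹)                       ≈⟨ L.*-comm _ _ ⟩
        𝐱 k L.* fd⁻¹ L.* f r                         ≈⟨ L.*-assoc _ _ _ ⟩
        𝐱 k L.* (fd⁻¹ L.* f r)                       ≈⟨ L.*-congˡ (L.*-congˡ (L.trans (c⊙ _) e)) ⟨
        𝐱 k L.* (fd⁻¹ L.* (c ⊙ (f d L.* 𝐲 k)))       ∎)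
      (Span.*ₗ-closed 𝐰 r (generator∈Span 𝐰 k)))
    where
    open Coefficients {G.setoid} G-finite id (λ _ _ → id) (λ _ _ → id)
    c : Func G.setoid L.setoid
    c = record { to = _• z ; cong = λ e → •-congʳ e z }
    c⊙ : ∀ y → c ⊙ y L.≈ Tr (z L.* y)
    c⊙ y = ∑-cong {G.setoid} G-finite λ g → L.sym (•.*-homo g z y)

  module Lattices {T : Setoid u u} (fin : Finite T) (κ : Setoid.Carrier T → G.Carrier)
    (κ-cong : ∀ s t → Setoid._≈_ T s t → κ s G.≈ κ t)
    (κ-injective : ∀ s t → κ s G.≈ κ t → Setoid._≈_ T s t) where

    open Coefficients {T} fin κ κ-cong κ-injective public
    private
      module T = Setoid T
      module M = Submodules {R = 𝒪ᴷ} (pointwise {R = 𝒪ᴷ} T L/R)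
      N = proj₁ fin
      open Inverse (proj₂ fin)

    indicator : Fin N → Fin N → L.Carrier
    indicator m n with m ≟ n
    ... | yes _ = L.1#
    ... | no  _ = L.0#

    indicator-≡ : ∀ m → indicator m m L.≈ L.1#
    indicator-≡ m with m ≟ m
    ... | yes _  = L.refl
    ... | no m≢m = contradiction ≡.refl m≢m

    indicator-≢ : ∀ {m n} → ¬ m ≡ n → indicator m n L.≈ L.0#
    indicator-≢ {m} {n} m≢n with m ≟ n
    ... | yes m≡n = contradiction m≡n m≢n
    ... | no _    = L.refl

    δ : Fin N → L.Carrier → Func T L.setoid
    δ m y = record
      { to   = λ t → indicator m (from t) L.* y
      ; cong = λ e → L.reflexive (≡.cong (λ n → indicator m n L.* y) (from-cong e))
      }

    expand : ∀ (c : Func T L.setoid) t → sum (λ m → Func.to (δ m (Func.to c (to m))) t) L.≈ Func.to c t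
    expand c t = begin
      sum (λ m → indicator m (from t) L.* Func.to c (to m))
        ≈⟨ sum-single {N} (from t) (λ m m≢ → L.trans (L.*-congʳ (indicator-≢ m≢)) (L.zeroˡ _)) ⟩
      indicator (from t) (from t) L.* Func.to c (to (from t))
        ≈⟨ L.trans (L.*-congʳ (indicator-≡ (from t))) (L.*-identityˡ _) ⟩
      Func.to c (to (from t))
        ≈⟨ Func.cong c (strictlyInverseˡ t) ⟩
      Func.to c t ∎

    private
      coeffs : Fin N → Vector L.Carrier (dim ℕ.* dim)
      coeffs m = (λ k → (κ (to m) • 𝐱 k) L.* fd⁻¹) ⊗ 𝐰

    lattice : Vector (Func T L.setoid) (N ℕ.* (dim ℕ.* dim))
    lattice p = let (m , q) = remQuot {N} (dim ℕ.* dim) p in δ m (coeffs m q)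

    -- By `coefficient`, `c(t)` is a combination of the values `c ⊙ d 𝐲ₖ`. These are integral, hence
    -- in the span of `𝐰`, so each `c(t)` lies in a finitely generated module depending on `t`
    -- alone.
    stable⇒∈lattice : ∀ {c} → (∀ {x} → x ∈ 𝒪ᴸ → c ⊙ x ∈ 𝒪ᴸ) → c ∈ M.Span lattice
    stable⇒∈lattice {c} stable =
      resp {M.sum λ m → δ m (Func.to c (to m))} {c}
        (λ t → L.trans (pointwise-sum {T} (λ m → δ m (Func.to c (to m))) t) (expand c t))
        (∑-closed {_} {λ m → δ m (Func.to c (to m))} λ m →
          Span⊆ (δ-preimage m) (generator m) (value∈ m))
      where
      open M.IsSubmodule (M.Span-isSubmodule lattice)
      open LeftModule (pointwise {R = 𝒪ᴷ} T L/R) using (0ᴹ; _+ᴹ_; _*ₗ_)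

      value∈ : ∀ m → Func.to c (to m) ∈ Span (coeffs m)
      value∈ m = Span.resp (coeffs m)
        (L.sym (L.trans (coefficient c (to m)) (sum-cong-≋ {dim} λ k →
          L.trans (L.*-congˡ (⊙-𝐲 c k)) (L.sym (L.*-assoc _ _ _)))))
        (Span.∑-closed (coeffs m) λ k →
          *∈Span-⊗ (λ k → (κ (to m) • 𝐱 k) L.* fd⁻¹) 𝐰
            (generator∈Span (λ k → (κ (to m) • 𝐱 k) L.* fd⁻¹) k) (𝒪ᴸ⊆Span (stable (dy∈ k))))

      δ-preimage : ∀ m → IsSubmodule (λ y → δ m y ∈ M.Span lattice)
      δ-preimage m = record
        { resp      = λ {x} {y} e → resp {δ m x} {δ m y} λ t → L.*-congˡ e
        ; 0∈        = resp {0ᴹ} {δ m L.0#} (λ t → L.sym (L.zeroʳ _)) 0∈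
        ; +-closed  = λ {x} {y} p q →
            resp {δ m x +ᴹ δ m y} {δ m (x L.+ y)} (λ t → L.sym (L.distribˡ _ x y))
              (+-closed {δ m x} {δ m y} p q)
        ; *ₗ-closed = λ r {x} p →
            resp {r *ₗ δ m x} {δ m (f r L.* x)} (λ t → x∙yz≈y∙xz (f r) _ x)
              (*ₗ-closed r {δ m x} p)
        }

      generator : ∀ m q → δ m (coeffs m q) ∈ M.Span lattice
      generator m q = ≡.subst (λ (m , q) → δ m (coeffs m q) ∈ M.Span lattice)
        (remQuot-combine {N} {dim ℕ.* dim} m q) (M.generator∈Span lattice (combine m q))

-- Tensor products of submodules

module Coordinates {R : CommutativeRing u u} {M : LeftModule (CommutativeRing.ring R) u u}
  {P : Pred (LeftModule.Carrierᴹ M) u} (basis : Submodules.Basis {R = R} M P) where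

  private module R = CommutativeRing R
  open LeftModule M
  open Submodules {R = R} M
  open Basis basis
  open SetoidReasoning ≈ᴹ-setoid

  lin-injective : ∀ r s → lin r vector ≈ᴹ lin s vector → ∀ i → r i R.≈ s i
  lin-injective r s e i = x∙y⁻¹≈ε⇒x≈y (r i) (s i) (independent (λ i → r i R.- s i) (begin
    lin (λ i → r i R.- s i) vector                          ≈⟨ lin-+ r (R.-_ ∘ s) vector ⟨
    lin r vector +ᴹ lin (R.-_ ∘ s) vector                   ≈⟨ +ᴹ-congʳ e ⟩
    lin s vector +ᴹ lin (R.-_ ∘ s) vector                   ≈⟨ lin-+ s (R.-_ ∘ s) vector ⟩
    lin (λ i → s i R.- s i) vector
      ≈⟨ sum-zero {rank} (λ i → ≈ᴹ-trans (*ₗ-congʳ (R.-‿inverseʳ (s i))) (*ₗ-zeroˡ (vector i))) ⟩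
    0ᴹ                                                      ∎) i)
    where open GroupProperties R.+-group using (x∙y⁻¹≈ε⇒x≈y)

  -- The coordinates are read off the proof of membership; by independence they depend only on the
  -- element.
  coord : ∃ P → Vector R.Carrier rank
  coord (x , x∈) = proj₁ (span x∈)

  coord-lin : ∀ x → proj₁ x ≈ᴹ lin (coord x) vector
  coord-lin (x , x∈) = proj₂ (span x∈)

  coord-unique : ∀ x r → proj₁ x ≈ᴹ lin r vector → ∀ i → coord x i R.≈ r i
  coord-unique x r e = lin-injective (coord x) r (≈ᴹ-trans (≈ᴹ-sym (coord-lin x)) e)

  coord-cong : ∀ x y → proj₁ x ≈ᴹ proj₁ y → ∀ i → coord x i R.≈ coord y i
  coord-cong x y e = coord-unique x (coord y) (≈ᴹ-trans e (coord-lin y))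

  coord-+ : ∀ x y z → proj₁ z ≈ᴹ proj₁ x +ᴹ proj₁ y → ∀ i → coord z i R.≈ coord x i R.+ coord y i
  coord-+ x y z e = coord-unique z (λ i → coord x i R.+ coord y i)
    (≈ᴹ-trans e (≈ᴹ-trans (+ᴹ-cong (coord-lin x) (coord-lin y)) (lin-+ (coord x) (coord y) vector)))

  coord-* : ∀ r x y → proj₁ y ≈ᴹ r *ₗ proj₁ x → ∀ i → coord y i R.≈ r R.* coord x i
  coord-* r x y e = coord-unique y (λ i → r R.* coord x i)
    (≈ᴹ-trans e (≈ᴹ-trans (*ₗ-congˡ (coord-lin x)) (*ₗ-lin r (coord x) vector)))

  coord-0 : ∀ x → proj₁ x ≈ᴹ 0ᴹ → ∀ i → coord x i R.≈ R.0#
  coord-0 x e = coord-unique x (λ _ → R.0#)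
    (≈ᴹ-trans e (≈ᴹ-sym (sum-zero {rank} λ i → *ₗ-zeroˡ (vector i))))

module TensorFold {R : CommutativeRing u u} {M N : LeftModule (CommutativeRing.ring R) u u}
  {A : Pred (LeftModule.Carrierᴹ M) u} {B : Pred (LeftModule.Carrierᴹ N) u} where

  private
    module M = LeftModule M
    module N = LeftModule N
  open Tensor R M N A B

  commutativeMonoid : CommutativeMonoid u u
  commutativeMonoid = record
    { Carrier = FormalSum ; _≈_ = _~_ ; _∙_ = _++_ ; ε = []
    ; isCommutativeMonoid = record
      { isMonoid = record
        { isSemigroup = record
          { isMagma = record
            { isEquivalence = record { refl = refl ; sym = sym ; trans = trans }
            ; ∙-cong = ++-cong
            }
          ; assoc = λ s t w → ≡⇒~ (++-assoc s t w)
          }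
        ; identity = (λ s → refl) , λ s → ≡⇒~ (++-identityʳ s)
        }
      ; comm = ++-comm
      }
    }
    where
    ≡⇒~ : ∀ {s t} → s ≡ t → s ~ t
    ≡⇒~ ≡.refl = refl

  -- Unlike in `extend`, the map may use the proofs of membership, as coordinates and `lift` do, and
  -- the target may be any commutative monoid, in particular another tensor product.
  module Fold (T : CommutativeMonoid u u) (φ : ∃ A → ∃ B → CommutativeMonoid.Carrier T) where

    private module T = CommutativeMonoid T

    fold : FormalSum → T.Carrier
    fold = foldr T._∙_ T.ε ∘ map λ (a , b) → φ a b

    fold-++ : ∀ s t → fold (s ++ t) T.≈ fold s T.∙ fold t
    fold-++ []      t = T.sym (T.identityˡ _)
    fold-++ (x ∷ s) t = T.trans (T.∙-congˡ (fold-++ s t)) (T.sym (T.assoc _ _ _))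

    fold-sum : ∀ {n} (v : Vector FormalSum n) →
               fold (Sum.sum commutativeMonoid v) T.≈ Sum.sum T (fold ∘ v)
    fold-sum {zero}  v = T.refl
    fold-sum {suc n} v = T.trans (fold-++ (v zero) (Sum.sum commutativeMonoid (tail v)))
                                 (T.∙-congˡ (fold-sum (tail v)))

    fold-closed : (P : Pred T.Carrier u) → T.ε ∈ P → (∀ {x y} → x ∈ P → y ∈ P → x T.∙ y ∈ P) →
                  (∀ a b → φ a b ∈ P) → ∀ s → fold s ∈ P
    fold-closed P ε∈ ∙∈ φ∈ []            = ε∈
    fold-closed P ε∈ ∙∈ φ∈ ((a , b) ∷ s) = ∙∈ (φ∈ a b) (fold-closed P ε∈ ∙∈ φ∈ s)

    record IsBalanced : Set u where
      field
        φ-cong : ∀ {a a′ b b′} → proj₁ a M.≈ᴹ proj₁ a′ → proj₁ b N.≈ᴹ proj₁ b′ →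
                 φ a b T.≈ φ a′ b′
        φ-+ˡ   : ∀ {a₁ a₂ a b} → proj₁ a M.≈ᴹ proj₁ a₁ M.+ᴹ proj₁ a₂ →
                 φ a b T.≈ φ a₁ b T.∙ φ a₂ b
        φ-+ʳ   : ∀ {a b₁ b₂ b} → proj₁ b N.≈ᴹ proj₁ b₁ N.+ᴹ proj₁ b₂ →
                 φ a b T.≈ φ a b₁ T.∙ φ a b₂
        φ-0ˡ   : ∀ {a b} → proj₁ a M.≈ᴹ M.0ᴹ → φ a b T.≈ T.ε
        φ-0ʳ   : ∀ {a b} → proj₁ b N.≈ᴹ N.0ᴹ → φ a b T.≈ T.ε
        φ-bal  : ∀ r {a ra b rb} → proj₁ ra M.≈ᴹ r M.*ₗ proj₁ a → proj₁ rb N.≈ᴹ r N.*ₗ proj₁ b →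
                 φ ra b T.≈ φ a rb

    module _ (balanced : IsBalanced) where

      open IsBalanced balanced

      fold-cong : ∀ {s t} → s ~ t → fold s T.≈ fold t
      fold-cong refl          = T.refl
      fold-cong (sym p)       = T.sym (fold-cong p)
      fold-cong (trans p q)   = T.trans (fold-cong p) (fold-cong q)
      fold-cong (++-cong {s} {s′} {t} {t′} p q) = T.trans (fold-++ s t)
        (T.trans (T.∙-cong (fold-cong p) (fold-cong q)) (T.sym (fold-++ s′ t′)))
      fold-cong (++-comm s t) = T.trans (fold-++ s t) (T.trans (T.comm _ _) (T.sym (fold-++ t s)))
      fold-cong (cong e e′)   = T.∙-congʳ (φ-cong e e′)
      fold-cong (+ˡ e)        = T.trans (T.∙-congʳ (φ-+ˡ e)) (T.assoc _ _ _)
      fold-cong (+ʳ e)        = T.trans (T.∙-congʳ (φ-+ʳ e)) (T.assoc _ _ _)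
      fold-cong (0ˡ e)        = T.trans (T.identityʳ _) (φ-0ˡ e)
      fold-cong (0ʳ e)        = T.trans (T.identityʳ _) (φ-0ʳ e)
      fold-cong (balance r e e′) = T.∙-congʳ (φ-bal r e e′)

  module _ (A-isSubmodule : Submodules.IsSubmodule {R = R} M A)
           (B-isSubmodule : Submodules.IsSubmodule {R = R} N B) where

    private
      module A = Submodules.IsSubmodule A-isSubmodule
      module B = Submodules.IsSubmodule B-isSubmodule
      module T = CommutativeMonoid commutativeMonoid
    open Sum commutativeMonoid using (sum; sum-cong-≋; ∑-distrib-+)
    open FiniteSum commutativeMonoid using (sum-zero)

    infixr 7 _*ᴮ_
    _*ᴮ_ : CommutativeRing.Carrier R → ∃ B → ∃ B
    r *ᴮ (b , b∈) = r N.*ₗ b , B.*ₗ-closed r b∈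

    infixl 6 _+ᴮ_
    _+ᴮ_ : ∃ B → ∃ B → ∃ B
    (b , b∈) +ᴮ (c , c∈) = b N.+ᴹ c , B.+-closed b∈ c∈

    0ᴮ : ∃ B
    0ᴮ = N.0ᴹ , B.0∈

    scale : CommutativeRing.Carrier R → FormalSum → FormalSum
    scale r = map λ (a , b) → a , r *ᴮ b

    expandˡ : ∀ {n} (v : Vector (∃ A) n) r (x : ∃ A) (b : ∃ B) →
              proj₁ x M.≈ᴹ Submodules.lin {R = R} M r (proj₁ ∘ v) →
              [ x , b ] ~ sum λ i → [ v i , r i *ᴮ b ]
    expandˡ {zero}  v r x b e = 0ˡ e
    expandˡ {suc n} v r x b e = trans (+ˡ {a₁ = r₀v₀} {a₂ = rest} e)
      (++-cong {[ r₀v₀ , b ]} (balance (r zero) M.≈ᴹ-refl N.≈ᴹ-refl)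
               (expandˡ (tail v) (tail r) rest b M.≈ᴹ-refl))
      where
      r₀v₀ rest : ∃ A
      r₀v₀ = r zero M.*ₗ proj₁ (v zero) , A.*ₗ-closed (r zero) (proj₂ (v zero))
      rest = _ , A.∑-closed λ i → A.*ₗ-closed (r (suc i)) (proj₂ (v (suc i)))

    -- Balancing moves all coefficients over the generators of `A` into the second factor, where
    -- terms with the same generator merge.
    normalForm : ∀ {n} (v : Vector (∃ A) n) → (A ⊆ Submodules.Span {R = R} M (proj₁ ∘ v)) →
                 ∀ s → ∃ λ (β : Vector (∃ B) n) → s ~ sum λ i → [ v i , β i ]
    normalForm {n} v spans [] = (λ _ → 0ᴮ) , sym (sum-zero {n} λ i → 0ʳ {v i} N.≈ᴹ-refl)
    normalForm {n} v spans ((a , b) ∷ s) =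
      let (r , e) = spans (proj₂ a)
          (β , p) = normalForm v spans s
      in (λ i → r i *ᴮ b +ᴮ β i)
       , trans (++-cong {[ a , b ]} (expandˡ v r a b e) p)
           (trans (sym (∑-distrib-+ (λ i → [ v i , r i *ᴮ b ]) (λ i → [ v i , β i ])))
                  (sum-cong-≋ {n} λ i → sym (+ʳ {v i} {r i *ᴮ b} {β i} {r i *ᴮ b +ᴮ β i} N.≈ᴹ-refl)))

    scale-sum : ∀ {n} r (v : Vector FormalSum n) → scale r (sum v) ~ sum λ i → scale r (v i)
    scale-sum {zero}  r v = refl
    scale-sum {suc n} r v = trans (scale-++ (v zero) (sum (tail v))) (++-cong refl (scale-sum r (tail v)))
      where
      scale-++ : ∀ s t → scale r (s ++ t) ~ scale r s ++ scale r t
      scale-++ []      t = refl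
      scale-++ (x ∷ s) t = ++-cong {[ _ ]} refl (scale-++ s t)

    scale-0 : ∀ s → scale (CommutativeRing.0# R) s ~ []
    scale-0 []            = refl
    scale-0 ((a , b) ∷ s) = ++-cong {[ _ ]} (0ʳ (N.*ₗ-zeroˡ _)) (scale-0 s)

    negate : FormalSum → FormalSum
    negate = map λ (a , b , b∈) → a , N.-ᴹ b , B.neg-closed b∈

    negate-inverseˡ : ∀ s → negate s ++ s ~ []
    negate-inverseˡ [] = refl
    negate-inverseˡ ((a , b) ∷ s) = trans
      (++-cong {[ a , _ ]} {t = negate s ++ ((a , b) ∷ s)} refl (++-comm (negate s) ((a , b) ∷ s)))
      (trans (++-cong {(a , _) ∷ (a , b) ∷ []} {[]} {s ++ negate s}
               (trans (sym (+ʳ {a = a} {b = 0ᴮ} (N.≈ᴹ-sym (N.-ᴹ‿inverseˡ _)))) (0ʳ N.≈ᴹ-refl))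
               (++-comm s (negate s)))
             (negate-inverseˡ s))

    -- Formal sums form a group modulo `_~_`, although its relations mention no negatives.
    -- Injectivity thereby reduces to a trivial kernel.
    ++-negate⇒~ : ∀ s t → s ++ negate t ~ [] → s ~ t
    ++-negate⇒~ s t p = trans (sym (T.identityʳ s)) (trans (++-cong {s} refl (sym (negate-inverseˡ t)))
      (trans (sym (T.assoc s (negate t) t)) (++-cong {s ++ negate t} {[]} p refl)))

-- Galois descent

module Averaging (S : SemidirectGaloisExtension u) where

  open SemidirectGaloisExtension S hiding (L/𝒪ᴷ)
  open Galois S
  open Coefficients {G.setoid} G-finite id (λ _ _ → id) (λ _ _ → id)
  open SetoidReasoning L.setoid
  open SemiringSum L.semiring using (*-distribˡ-sum)
  open GroupProperties G using (⁻¹-anti-homo-∙; ε⁻¹≈ε; //-rightDividesˡ)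

  Tr-as-⊙ : ∀ {c : Func G.setoid L.setoid} {h} y → (∀ g → Func.to c g L.≈ h) → c ⊙ y L.≈ h L.* Tr y
  Tr-as-⊙ {c} {h} y e = L.trans (∑-cong {G.setoid} G-finite λ g → L.*-congʳ {g • y} (e g))
    (L.sym (*-distribˡ-sum h λ m → Inverse.to (proj₂ G-finite) m • y))

  module Average {X : Setoid u u} (_▷_ : G.Carrier → Setoid.Carrier X → Setoid.Carrier X)
    (▷-cong : ∀ g h x y → g G.≈ h → Setoid._≈_ X x y → Setoid._≈_ X (g ▷ x) (h ▷ y))
    (▷-ε : ∀ x → Setoid._≈_ X (G.ε ▷ x) x)
    (▷-∙ : ∀ g h x → Setoid._≈_ X ((g G.∙ h) ▷ x) (g ▷ (h ▷ x))) where

    private module X = Setoid X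

    Equivariant : Func X L.setoid → Set u
    Equivariant c = ∀ g x → (g • Func.to c x) L.≈ Func.to c (g ▷ x)

    orbit : Func X L.setoid → X.Carrier → Func G.setoid L.setoid
    orbit c x = record
      { to   = λ g → g • Func.to c ((g G.⁻¹) ▷ x)
      ; cong = λ {g} {h} g≈h → L.trans (•-congʳ g≈h _)
          (•.⟦⟧-cong h (Func.cong c (▷-cong _ _ _ _ (G.⁻¹-cong g≈h) X.refl))) }

    -- The trace of y c for the semilinear action (g c)(x) = g(c(g⁻¹ x)).
    average : L.Carrier → Func X L.setoid → Func X L.setoid
    average y c = record
      { to   = λ x → orbit c x ⊙ y
      ; cong = λ {x} {x′} e → ⊙-congʳ {orbit c x} {orbit c x′} y
          λ g → •.⟦⟧-cong g (Func.cong c (▷-cong _ _ _ _ G.refl e)) }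

    -- Applying `g` replaces the summation variable `h` by `g h`, and the inverse of `g h` carries
    -- `g ▷ x` to the translate of `x` by the inverse of `h`.
    average-equivariant : ∀ y c → Equivariant (average y c)
    average-equivariant y c g x = begin
      (g • (orbit c x ⊙ y))
        ≈⟨ •-sum g (λ m → Func.to (orbit c x) (to m) L.* (to m • y)) ⟩
      (∑ {G.setoid} G-finite λ h → g • ((h • Func.to c ((h G.⁻¹) ▷ x)) L.* (h • y)))
        ≈⟨ ∑-cong {G.setoid} G-finite (λ h → L.trans (•.*-homo g _ _) (L.*-cong
             (L.trans (L.sym (•-∙ g h _)) (•.⟦⟧-cong (g G.∙ h) (Func.cong c (shift h))))
             (L.sym (•-∙ g h y)))) ⟩
      (∑ {G.setoid} G-finite λ h → Φ (g G.∙ h))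
        ≈⟨ ∑-reindex {G.setoid} {G.setoid} G-finite G-finite (leftMult G g) Φ Φ-cong ⟨
      (orbit c (g ▷ x) ⊙ y)
        ∎
      where
      to = Inverse.to (proj₂ G-finite)
      Φ : G.Carrier → L.Carrier
      Φ h = Func.to (orbit c (g ▷ x)) h L.* (h • y)
      Φ-cong : ∀ {h h′} → h G.≈ h′ → Φ h L.≈ Φ h′
      Φ-cong e = L.*-cong (Func.cong (orbit c (g ▷ x)) e) (•-congʳ e y)
      shift : ∀ h → ((h G.⁻¹) ▷ x) X.≈ (((g G.∙ h) G.⁻¹) ▷ (g ▷ x))
      shift h = X.trans
        (▷-cong _ _ _ _
          (G.sym (G.trans (G.∙-congʳ (⁻¹-anti-homo-∙ g h)) (//-rightDividesˡ g (h G.⁻¹)))) X.refl)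
        (▷-∙ _ g x)

    -- The orbit function takes the value `c(x)` at the neutral element, so `coefficient` applied
    -- there writes `c` as an `L`-combination of equivariant functions.
    average-dual : ∀ c x → Func.to c x L.≈ sum λ k → 𝐱 k L.* Func.to (average (𝐲 k) c) x
    average-dual c x = begin
      Func.to c x                                               ≈⟨ •-ε _ ⟨
      (G.ε • Func.to c x)
        ≈⟨ •.⟦⟧-cong G.ε (Func.cong c (X.trans (▷-cong _ _ _ _ ε⁻¹≈ε X.refl) (▷-ε x))) ⟨
      Func.to (orbit c x) G.ε                                   ≈⟨ coefficient (orbit c x) G.ε ⟩
      sum (λ k → (G.ε • 𝐱 k) L.* (orbit c x ⊙ 𝐲 k))
        ≈⟨ sum-cong-≋ {dim} (λ k → L.*-congʳ (•-ε (𝐱 k))) ⟩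
      sum (λ k → 𝐱 k L.* (orbit c x ⊙ 𝐲 k))                     ∎

    -- An equivariant `h` is fixed by the semilinear action and so factors out of the sum, leaving a
    -- trace.
    average-*-equivariant : ∀ {c h} a y → Equivariant h →
      (∀ x → Func.to c x L.≈ a L.* Func.to h x) →
      ∀ x → Func.to (average y c) x L.≈ Tr (a L.* y) L.* Func.to h x
    average-*-equivariant {c} {h} a y equivariant c≈ah x = begin
      orbit c x ⊙ y                       ≈⟨ ∑-cong {G.setoid} G-finite (λ g → begin
        (g • Func.to c ((g G.⁻¹) ▷ x)) L.* (g • y)
          ≈⟨ •.*-homo g _ y ⟨
        (g • (Func.to c ((g G.⁻¹) ▷ x) L.* y))
          ≈⟨ •.⟦⟧-cong g (L.trans (L.*-congʳ (c≈ah _)) (L.trans (L.*-congʳ (L.*-comm _ _))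
               (L.*-assoc (Func.to h ((g G.⁻¹) ▷ x)) a y))) ⟩
        (g • (Func.to h ((g G.⁻¹) ▷ x) L.* (a L.* y)))
          ≈⟨ •.*-homo g _ _ ⟩
        (g • Func.to h ((g G.⁻¹) ▷ x)) L.* (g • (a L.* y))
          ∎) ⟩
      orbit h x ⊙ (a L.* y)               ≈⟨ Tr-as-⊙ {orbit h x} (a L.* y) (λ g →
          L.trans (equivariant g _) (Func.cong h (X.trans (X.sym (▷-∙ g _ x))
            (X.trans (▷-cong _ _ _ _ (G.inverseʳ g) X.refl) (▷-ε x))))) ⟩
      Func.to h x L.* Tr (a L.* y)        ≈⟨ L.*-comm _ _ ⟩
      Tr (a L.* y) L.* Func.to h x        ∎

    average-+ : ∀ {c c′ c″} y → (∀ x → Func.to c″ x L.≈ Func.to c x L.+ Func.to c′ x) →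
      ∀ x → Func.to (average y c″) x L.≈ Func.to (average y c) x L.+ Func.to (average y c′) x
    average-+ {c} {c′} {c″} y e x = ⊙-distribʳ {orbit c x} {orbit c′ x} {orbit c″ x} y
      λ g → L.trans (•.⟦⟧-cong g (e _)) (•.+-homo g _ _)

    average-f : ∀ {c c′} r y → (∀ x → Func.to c′ x L.≈ f r L.* Func.to c x) →
      ∀ x → Func.to (average y c′) x L.≈ f r L.* Func.to (average y c) x
    average-f {c} {c′} r y e x = ⊙-scale {orbit c x} {orbit c′ x} (f r) y
      λ g → L.trans (•.⟦⟧-cong g (e _)) (L.trans (•.*-homo g _ _) (L.*-congʳ (•-f g r)))

    average-cong : ∀ {c c′} y → (∀ x → Func.to c x L.≈ Func.to c′ x) →
      ∀ x → Func.to (average y c) x L.≈ Func.to (average y c′) x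
    average-cong {c} {c′} y e x = ⊙-congʳ {orbit c x} {orbit c′ x} y λ g → •.⟦⟧-cong g (e _)

  -- If every trace vanished, `coefficient` for the constant function 1 would give
  -- `1 = Σ 𝐱ₖ Tr(𝐲ₖ) = 0`.
  nonzeroTrace : ∃ λ z → ¬ Tr z L.≈ L.0#
  nonzeroTrace with PID.excluded-middle isPID (∃ λ z → ¬ Tr z L.≈ L.0#)
  ... | inj₁ z = z
  ... | inj₂ none = contradiction (begin
    L.1#                                           ≈⟨ coefficient one G.ε ⟩
    sum (λ k → (G.ε • 𝐱 k) L.* (one ⊙ 𝐲 k))        ≈⟨ sum-zero {dim} (λ k → L.trans
      (L.*-congˡ (L.trans (Tr-as-⊙ {one} (𝐲 k) (λ _ → L.refl)) (L.trans (L.*-identityˡ _) (vanishes (𝐲 k)))))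
      (L.zeroʳ _)) ⟩
    L.0#                                           ∎)
    1≉0
    where
    one : Func G.setoid L.setoid
    one = record { to = λ _ → L.1# ; cong = λ _ → L.refl }
    vanishes : ∀ z → Tr z L.≈ L.0#
    vanishes z with PID.excluded-middle isPID (Tr z L.≈ L.0#)
    ... | inj₁ e = e
    ... | inj₂ n = contradiction (z , n) none

  traceForm : ∃ λ z → ∃ λ a → ¬ a 𝒪ᴷ.≈ 𝒪ᴷ.0# × Tr z L.≈ f a × (∀ k → ∃ λ r → Tr (𝐱 k L.* z) L.≈ f r)
  traceForm =
    let (z , Tr≉0)     = nonzeroTrace
        (b , b≉0 , bz) = integralDenominator z
        (c , c≉0 , cx) = commonMultiple integral-isSubmodule (λ k → 𝐱 k L.* z)
                           (λ k → integralDenominator (𝐱 k L.* z))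
        -- The factor `b` makes `z` integral and `c` makes every `𝐱ₖ z` integral. With both factors
        -- all traces required of `z′` fall into `𝒪ᴷ`.
        z′             = f c L.* (f b L.* z)
        (a , e)        = Tr∈ (integral-* (integral-f c) bz)
    in z′ , a
     , (λ a≈0 → Tr≉0 (torsionFree b≉0 (torsionFree c≉0 (begin
          f c L.* (f b L.* Tr z)    ≈⟨ L.*-congˡ (Tr-f b z) ⟨
          f c L.* Tr (f b L.* z)    ≈⟨ Tr-f c _ ⟨
          Tr z′                     ≈⟨ e ⟩
          f a                       ≈⟨ f-cong a≈0 ⟩
          f 𝒪ᴷ.0#                   ≈⟨ f-0 ⟩
          L.0#                      ∎))))
     , e
     , λ k → let (r , e) = Tr∈ (integral-* (integral-f b) (cx k)) in
         r , L.trans (Tr-cong (begin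
           𝐱 k L.* (f c L.* (f b L.* z))    ≈⟨ x∙yz≈y∙xz _ _ _ ⟩
           f c L.* (𝐱 k L.* (f b L.* z))    ≈⟨ L.*-congˡ (x∙yz≈y∙xz _ _ _) ⟩
           f c L.* (f b L.* (𝐱 k L.* z))    ≈⟨ x∙yz≈y∙xz _ _ _ ⟩
           f b L.* (f c L.* (𝐱 k L.* z))    ∎)) e
    where
    open CommutativeSemigroupProperties L.*-commutativeSemigroup using (x∙yz≈y∙xz)
    Tr-f : ∀ r x → Tr (f r L.* x) L.≈ f r L.* Tr x
    Tr-f r x = L.trans
      (∑-cong {G.setoid} G-finite λ g →
        L.trans (•.*-homo g (f r) x) (L.*-congʳ {g • x} (•-f g r)))
      (L.sym (*-distribˡ-sum (f r) λ m → Inverse.to (proj₂ G-finite) m • x))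

-- Associated orders

module Orders (S : SemidirectGaloisExtension u) where

  open SemidirectGaloisExtension S hiding (L/𝒪ᴷ)
  open Galois S
  open PID isPID using (excluded-middle)
  open SetoidReasoning L.setoid

  module Equivariants {T : Setoid u u} {Γ : Set u} (γ : Γ → G.Carrier)
    (conj : Γ → Setoid.Carrier T → Setoid.Carrier T)
    (C : Pred L.Carrier u) (C-isSubmodule : IsSubmodule C)
    (C-saturated : ∀ {a x} → ¬ a 𝒪ᴷ.≈ 𝒪ᴷ.0# → f a L.* x ∈ C → x ∈ C) where

    private
      module C = IsSubmodule C-isSubmodule
      module M = Submodules {R = 𝒪ᴷ} (pointwise {R = 𝒪ᴷ} T L/R)

    H : Pred (Func T L.setoid) u
    H c = (∀ t → Func.to c t ∈ C) × (∀ g t → (γ g • Func.to c t) L.≈ Func.to c (conj g t))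

    H-isSubmodule : M.IsSubmodule H
    H-isSubmodule = record
      { resp      = λ {c} {c′} e (c∈ , p) → (λ t → C.resp (e t) (c∈ t)) , λ g t →
          L.trans (•.⟦⟧-cong (γ g) (L.sym (e t))) (L.trans (p g t) (e (conj g t)))
      ; 0∈        = (λ _ → C.0∈) , λ g _ → •.0#-homo (γ g)
      ; +-closed  = λ (c∈ , p) (d∈ , q) → (λ t → C.+-closed (c∈ t) (d∈ t)) , λ g t →
          L.trans (•.+-homo (γ g) _ _) (L.+-cong (p g t) (q g t))
      ; *ₗ-closed = λ a (c∈ , p) → (λ t → C.*ₗ-closed a (c∈ t)) , λ g t →
          L.trans (•.*-homo (γ g) _ _) (L.*-cong (•-f (γ g) a) (p g t))
      }

    H-saturated : ∀ {a} c c′ → ¬ a 𝒪ᴷ.≈ 𝒪ᴷ.0# → (∀ t → Func.to c t L.≈ f a L.* Func.to c′ t) →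
                  c ∈ H → c′ ∈ H
    H-saturated {a} c c′ a≉0 e (c∈ , p) =
        (λ t → C-saturated a≉0 (C.resp (e t) (c∈ t)))
      , λ g t → *-cancelˡ (f-nonzero a≉0) (begin
          f a L.* (γ g • Func.to c′ t)              ≈⟨ L.*-congʳ (•-f (γ g) a) ⟨
          (γ g • f a) L.* (γ g • Func.to c′ t)      ≈⟨ •.*-homo (γ g) _ _ ⟨
          (γ g • (f a L.* Func.to c′ t))            ≈⟨ •.⟦⟧-cong (γ g) (e t) ⟨
          (γ g • Func.to c t)                       ≈⟨ p g t ⟩
          Func.to c (conj g t)                      ≈⟨ e (conj g t) ⟩
          f a L.* Func.to c′ (conj g t)             ∎)

  -- One treatment for `E` and `F`; `𝔄` unfolds to the associated order of `HopfGalois`.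
  -- Faithfulness is demanded on the integers of the subfield alone, and arithmetic disjointness
  -- will supply it.
  module AssociatedOrder {T : Setoid u u} (fin : Finite T) (κ : Setoid.Carrier T → G.Carrier)
    (κ-cong : ∀ s t → Setoid._≈_ T s t → κ s G.≈ κ t)
    (κ-injective : ∀ s t → κ s G.≈ κ t → Setoid._≈_ T s t)
    (X : Pred L.Carrier u) (X-isSubmodule : IsSubmodule X)
    (H : Pred (Func T L.setoid) u)
    (H-isSubmodule : Submodules.IsSubmodule {R = 𝒪ᴷ} (pointwise {R = 𝒪ᴷ} T L/R) H)
    (H-saturated : ∀ {a} c c′ → ¬ a 𝒪ᴷ.≈ 𝒪ᴷ.0# →
                   (∀ t → Func.to c t L.≈ f a L.* Func.to c′ t) → c ∈ H → c′ ∈ H)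
    (H-acts : ∀ c {x} → c ∈ H → x ∈ X →
              Coefficients._⊙_ {T} fin κ κ-cong κ-injective c x ∈ X)
    (faithful : ∀ c →
                (∀ {x} → x ∈ X ∩ 𝒪ᴸ → Coefficients._⊙_ {T} fin κ κ-cong κ-injective c x L.≈ L.0#) →
                ∀ t → Func.to c t L.≈ L.0#) where

    open Coefficients {T} fin κ κ-cong κ-injective public
    private
      module M = Submodules {R = 𝒪ᴷ} (pointwise {R = 𝒪ᴷ} T L/R)
      module X = IsSubmodule X-isSubmodule
      module H = M.IsSubmodule H-isSubmodule
      module 𝒪 = IsSubmodule integral-isSubmodule
    open LeftModule (pointwise {R = 𝒪ᴷ} T L/R) using (0ᴹ; _+ᴹ_; _*ₗ_; _≈ᴹ_)

    𝒪ᴹ : Pred L.Carrier u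
    𝒪ᴹ = X ∩ 𝒪ᴸ

    𝒪ᴹ-isSubmodule : IsSubmodule 𝒪ᴹ
    𝒪ᴹ-isSubmodule = record
      { resp      = λ e (p , q) → X.resp e p , 𝒪.resp e q
      ; 0∈        = X.0∈ , 𝒪.0∈
      ; +-closed  = λ (p , q) (p′ , q′) → X.+-closed p p′ , 𝒪.+-closed q q′
      ; *ₗ-closed = λ r (p , q) → X.*ₗ-closed r p , 𝒪.*ₗ-closed r q
      }

    private module 𝒪ᴹ = IsSubmodule 𝒪ᴹ-isSubmodule

    𝔄 : Pred (Func T L.setoid) u
    𝔄 = H ∩ λ c → ∀ {x} → x ∈ 𝒪ᴹ → c ⊙ x ∈ 𝒪ᴹ

    ⊙-zeroˡ : ∀ {c} x → (∀ t → Func.to c t L.≈ L.0#) → c ⊙ x L.≈ L.0#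
    ⊙-zeroˡ x e = sum-zero {proj₁ fin} λ m → L.trans (L.*-congʳ (e (Inverse.to (proj₂ fin) m))) (L.zeroˡ _)

    𝔄-isSubmodule : M.IsSubmodule 𝔄
    𝔄-isSubmodule = record
      { resp      = λ {c} {c′} e (p , q) → H.resp {c} {c′} e p , λ {x} x∈ →
          𝒪ᴹ.resp (⊙-congʳ {c} {c′} x e) (q x∈)
      ; 0∈        = H.0∈ , λ {x} x∈ → 𝒪ᴹ.resp (L.sym (⊙-zeroˡ {0ᴹ} x λ t → L.refl)) 𝒪ᴹ.0∈
      ; +-closed  = λ {c} {c′} (p , q) (p′ , q′) → H.+-closed {c} {c′} p p′ , λ {x} x∈ →
          𝒪ᴹ.resp (L.sym (⊙-distribʳ {c} {c′} {c +ᴹ c′} x λ t → L.refl)) (𝒪ᴹ.+-closed (q x∈) (q′ x∈))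
      ; *ₗ-closed = λ a {c} (p , q) → H.*ₗ-closed a {c} p , λ {x} x∈ →
          𝒪ᴹ.resp (L.sym (⊙-scale {c} {a *ₗ c} (f a) x λ t → L.refl)) (𝒪ᴹ.*ₗ-closed a (q x∈))
      }

    -- This includes r = 0, where it is the faithfulness of the action.
    divide : ∀ r c → c ∈ 𝔄 →
             (∀ {x} → x ∈ 𝒪ᴹ → ∃ λ y → y ∈ 𝒪ᴹ × c ⊙ x L.≈ f r L.* y) →
             ∃ λ c′ → c′ ∈ 𝔄 × c ≈ᴹ r *ₗ c′
    divide r c c∈ divides with excluded-middle (r 𝒪ᴷ.≈ 𝒪ᴷ.0#)
    ... | inj₁ r≈0 = 0ᴹ , M.IsSubmodule.0∈ 𝔄-isSubmodule , λ t → L.trans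
      (faithful c (λ x∈ → let (y , _ , e) = divides x∈ in
        L.trans e (L.trans (L.*-congʳ (L.trans (f-cong r≈0) f-0)) (L.zeroˡ y))) t)
      (L.sym (L.zeroʳ _))
    ... | inj₂ r≉0 = c′ , (H-saturated c c′ r≉0 c≈rc′ (proj₁ c∈) , λ {x} x∈ →
        let (y , y∈ , e) = divides x∈ in
        𝒪ᴹ.resp (*-cancelˡ (f-nonzero r≉0) (L.trans (L.sym e) (⊙-scale {c′} {c} (f r) x c≈rc′))) y∈) , c≈rc′
      where
      r⁻¹ = f-inverse r≉0
      c′ : Func T L.setoid
      c′ = record { to = λ t → proj₁ r⁻¹ L.* Func.to c t ; cong = λ e → L.*-congˡ (Func.cong c e) }
      c≈rc′ : ∀ t → Func.to c t L.≈ f r L.* Func.to c′ t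
      c≈rc′ t = L.sym (L.trans (L.sym (L.*-assoc _ _ _)) (L.trans (L.*-congʳ (proj₂ r⁻¹)) (L.*-identityˡ _)))

    -- As `𝒪ᴸ` lies in the span of `𝐰`, it is enough to clear the denominators of the finitely many
    -- `c ⊙ 𝐰ₖ`.
    𝔄-multiple : ∀ c → c ∈ H → ∃ λ a → ¬ a 𝒪ᴷ.≈ 𝒪ᴷ.0# × a *ₗ c ∈ 𝔄
    𝔄-multiple c c∈ =
      let (a , a≉0 , a∈) = commonMultiple integral-isSubmodule (λ k → c ⊙ 𝐰 k)
                             (λ k → integralDenominator (c ⊙ 𝐰 k))
          preimage       : IsSubmodule λ x → f a L.* (c ⊙ x) ∈ 𝒪ᴸ
          preimage       = record
            { resp      = λ e → 𝒪.resp (L.*-congˡ (⊙-congˡ c e))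
            ; 0∈        = 𝒪.resp (L.sym (L.trans (L.*-congˡ (⊙-0 c)) (L.zeroʳ _))) 𝒪.0∈
            ; +-closed  = λ {x} {y} p q → 𝒪.resp
                (L.trans (L.sym (L.distribˡ _ _ _)) (L.*-congˡ (L.sym (⊙-+ c x y)))) (𝒪.+-closed p q)
            ; *ₗ-closed = λ r {x} p → 𝒪.resp
                (L.trans (x∙yz≈y∙xz _ _ _) (L.*-congˡ (L.sym (⊙-f c r x)))) (𝒪.*ₗ-closed r p)
            }
      in a , a≉0 , H.*ₗ-closed a {c} c∈ , λ {x} (x∈X , x∈𝒪) →
           let e = L.sym (⊙-scale {c} {a *ₗ c} (f a) x λ t → L.refl) in
           X.resp e (X.*ₗ-closed a (H-acts c c∈ x∈X)) ,
           𝒪.resp e (Span⊆ preimage a∈ (𝒪ᴸ⊆Span x∈𝒪))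
      where open CommutativeSemigroupProperties L.*-commutativeSemigroup using (x∙yz≈y∙xz)

    module Lift {β : L.Carrier}
      (bij : BijectiveOn (LeftModule.≈ᴹ-setoid (pointwise {R = 𝒪ᴷ} T L/R)) L.setoid 𝔄 𝒪ᴹ (_⊙ β)) where

      open M.IsSubmodule 𝔄-isSubmodule

      lift : ∃ 𝒪ᴹ → ∃ 𝔄
      lift (y , y∈) = let (c , c∈ , _) = proj₂ (proj₂ bij) y∈ in c , c∈

      lift-⊙ : ∀ y → proj₁ (lift y) ⊙ β L.≈ proj₁ y
      lift-⊙ (y , y∈) = proj₂ (proj₂ (proj₂ (proj₂ bij) y∈))

      -- Injectivity of `_⊙ β` identifies a lift by its value at `β`; linearity of `lift` follows by
      -- naming the expected candidate.
      lift-unique : ∀ y {c} → c ∈ 𝔄 → proj₁ y L.≈ c ⊙ β → proj₁ (lift y) ≈ᴹ c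
      lift-unique y {c} c∈ e =
        proj₁ (proj₂ bij) {proj₁ (lift y)} {c} (proj₂ (lift y)) c∈ (L.trans (lift-⊙ y) e)

      lift-cong : ∀ y z → proj₁ y L.≈ proj₁ z → proj₁ (lift y) ≈ᴹ proj₁ (lift z)
      lift-cong y z e = lift-unique y (proj₂ (lift z)) (L.trans e (L.sym (lift-⊙ z)))

      lift-0 : ∀ y → proj₁ y L.≈ L.0# → proj₁ (lift y) ≈ᴹ 0ᴹ
      lift-0 y e = lift-unique y 0∈ (L.trans e (L.sym (⊙-zeroˡ {0ᴹ} β λ t → L.refl)))

      lift-+ : ∀ x y z → proj₁ z L.≈ proj₁ x L.+ proj₁ y →
               proj₁ (lift z) ≈ᴹ proj₁ (lift x) +ᴹ proj₁ (lift y)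
      lift-+ x y z e = lift-unique z (+-closed {a} {b} (proj₂ (lift x)) (proj₂ (lift y)))
        (L.trans e (L.trans (L.+-cong (L.sym (lift-⊙ x)) (L.sym (lift-⊙ y)))
          (L.sym (⊙-distribʳ {a} {b} {a +ᴹ b} β λ t → L.refl))))
        where
        a = proj₁ (lift x)
        b = proj₁ (lift y)

      lift-* : ∀ r x y → proj₁ y L.≈ f r L.* proj₁ x → proj₁ (lift y) ≈ᴹ r *ₗ proj₁ (lift x)
      lift-* r x y e = lift-unique y (*ₗ-closed r {a} (proj₂ (lift x)))
        (L.trans e (L.trans (L.*-congˡ (L.sym (lift-⊙ x)))
          (L.sym (⊙-scale {a} {r *ₗ a} (f r) β λ t → L.refl))))
        where a = proj₁ (lift x)

-- Conjugation actions, regular subgroups and the representations of a semidirect product.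

module Conjugation (G P : Group u u) (ρ : Group.Carrier G → Group.Carrier P)
  (ρ-cong : ∀ {g h} → Group._≈_ G g h → Group._≈_ P (ρ g) (ρ h))
  (ρ-∙ : ∀ g h → Group._≈_ P (ρ (Group._∙_ G g h)) (Group._∙_ P (ρ g) (ρ h))) where

  private module G = Group G
  open Group P
  open GroupProperties P
  open SetoidReasoning setoid

  infixr 8 _▷_
  _▷_ : G.Carrier → Carrier → Carrier
  g ▷ x = ρ g ∙ x ∙ ρ g ⁻¹

  ▷-cong : ∀ {g h x y} → g G.≈ h → x ≈ y → g ▷ x ≈ h ▷ y
  ▷-cong g≈h x≈y = ∙-cong (∙-cong (ρ-cong g≈h) x≈y) (⁻¹-cong (ρ-cong g≈h))

  ρ-ε : ρ G.ε ≈ ε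
  ρ-ε = begin
    ρ G.ε                             ≈⟨ //-rightDividesʳ (ρ G.ε) (ρ G.ε) ⟨
    ρ G.ε ∙ ρ G.ε ∙ ρ G.ε ⁻¹          ≈⟨ ∙-congʳ (trans (sym (ρ-∙ G.ε G.ε)) (ρ-cong (G.identityˡ G.ε))) ⟩
    ρ G.ε ∙ ρ G.ε ⁻¹                  ≈⟨ inverseʳ (ρ G.ε) ⟩
    ε                                 ∎

  ▷-trivial : ∀ {g} x → ρ g ≈ ε → g ▷ x ≈ x
  ▷-trivial {g} x e = begin
    ρ g ∙ x ∙ ρ g ⁻¹    ≈⟨ ∙-cong (∙-congʳ e) (trans (⁻¹-cong e) ε⁻¹≈ε) ⟩
    ε ∙ x ∙ ε           ≈⟨ identityʳ _ ⟩
    ε ∙ x               ≈⟨ identityˡ x ⟩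
    x                   ∎

  ▷-ε : ∀ x → G.ε ▷ x ≈ x
  ▷-ε x = ▷-trivial x ρ-ε

  ▷-∙ : ∀ g h x → (g G.∙ h) ▷ x ≈ g ▷ h ▷ x
  ▷-∙ g h x = begin
    ρ (g G.∙ h) ∙ x ∙ ρ (g G.∙ h) ⁻¹
      ≈⟨ ∙-cong (∙-congʳ (ρ-∙ g h)) (trans (⁻¹-cong (ρ-∙ g h)) (⁻¹-anti-homo-∙ _ _)) ⟩
    ρ g ∙ ρ h ∙ x ∙ (ρ h ⁻¹ ∙ ρ g ⁻¹)
      ≈⟨ assoc _ _ _ ⟨
    ρ g ∙ ρ h ∙ x ∙ ρ h ⁻¹ ∙ ρ g ⁻¹
      ≈⟨ ∙-congʳ (trans (∙-congʳ (assoc _ _ _)) (assoc _ _ _)) ⟩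
    ρ g ∙ (ρ h ∙ x ∙ ρ h ⁻¹) ∙ ρ g ⁻¹
      ∎

  ▷-inverse : ∀ g x → g ▷ (g G.⁻¹) ▷ x ≈ x
  ▷-inverse g x = trans (sym (▷-∙ g (g G.⁻¹) x)) (trans (▷-cong (G.inverseʳ g) refl) (▷-ε x))

  ▷-inverse′ : ∀ g x → (g G.⁻¹) ▷ g ▷ x ≈ x
  ▷-inverse′ g x = trans (sym (▷-∙ (g G.⁻¹) g x)) (trans (▷-cong (G.inverseˡ g) refl) (▷-ε x))

  restrict : (N : Pred Carrier u) → (∀ g {x} → x ∈ N → g ▷ x ∈ N) →
             G.Carrier → Inverse (subsetoid setoid N) (subsetoid setoid N)
  restrict N N-closed g = record
    { to        = λ (x , x∈) → g ▷ x , N-closed g x∈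
    ; from      = λ (x , x∈) → (g G.⁻¹) ▷ x , N-closed (g G.⁻¹) x∈
    ; to-cong   = ▷-cong G.refl
    ; from-cong = ▷-cong G.refl
    ; inverse   = (λ e → trans (▷-cong G.refl e) (▷-inverse g _))
                , (λ e → trans (▷-cong G.refl e) (▷-inverse′ g _))
    }

module RegularSubgroup (X : Group u u) (N : Pred (Group.Carrier (Perm (Group.setoid X))) u)
  (isRegular : IsRegularSubgroup N) where

  private
    module X = Group X
    module P = Group (Perm X.setoid)
  open Inverse
  open IsRegularSubgroup isRegular

  preimageOfε : ∃ N → X.Carrier
  preimageOfε (η , _) = from η X.ε

  preimageOfε-cong : ∀ (η θ : ∃ N) → proj₁ η P.≈ proj₁ θ → preimageOfε η X.≈ preimageOfε θ
  preimageOfε-cong (η , _) (θ , _) e = P.⁻¹-cong {η} {θ} e X.ε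

  -- Both permutations carry the same point to the neutral element, so simple transitivity
  -- identifies them. This makes `κ` injective in all three cases.
  preimageOfε-injective : ∀ (η θ : ∃ N) → preimageOfε η X.≈ preimageOfε θ → proj₁ η P.≈ proj₁ θ
  preimageOfε-injective (η , η∈) (θ , θ∈) e =
    let (ζ , _ , ζ-unique) = simplyTransitive (from η X.ε) X.ε in
    P.trans {η} {ζ} {θ}
      (P.sym {ζ} {η} (ζ-unique (η∈ , strictlyInverseˡ η X.ε)))
      (ζ-unique (θ∈ , X.trans (to-cong θ e) (strictlyInverseˡ θ X.ε)))

module SemidirectRepresentations {G : Group u u} {J G′ : Pred (Group.Carrier G) u}
  (isSemidirect : IsSemidirect G J G′) where

  open Semidirect isSemidirect
  open Group G
  private
    module PJ = Group (Perm (Group.setoid Jᴳ))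
    module PG′ = Group (Perm (Group.setoid G′ᴳ))
  open Inverse using (to; from; to-cong; from-cong; strictlyInverseʳ)

  lam-cong : ∀ {g h} → g ≈ h → lamᶜ g PJ.≈ lamᶜ h × lam′ (πG′ g) PG′.≈ lam′ (πG′ h)
  lam-cong {g} {h} e = ι-injective (lamᶜ g) (lam′ (πG′ g)) (lamᶜ h) (lam′ (πG′ h)) λ x →
    trans (sym (lam≈ι g x)) (trans (∙-congʳ e) (lam≈ι h x))

  -- Left translation is multiplicative and splits as `ι (lamᶜ g) (lam′ (πG′ g))`; injectivity of
  -- `ι` passes multiplicativity to both components without computing in the semidirect product.
  lam-∙ : ∀ g h → lamᶜ (g ∙ h) PJ.≈ lamᶜ g PJ.∙ lamᶜ h ×
                  lam′ (πG′ (g ∙ h)) PG′.≈ lam′ (πG′ g) PG′.∙ lam′ (πG′ h)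
  lam-∙ g h = ι-injective (lamᶜ (g ∙ h)) (lam′ (πG′ (g ∙ h)))
    (lamᶜ g PJ.∙ lamᶜ h) (lam′ (πG′ g) PG′.∙ lam′ (πG′ h)) λ x →
      trans (sym (lam≈ι (g ∙ h) x)) (trans (assoc g h x) (trans (lam≈ι g (h ∙ x))
        (trans (to-cong (ι (lamᶜ g) (lam′ (πG′ g))) (lam≈ι h x))
               (ι-∙ (lamᶜ g) (lam′ (πG′ g)) (lamᶜ h) (lam′ (πG′ h)) x))))

  module J = IsSubgroup (IsSemidirect.J-isSubgroup isSemidirect)
  module G″ = IsSubgroup (IsSemidirect.G′-isSubgroup isSemidirect)

  π-∈J : ∀ {g} → g ∈ J → proj₁ (πJ g) ≈ g × proj₁ (πG′ g) ≈ ε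
  π-∈J {g} g∈ = π-unique (g , g∈) (ε , G″.ε-closed) (sym (identityʳ g))

  π-∈G′ : ∀ {g} → g ∈ G′ → proj₁ (πJ g) ≈ ε × proj₁ (πG′ g) ≈ g
  π-∈G′ {g} g∈ = π-unique (ε , J.ε-closed) (g , g∈) (sym (identityˡ g))

  lamᶜ-∈G′ : ∀ {τ} → τ ∈ G′ → ∀ x → proj₁ (to (lamᶜ τ) x) ≈ τ ∙ proj₁ x ∙ τ ⁻¹
  lamᶜ-∈G′ {τ} τ∈ x = let (p , q) = π-∈G′ τ∈ in
    trans (∙-congʳ p) (trans (identityˡ _) (∙-cong (∙-congʳ q) (⁻¹-cong q)))

  lamᶜ⁻¹-ε : ∀ {τ} → τ ∈ G′ → proj₁ (from (lamᶜ τ) (ε , J.ε-closed)) ≈ ε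
  lamᶜ⁻¹-ε {τ} τ∈ = trans
    (from-cong (lamᶜ τ) {ε , J.ε-closed} {to (lamᶜ τ) (ε , J.ε-closed)}
      (sym (trans (lamᶜ-∈G′ τ∈ (ε , J.ε-closed)) (trans (∙-congʳ (identityʳ τ)) (inverseʳ τ)))))
    (strictlyInverseʳ (lamᶜ τ) (ε , J.ε-closed))

-- The induced Hopf Galois structure

module Induced {S : SemidirectGaloisExtension u} (I : InducedHopfGaloisStructure S)
  (disjoint : SemidirectGaloisExtension.ArithmeticallyDisjoint S) where

  open SemidirectGaloisExtension S hiding (L/𝒪ᴷ)
  open InducedHopfGaloisStructure I
  open Galois S
  open Orders S
  open SemidirectRepresentations isSemidirect
  open SetoidReasoning L.setoid
  open CommutativeSemigroupProperties L.*-commutativeSemigroup using (interchange; x∙yz≈y∙xz)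
  private
    module Sd = IsSemidirect isSemidirect
    module P = Group (Perm G.setoid)
    module PG′ = Group (Perm (Group.setoid G′ᴳ))
    module 𝒪 = IsSubmodule integral-isSubmodule
    module L[N₁] = LeftModule L[N₁]
    module L[N₂] = LeftModule L[N₂]
    module L[N] = LeftModule L[N]

  F-normal : ∀ g {x} → x ∈ F → (g • x) ∈ F
  F-normal g {x} x∈ {σ} σ∈ = begin
    (σ • (g • x))                                  ≈⟨ •-inverse g _ ⟨
    (g • ((g G.⁻¹) • (σ • (g • x))))               ≈⟨ •.⟦⟧-cong g (•-∙ (g G.⁻¹) σ (g • x)) ⟨
    (g • ((g G.⁻¹ G.∙ σ) • (g • x)))               ≈⟨ •.⟦⟧-cong g (•-∙ _ g x) ⟨
    (g • ((g G.⁻¹ G.∙ σ G.∙ g) • x))               ≈⟨ •.⟦⟧-cong g (x∈ conj∈) ⟩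
    (g • x)                                        ∎
    where
    open GroupProperties G using (⁻¹-involutive)
    conj∈ : g G.⁻¹ G.∙ σ G.∙ g ∈ J
    conj∈ = J.resp (G.∙-congˡ (⁻¹-involutive g)) (Sd.J-normal (g G.⁻¹) σ∈)

  fixed-isSubmodule : (Γ : Pred G.Carrier u) → IsSubmodule (λ x → ∀ {g} → g ∈ Γ → (g • x) L.≈ x)
  fixed-isSubmodule Γ = record
    { resp      = λ e p {g} g∈ → L.trans (•.⟦⟧-cong g (L.sym e)) (L.trans (p g∈) e)
    ; 0∈        = λ {g} _ → •.0#-homo g
    ; +-closed  = λ p q {g} g∈ → L.trans (•.+-homo g _ _) (L.+-cong (p g∈) (q g∈))
    ; *ₗ-closed = λ r p {g} g∈ → L.trans (•.*-homo g _ _) (L.*-cong (•-f g r) (p g∈))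
    }

  fixed-saturated : ∀ {a x g} → ¬ a 𝒪ᴷ.≈ 𝒪ᴷ.0# → (g • (f a L.* x)) L.≈ f a L.* x → (g • x) L.≈ x
  fixed-saturated {a} {x} {g} a≉0 e = *-cancelˡ (f-nonzero a≉0) (begin
    f a L.* (g • x)            ≈⟨ L.*-congʳ (•-f g a) ⟨
    (g • f a) L.* (g • x)      ≈⟨ •.*-homo g (f a) x ⟨
    (g • (f a L.* x))          ≈⟨ e ⟩
    f a L.* x                  ∎)

  T₁ = H₁.Nˢ
  T₂ = H̄.Nˢ
  T  = H.Nˢ
  module T₁ = Setoid T₁
  module T₂ = Setoid T₂
  module T = Setoid T

  N-regular = ι×-regular N₁ N₂ N₁-regular N₂-regular
  module R₁ = RegularSubgroup Jᴳ N₁ N₁-regular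
  module R₂ = RegularSubgroup G′ᴳ N₂ N₂-regular
  module R = RegularSubgroup G N N-regular

  fin₁ : Finite T₁
  fin₁ = regular⇒finite N₁ N₁-regular (Group.ε Jᴳ) J-finite
  fin₂ : Finite T₂
  fin₂ = regular⇒finite N₂ N₂-regular (Group.ε G′ᴳ) G′-finite
  fin : Finite T
  fin = regular⇒finite N N-regular G.ε G-finite

  κ₁ : T₁.Carrier → G.Carrier
  κ₁ = proj₁ ∘ R₁.preimageOfε
  κ₂ : T₂.Carrier → G.Carrier
  κ₂ = proj₁ ∘ R₂.preimageOfε

  κ₁∈J : ∀ t → κ₁ t ∈ J
  κ₁∈J = proj₂ ∘ R₁.preimageOfε
  κ₂∈G′ : ∀ t → κ₂ t ∈ G′
  κ₂∈G′ = proj₂ ∘ R₂.preimageOfε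

  module C₁ = Coefficients {T₁} fin₁ κ₁
    R₁.preimageOfε-cong R₁.preimageOfε-injective
  module C₂ = Coefficients {T₂} fin₂ κ₂
    R₂.preimageOfε-cong R₂.preimageOfε-injective
  module C = Coefficients {T} fin R.preimageOfε
    R.preimageOfε-cong R.preimageOfε-injective

  κ₁-F : ∀ t {z} → z ∈ F → (κ₁ t • z) L.≈ z
  κ₁-F t z∈ = z∈ (κ₁∈J t)

  κ₂-E : ∀ t {x} → x ∈ E → (κ₂ t • x) L.≈ x
  κ₂-E t x∈ = x∈ (κ₂∈G′ t)

  -- Surjectivity of `𝒪ᴱ ⊗ 𝒪ᶠ → 𝒪ᴸ`, cast as an induction principle: a property closed under linear
  -- combinations need only be checked on products.
  𝒪ᴱ𝒪ᶠ⊆⇒𝒪ᴸ⊆ : ∀ {P : Pred L.Carrier u} → IsSubmodule P →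
              (∀ {x z} → x ∈ 𝒪ᴱ → z ∈ 𝒪ᶠ → x L.* z ∈ P) → 𝒪ᴸ ⊆ P
  𝒪ᴱ𝒪ᶠ⊆⇒𝒪ᴸ⊆ {P} isSub *∈ {y} y∈ =
    let (t , _ , e) = proj₂ (proj₂ (proj₂ disjoint)) y∈
    in resp e (fold-closed P 0∈ +-closed (λ x z → *∈ (proj₂ x) (proj₂ z)) t)
    where
    open IsSubmodule isSub
    open TensorFold.Fold {R = 𝒪ᴷ} {L/R} {L/R} {𝒪ᴱ} {𝒪ᶠ} L.+-commutativeMonoid
      (λ x z → proj₁ x L.* proj₁ z)

  module Conj₁ = Conjugation G (Perm (Group.setoid Jᴳ)) lamᶜ
    (λ e → proj₁ (lam-cong e)) (λ g h → proj₁ (lam-∙ g h))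
  module Conj₂ = Conjugation G (Perm (Group.setoid G′ᴳ)) (lam′ ∘ πG′)
    (λ e → proj₂ (lam-cong e)) (λ g h → proj₂ (lam-∙ g h))

  U-isSubmodule : IsSubmodule U
  U-isSubmodule = record
    { resp = λ _ _ → _ ; 0∈ = _ ; +-closed = λ _ _ → _ ; *ₗ-closed = λ _ _ → _ }

  module Eq₁ = Equivariants {T₁} id H₁.conj U
    U-isSubmodule (λ _ _ → _)

  module Eq₂ = Equivariants {T₂} proj₁ H̄.conj F (fixed-isSubmodule J)
    (λ a≉0 p g∈ → fixed-saturated a≉0 (p g∈))

  module Eq = Equivariants {T} id H.conj U
    U-isSubmodule (λ _ _ → _)

  -- `lamᶜ τ` is conjugation by `τ` and fixes the neutral element, so conjugating `t` conjugates
  -- `κ₁ t`. As `τ` fixes `x`, applying `τ` only permutes the summands.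
  H₁-acts : ∀ c {x} → c ∈ H₁.H → x ∈ E → c C₁.⊙ x ∈ E
  H₁-acts c {x} (_ , equivariant) x∈ {τ} τ∈ = begin
    (τ • (c C₁.⊙ x))
      ≈⟨ •-sum τ (λ m → Func.to c (Inverse.to (proj₂ fin₁) m) L.* (κ₁ (Inverse.to (proj₂ fin₁) m) • x)) ⟩
    (∑ {T₁} fin₁ λ t → τ • (Func.to c t L.* (κ₁ t • x)))
      ≈⟨ ∑-cong {T₁} fin₁ (λ t → L.trans (•.*-homo τ _ _) (L.*-cong (equivariant τ t) (shift t))) ⟩
    (∑ {T₁} fin₁ λ t → Φ (H₁.conj τ t))
      ≈⟨ ∑-reindex {T₁} {T₁} fin₁ fin₁ (Conj₁.restrict N₁ (λ g {η} → N₁-normalized g {η}) τ)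
           Φ (λ {s} {t} → Φ-cong {s} {t}) ⟨
    c C₁.⊙ x ∎
    where
    Φ : T₁.Carrier → L.Carrier
    Φ t = Func.to c t L.* (κ₁ t • x)
    Φ-cong : ∀ {s t} → s T₁.≈ t → Φ s L.≈ Φ t
    Φ-cong {s} {t} e = L.*-cong (Func.cong c e) (•-congʳ (R₁.preimageOfε-cong s t e) x)
    κ₁-conj : ∀ t → κ₁ (H₁.conj τ t) G.≈ τ G.∙ κ₁ t G.∙ τ G.⁻¹
    κ₁-conj (η , _) = G.trans
      (Inverse.to-cong (lamᶜ τ)
        {Inverse.from η (Inverse.from (lamᶜ τ) (Group.ε Jᴳ))} {Inverse.from η (Group.ε Jᴳ)}
        (Inverse.from-cong η (lamᶜ⁻¹-ε τ∈)))
      (lamᶜ-∈G′ τ∈ (Inverse.from η (Group.ε Jᴳ)))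
    shift : ∀ t → (τ • (κ₁ t • x)) L.≈ (κ₁ (H₁.conj τ t) • x)
    shift t = L.sym (begin
      (κ₁ (H₁.conj τ t) • x)                    ≈⟨ •-congʳ (κ₁-conj t) x ⟩
      ((τ G.∙ κ₁ t G.∙ τ G.⁻¹) • x)             ≈⟨ •-∙ _ _ x ⟩
      ((τ G.∙ κ₁ t) • ((τ G.⁻¹) • x))           ≈⟨ •.⟦⟧-cong _ (x∈ (G″.⁻¹-closed τ∈)) ⟩
      ((τ G.∙ κ₁ t) • x)                        ≈⟨ •-∙ τ _ x ⟩
      (τ • (κ₁ t • x))                          ∎)

  H̄-acts : ∀ c {x} → c ∈ H̄.H → x ∈ F → c C₂.⊙ x ∈ F
  H̄-acts c {x} (c∈ , _) x∈ {σ} σ∈ = L.trans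
    (•-sum σ (λ m → Func.to c (Inverse.to (proj₂ fin₂) m) L.* (κ₂ (Inverse.to (proj₂ fin₂) m) • x)))
    (∑-cong {T₂} fin₂ λ t → L.trans (•.*-homo σ _ _)
      (L.*-cong (c∈ t σ∈) (F-normal (κ₂ t) x∈ σ∈)))

  -- Since `κ₁` takes values in `J`, the operator `c` is linear over `𝒪ᶠ`. Vanishing on `𝒪ᴱ` thus
  -- spreads to all of `𝒪ᴸ`, where the dual family detects the coefficients.
  H₁-faithful : ∀ c → (∀ {x} → x ∈ 𝒪ᴱ → c C₁.⊙ x L.≈ L.0#) → ∀ t → Func.to c t L.≈ L.0#
  H₁-faithful c c⊙≈0 = C₁.⊙-faithful c (𝒪ᴱ𝒪ᶠ⊆⇒𝒪ᴸ⊆ (record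
    { resp      = λ e p → L.trans (C₁.⊙-congˡ c (L.sym e)) p
    ; 0∈        = C₁.⊙-0 c
    ; +-closed  = λ {x} {y} p q → L.trans (C₁.⊙-+ c x y) (L.trans (L.+-cong p q) (L.+-identityˡ _))
    ; *ₗ-closed = λ r {x} p → L.trans (C₁.⊙-f c r x) (L.trans (L.*-congˡ p) (L.zeroʳ _))
    }) λ {x} {z} x∈ z∈ → L.trans (C₁.⊙-*-fixed c x λ t → κ₁-F t (proj₁ z∈))
         (L.trans (L.*-congʳ (c⊙≈0 x∈)) (L.zeroˡ z)))

  H̄-faithful : ∀ c → (∀ {x} → x ∈ 𝒪ᶠ → c C₂.⊙ x L.≈ L.0#) → ∀ t → Func.to c t L.≈ L.0#
  H̄-faithful c c⊙≈0 = C₂.⊙-faithful c (𝒪ᴱ𝒪ᶠ⊆⇒𝒪ᴸ⊆ (record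
    { resp      = λ e p → L.trans (C₂.⊙-congˡ c (L.sym e)) p
    ; 0∈        = C₂.⊙-0 c
    ; +-closed  = λ {x} {y} p q → L.trans (C₂.⊙-+ c x y) (L.trans (L.+-cong p q) (L.+-identityˡ _))
    ; *ₗ-closed = λ r {x} p → L.trans (C₂.⊙-f c r x) (L.trans (L.*-congˡ p) (L.zeroʳ _))
    }) λ {x} {z} x∈ z∈ → L.trans (C₂.⊙-congˡ c (L.*-comm x z))
         (L.trans (C₂.⊙-*-fixed c z λ t → κ₂-E t (proj₁ x∈))
         (L.trans (L.*-congʳ (c⊙≈0 z∈)) (L.zeroˡ x))))

  module A₁ = AssociatedOrder {T₁} fin₁ κ₁
      R₁.preimageOfε-cong R₁.preimageOfε-injective E (fixed-isSubmodule G′)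
    H₁.H Eq₁.H-isSubmodule Eq₁.H-saturated H₁-acts H₁-faithful

  module A₂ = AssociatedOrder {T₂} fin₂ κ₂
      R₂.preimageOfε-cong R₂.preimageOfε-injective F (fixed-isSubmodule J)
    H̄.H Eq₂.H-isSubmodule Eq₂.H-saturated H̄-acts H̄-faithful

  -- Linearity over `𝒪ᶠ` extends stability from `𝒪ᴱ` to `𝒪ᴸ`, which is what places `𝔄₁` inside
  -- `lattice`.
  𝔄₁-stable : ∀ c → c ∈ H₁.𝔄 → ∀ {x} → x ∈ 𝒪ᴸ → c C₁.⊙ x ∈ 𝒪ᴸ
  𝔄₁-stable c c∈ = 𝒪ᴱ𝒪ᶠ⊆⇒𝒪ᴸ⊆ (record
    { resp      = λ e → 𝒪.resp (C₁.⊙-congˡ c e)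
    ; 0∈        = 𝒪.resp (L.sym (C₁.⊙-0 c)) 𝒪.0∈
    ; +-closed  = λ {x} {y} p q → 𝒪.resp (L.sym (C₁.⊙-+ c x y)) (𝒪.+-closed p q)
    ; *ₗ-closed = λ r {x} p → 𝒪.resp (L.sym (C₁.⊙-f c r x)) (𝒪.*ₗ-closed r p)
    }) λ {x} {z} x∈ z∈ → 𝒪.resp (L.sym (C₁.⊙-*-fixed c x λ t → κ₁-F t (proj₁ z∈)))
         (integral-* (proj₂ (proj₂ c∈ x∈)) (proj₂ z∈))

  module M₁ = Submodules {R = 𝒪ᴷ} L[N₁]
  module M = Submodules {R = 𝒪ᴷ} L[N]
  module 𝔄₁ = M₁.IsSubmodule A₁.𝔄-isSubmodule

  𝔄₁-basis : M₁.Basis H₁.𝔄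
  𝔄₁-basis = M₁.FreeSubmodules.basis isPID (λ a≉0 e t → torsionFree a≉0 (e t))
    lattice A₁.𝔄-isSubmodule λ {c} c∈ → stable⇒∈lattice {c} (𝔄₁-stable c c∈)
    where
    open Lattices {T₁} fin₁ κ₁
      R₁.preimageOfε-cong R₁.preimageOfε-injective

  𝒪ᶠ-basis : Basis 𝒪ᶠ
  𝒪ᶠ-basis = basis 𝐰 A₂.𝒪ᴹ-isSubmodule (𝒪ᴸ⊆Span ∘ proj₂)

  ι-bijection : Inverse (×-setoid T₁ T₂) T
  ι-bijection = record
    { to = λ ((φ , φ∈) , (ψ , ψ∈)) → ι φ ψ , φ , ψ , φ∈ , ψ∈ , P.refl {ι φ ψ}
    ; from = λ (η , φ , ψ , φ∈ , ψ∈ , e) → (φ , φ∈) , (ψ , ψ∈)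
    ; to-cong = λ { {(φ , _) , (ψ , _)} {(φ′ , _) , (ψ′ , _)} (e , e′) → ι-cong {φ} {φ′} {ψ} {ψ′} e e′ }
    ; from-cong = λ { {η , φ , ψ , _ , _ , e} {θ , φ′ , ψ′ , _ , _ , e′} η≈θ →
        ι-injective φ ψ φ′ ψ′ (λ g → G.trans (G.sym (e g)) (G.trans (η≈θ g) (e′ g))) }
    ; inverse =
        (λ { {η , φ , ψ , _ , _ , e} {(φ′ , _) , (ψ′ , _)} (p , q) →
           P.trans {ι φ′ ψ′} {ι φ ψ} {η} (ι-cong {φ′} {φ} {ψ′} {ψ} p q) (P.sym {η} {ι φ ψ} e) })
      , (λ { {(φ , _) , (ψ , _)} {η , φ′ , ψ′ , _ , _ , e} p →
           ι-injective φ′ ψ′ φ ψ (P.trans {ι φ′ ψ′} {η} {ι φ ψ} (P.sym {η} {ι φ′ ψ′} e) p) })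
    }

  κ-ι : ∀ s t → R.preimageOfε (Inverse.to ι-bijection (s , t)) G.≈ κ₁ s G.∙ κ₂ t
  κ-ι (φ , _) (ψ , _) =
    let (p , q) = π-unique (Group.ε Jᴳ) (Group.ε G′ᴳ) (G.sym (G.identityˡ G.ε))
    in G.∙-cong (Inverse.from-cong φ p) (Inverse.from-cong ψ q)

  -- `κ` sends `ι(φ , ψ)` to the product of `κ₁` and `κ₂`. The second factor fixes `x` and keeps `z`
  -- in `F`, which the first factor fixes, so the double sum splits.
  ⊠-⊙ : ∀ a b {x z} → x ∈ E → z ∈ F → (a ⊠ b) C.⊙ (x L.* z) L.≈ (a C₁.⊙ x) L.* (b C₂.⊙ z)
  ⊠-⊙ a b {x} {z} x∈ z∈ = begin
    (a ⊠ b) C.⊙ (x L.* z)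
      ≈⟨ ∑-product {T₁} {T₂} {T} fin₁ fin₂ fin ι-bijection Φ (λ {s} {t} → Φ-cong {s} {t}) ⟩
    (∑ {T₁} fin₁ λ s → ∑ {T₂} fin₂ λ t → Φ (Inverse.to ι-bijection (s , t)))
      ≈⟨ ∑-cong {T₁} fin₁ (λ s → ∑-cong {T₂} fin₂ λ t →
           L.trans (L.*-congˡ {Func.to a s L.* Func.to b t} (act s t)) (interchange _ _ _ _)) ⟩
    (∑ {T₁} fin₁ λ s → ∑ {T₂} fin₂ λ t → Φ₁ s L.* Φ₂ t)
      ≈⟨ ∑-cong {T₁} fin₁ (λ s → *-distribˡ-sum (Φ₁ s) (Φ₂ ∘ Inverse.to (proj₂ fin₂))) ⟨
    (∑ {T₁} fin₁ λ s → Φ₁ s L.* (b C₂.⊙ z))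
      ≈⟨ *-distribʳ-sum (b C₂.⊙ z) (Φ₁ ∘ Inverse.to (proj₂ fin₁)) ⟨
    (a C₁.⊙ x) L.* (b C₂.⊙ z) ∎
    where
    open SemiringSum L.semiring using (*-distribˡ-sum; *-distribʳ-sum)
    Φ : T.Carrier → L.Carrier
    Φ t = Func.to (a ⊠ b) t L.* (R.preimageOfε t • (x L.* z))
    Φ-cong : ∀ {s t} → s T.≈ t → Φ s L.≈ Φ t
    Φ-cong {s} {t} e = L.*-cong (Func.cong (a ⊠ b) {s} {t} e) (•-congʳ (R.preimageOfε-cong s t e) (x L.* z))
    Φ₁ : T₁.Carrier → L.Carrier
    Φ₁ s = Func.to a s L.* (κ₁ s • x)
    Φ₂ : T₂.Carrier → L.Carrier
    Φ₂ t = Func.to b t L.* (κ₂ t • z)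
    act : ∀ s t → (R.preimageOfε (Inverse.to ι-bijection (s , t)) • (x L.* z)) L.≈ (κ₁ s • x) L.* (κ₂ t • z)
    act s t = begin
      (R.preimageOfε (Inverse.to ι-bijection (s , t)) • (x L.* z))
        ≈⟨ •-congʳ (κ-ι s t) (x L.* z) ⟩
      ((κ₁ s G.∙ κ₂ t) • (x L.* z))
        ≈⟨ •-∙ _ _ _ ⟩
      (κ₁ s • (κ₂ t • (x L.* z)))
        ≈⟨ •.⟦⟧-cong (κ₁ s) (L.trans (•.*-homo (κ₂ t) x z) (L.*-congʳ (κ₂-E t x∈))) ⟩
      (κ₁ s • (x L.* (κ₂ t • z)))
        ≈⟨ L.trans (•.*-homo (κ₁ s) x _) (L.*-congˡ (κ₁-F s (F-normal (κ₂ t) z∈))) ⟩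
      (κ₁ s • x) L.* (κ₂ t • z) ∎

  ⊠∈H : ∀ a b → a ∈ H₁.H → b ∈ H̄.H → a ⊠ b ∈ H.H
  ⊠∈H a b (_ , p) (b∈ , q) = _ , λ g (η , φ , ψ , φ∈ , ψ∈ , e) →
    L.trans (•.*-homo g _ _) (L.*-cong (p g (φ , φ∈)) (begin
      (g • Func.to b (ψ , ψ∈))
        ≈⟨ •-congʳ (factor-≈ g) _ ⟩
      ((proj₁ (πJ g) G.∙ proj₁ (πG′ g)) • Func.to b (ψ , ψ∈))
        ≈⟨ •-∙ _ _ _ ⟩
      (proj₁ (πJ g) • (proj₁ (πG′ g) • Func.to b (ψ , ψ∈)))
        ≈⟨ F-normal (proj₁ (πG′ g)) (b∈ (ψ , ψ∈)) (proj₂ (πJ g)) ⟩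
      (proj₁ (πG′ g) • Func.to b (ψ , ψ∈))
        ≈⟨ q (πG′ g) (ψ , ψ∈) ⟩
      Func.to b (H̄.conj (πG′ g) (ψ , ψ∈)) ∎))

  module Conj = Conjugation G (Perm G.setoid) lam (λ e _ → G.∙-congʳ e) (λ g h x → G.assoc g h x)
  module Conj′ = Conjugation G′ᴳ (Perm (Group.setoid G′ᴳ)) lam′
    (λ e _ → G.∙-congʳ e) (λ g h x → G.assoc _ _ _)

  -- The action of `G / J` written as an action of `G`, so that the averages for `N₁`, `N₂` and `N`
  -- all use sums over `G` and the same dual family.
  ▷₂ : G.Carrier → T₂.Carrier → T₂.Carrier
  ▷₂ = H̄.conj ∘ πG′

  module Av₁ = Averaging.Average S {T₁} H₁.conj
    (λ g h x y → Conj₁.▷-cong {g} {h} {proj₁ x} {proj₁ y}) (Conj₁.▷-ε ∘ proj₁)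
    (λ g h x → Conj₁.▷-∙ g h (proj₁ x))

  module Av₂ = Averaging.Average S {T₂} ▷₂
    (λ g h x y → Conj₂.▷-cong {g} {h} {proj₁ x} {proj₁ y}) (Conj₂.▷-ε ∘ proj₁)
    (λ g h x → Conj₂.▷-∙ g h (proj₁ x))

  module Av = Averaging.Average S {T} H.conj
    (λ g h x y → Conj.▷-cong {g} {h} {proj₁ x} {proj₁ y}) (Conj.▷-ε ∘ proj₁)
    (λ g h x → Conj.▷-∙ g h (proj₁ x))

  average₁∈ : ∀ y c → Av₁.average y c ∈ H₁.H
  average₁∈ y c = _ , Av₁.average-equivariant y c

  -- J acts trivially on N₂, so a G-equivariant function on N₂ has values in F.
  average₂∈ : ∀ y c → Av₂.average y c ∈ H̄.H
  average₂∈ y c =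
      (λ t {σ} σ∈ → L.trans (equivariant σ t) (Func.cong a {▷₂ σ t} {t}
        (Conj₂.▷-trivial {σ} (proj₁ t) λ x → G.trans (G.∙-congʳ (proj₂ (π-∈J σ∈))) (G.identityˡ _))))
    , (λ (τ , τ∈) t → L.trans (equivariant τ t) (Func.cong a {▷₂ τ t} {H̄.conj (τ , τ∈) t}
        (Conj′.▷-cong {πG′ τ} {τ , τ∈} {proj₁ t} {proj₁ t} (proj₂ (π-∈G′ τ∈)) (PG′.refl {proj₁ t}))))
    where
    a = Av₂.average y c
    equivariant = Av₂.average-equivariant y c

  -- The map from `𝔄₁ ⊗ 𝔄̄` to `L[N]` and the span of its image.

  module TF = TensorFold {R = 𝒪ᴷ} {L[N₁]} {L[N₂]} {H₁.𝔄} {H̄.𝔄}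
  module EF = TensorFold {R = 𝒪ᴷ} {L/R} {L/R} {𝒪ᴱ} {𝒪ᶠ}
  open TF.Fold L[N].+ᴹ-commutativeMonoid (λ a b → proj₁ a ⊠ proj₁ b) public
    renaming (fold to ext; fold-++ to ext-++; fold-closed to ext-closed; fold-cong to ext-cong′)
    using ()
  open EF.Fold L.+-commutativeMonoid (λ x z → proj₁ x L.* proj₁ z) public
    renaming (fold to mult; fold-sum to mult-sum) using ()

  infixr 7 _*ᵀ_
  _*ᵀ_ : 𝒪ᴷ.Carrier → 𝔄₁⊗𝔄̄.FormalSum → 𝔄₁⊗𝔄̄.FormalSum
  _*ᵀ_ = TF.scale A₁.𝔄-isSubmodule A₂.𝔄-isSubmodule

  ext-cong : ∀ {s t} → s 𝔄₁⊗𝔄̄.~ t → ext s L[N].≈ᴹ ext t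
  ext-cong = ext-cong′ record
    { φ-cong = λ e e′ (_ , φ , ψ , φ∈ , ψ∈ , _) → L.*-cong (e (φ , φ∈)) (e′ (ψ , ψ∈))
    ; φ-+ˡ   = λ e (_ , φ , ψ , φ∈ , ψ∈ , _) → L.trans (L.*-congʳ (e (φ , φ∈))) (L.distribʳ _ _ _)
    ; φ-+ʳ   = λ e (_ , φ , ψ , φ∈ , ψ∈ , _) → L.trans (L.*-congˡ (e (ψ , ψ∈))) (L.distribˡ _ _ _)
    ; φ-0ˡ   = λ e (_ , φ , ψ , φ∈ , ψ∈ , _) → L.trans (L.*-congʳ (e (φ , φ∈))) (L.zeroˡ _)
    ; φ-0ʳ   = λ e (_ , φ , ψ , φ∈ , ψ∈ , _) → L.trans (L.*-congˡ (e (ψ , ψ∈))) (L.zeroʳ _)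
    ; φ-bal  = λ r {a} {ra} {b} {rb} e e′ (_ , φ , ψ , φ∈ , ψ∈ , _) → begin
        Func.to (proj₁ ra) (φ , φ∈) L.* Func.to (proj₁ b) (ψ , ψ∈)
          ≈⟨ L.*-congʳ (e (φ , φ∈)) ⟩
        f r L.* Func.to (proj₁ a) (φ , φ∈) L.* Func.to (proj₁ b) (ψ , ψ∈)
          ≈⟨ L.trans (L.*-assoc _ _ _) (x∙yz≈y∙xz _ _ _) ⟩
        Func.to (proj₁ a) (φ , φ∈) L.* (f r L.* Func.to (proj₁ b) (ψ , ψ∈))
          ≈⟨ L.*-congˡ (e′ (ψ , ψ∈)) ⟨
        Func.to (proj₁ a) (φ , φ∈) L.* Func.to (proj₁ rb) (ψ , ψ∈) ∎
    }

  ext-* : ∀ r s → ext (r *ᵀ s) L[N].≈ᴹ r L[N].*ₗ ext s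
  ext-* r []            t = L.sym (L.zeroʳ _)
  ext-* r ((a , b) ∷ s) t@(_ , φ , ψ , φ∈ , ψ∈ , _) =
    L.trans (L.+-cong (x∙yz≈y∙xz _ _ _) (ext-* r s t)) (L.sym (L.distribˡ _ _ _))

  𝔄-isSubmodule : M.IsSubmodule H.𝔄
  𝔄-isSubmodule = record
    { resp      = λ {c} {c′} e (p , q) → HH.resp {c} {c′} e p , λ {x} x∈ →
        𝒪.resp (C.⊙-congʳ {c} {c′} x e) (q x∈)
    ; 0∈        = HH.0∈ , λ {x} x∈ → 𝒪.resp
        (L.sym (sum-zero {proj₁ fin} λ m → L.zeroˡ (R.preimageOfε (Inverse.to (proj₂ fin) m) • x))) 𝒪.0∈
    ; +-closed  = λ {c} {c′} (p , q) (p′ , q′) → HH.+-closed {c} {c′} p p′ , λ {x} x∈ →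
        𝒪.resp (L.sym (C.⊙-distribʳ {c} {c′} {c L[N].+ᴹ c′} x λ t → L.refl)) (𝒪.+-closed (q x∈) (q′ x∈))
    ; *ₗ-closed = λ a {c} (p , q) → HH.*ₗ-closed a {c} p , λ {x} x∈ →
        𝒪.resp (L.sym (C.⊙-scale {c} {a L[N].*ₗ c} (f a) x λ t → L.refl)) (𝒪.*ₗ-closed a (q x∈))
    }
    where module HH = M.IsSubmodule Eq.H-isSubmodule

  ⊠∈𝔄 : ∀ a b → a ∈ H₁.𝔄 → b ∈ H̄.𝔄 → a ⊠ b ∈ H.𝔄
  ⊠∈𝔄 a b (a∈H , a∈) (b∈H , b∈) = ⊠∈H a b a∈H b∈H , 𝒪ᴱ𝒪ᶠ⊆⇒𝒪ᴸ⊆ (record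
    { resp      = λ e → 𝒪.resp (C.⊙-congˡ (a ⊠ b) e)
    ; 0∈        = 𝒪.resp (L.sym (C.⊙-0 (a ⊠ b))) 𝒪.0∈
    ; +-closed  = λ {x} {y} p q → 𝒪.resp (L.sym (C.⊙-+ (a ⊠ b) x y)) (𝒪.+-closed p q)
    ; *ₗ-closed = λ r {x} p → 𝒪.resp (L.sym (C.⊙-f (a ⊠ b) r x)) (𝒪.*ₗ-closed r p)
    }) λ x∈ z∈ → 𝒪.resp (L.sym (⊠-⊙ a b (proj₁ x∈) (proj₁ z∈)))
         (integral-* (proj₂ (a∈ x∈)) (proj₂ (b∈ z∈)))

  ext∈𝔄 : ∀ s → ext s ∈ H.𝔄
  ext∈𝔄 = ext-closed H.𝔄 0∈ (λ {c} {c′} → +-closed {c} {c′})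
    λ a b → ⊠∈𝔄 (proj₁ a) (proj₁ b) (proj₂ a) (proj₂ b)
    where open M.IsSubmodule 𝔄-isSubmodule

  -- The `K`-span of the image of `ext`, expressed by nonzero multiples because elements of `K` are
  -- fractions over `𝒪ᴷ`.
  KSpan : Pred L[N].Carrierᴹ u
  KSpan h = ∃ λ a → ¬ a 𝒪ᴷ.≈ 𝒪ᴷ.0# × ∃ λ s → a L[N].*ₗ h L[N].≈ᴹ ext s

  private
    a≉0∧b≉0⇒ab≉0 : ∀ {a b} → ¬ a 𝒪ᴷ.≈ 𝒪ᴷ.0# → ¬ b 𝒪ᴷ.≈ 𝒪ᴷ.0# → ¬ a 𝒪ᴷ.* b 𝒪ᴷ.≈ 𝒪ᴷ.0#
    a≉0∧b≉0⇒ab≉0 a≉0 b≉0 e = [ a≉0 , b≉0 ]′ (PID.domain isPID e)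

  KSpan-isSubmodule : M.IsSubmodule KSpan
  KSpan-isSubmodule = record
    { resp      = λ {x} {y} e (a , a≉0 , s , p) → a , a≉0 , s , λ t →
        L.trans (L.*-congˡ (L.sym (e t))) (p t)
    ; 0∈        = 𝒪ᴷ.1# , PID.1≉0 isPID , [] , λ t → L.zeroʳ _
    ; +-closed  = λ {x} {y} (a , a≉0 , s , p) (b , b≉0 , s′ , q) →
        a 𝒪ᴷ.* b , a≉0∧b≉0⇒ab≉0 a≉0 b≉0 , (b *ᵀ s) ++ (a *ᵀ s′) , λ t → begin
          f (a 𝒪ᴷ.* b) L.* (Func.to x t L.+ Func.to y t)
            ≈⟨ L.trans (L.*-congʳ (f-* a b)) (L.distribˡ _ _ _) ⟩
          f a L.* f b L.* Func.to x t L.+ f a L.* f b L.* Func.to y t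
            ≈⟨ L.+-cong (L.trans (L.*-congʳ (L.*-comm _ _)) (L.*-assoc _ _ _)) (L.*-assoc _ _ _) ⟩
          f b L.* (f a L.* Func.to x t) L.+ f a L.* (f b L.* Func.to y t)
            ≈⟨ L.+-cong (L.*-congˡ (p t)) (L.*-congˡ (q t)) ⟩
          f b L.* Func.to (ext s) t L.+ f a L.* Func.to (ext s′) t
            ≈⟨ L.+-cong (ext-* b s t) (ext-* a s′ t) ⟨
          Func.to (ext (b *ᵀ s)) t L.+ Func.to (ext (a *ᵀ s′)) t
            ≈⟨ ext-++ (b *ᵀ s) (a *ᵀ s′) t ⟨
          Func.to (ext ((b *ᵀ s) ++ (a *ᵀ s′))) t ∎
    ; *ₗ-closed = λ r {x} (a , a≉0 , s , p) → a , a≉0 , r *ᵀ s , λ t →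
        L.trans (x∙yz≈y∙xz _ _ _) (L.trans (L.*-congˡ (p t)) (L.sym (ext-* r s t)))
    }

  KSpan-saturated : ∀ {a h} → ¬ a 𝒪ᴷ.≈ 𝒪ᴷ.0# → a L[N].*ₗ h ∈ KSpan → h ∈ KSpan
  KSpan-saturated {a} a≉0 (b , b≉0 , s , p) = b 𝒪ᴷ.* a , a≉0∧b≉0⇒ab≉0 b≉0 a≉0 , s , λ t →
    L.trans (L.*-congʳ (f-* b a)) (L.trans (L.*-assoc _ _ _) (p t))

  ⊠∈KSpan : ∀ a b → a ∈ H₁.H → b ∈ H̄.H → a ⊠ b ∈ KSpan
  ⊠∈KSpan a b a∈ b∈ =
    let (r , r≉0 , ra∈) = A₁.𝔄-multiple a a∈
        (s , s≉0 , sb∈) = A₂.𝔄-multiple b b∈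
    in r 𝒪ᴷ.* s , a≉0∧b≉0⇒ab≉0 r≉0 s≉0 , [ (r L[N₁].*ₗ a , ra∈) , (s L[N₂].*ₗ b , sb∈) ] , λ t →
         L.trans (L.*-congʳ (f-* r s)) (L.trans (interchange _ _ _ _) (L.sym (L.+-identityʳ _)))

  slice : Func T L.setoid → T₂.Carrier → Func T₁ L.setoid
  slice h t = record
    { to   = λ s → Func.to h (Inverse.to ι-bijection (s , t))
    ; cong = λ {s} {s′} e → Func.cong h {Inverse.to ι-bijection (s , t)} {Inverse.to ι-bijection (s′ , t)}
        (ι-cong {proj₁ s} {proj₁ s′} {proj₁ t} {proj₁ t} e (PG′.refl {proj₁ t})) }

  module Expand₂ = Lattices {T₂} fin₂ κ₂ R₂.preimageOfε-cong R₂.preimageOfε-injective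

  -- On the product `N₁ × N₂`, `h` is the sum of its slices at the points of `N₂` times indicator
  -- functions. Descent on `N₁` expands each slice, and descent on `N₂` expands the indicators.
  decomposition : ∀ h t → Func.to h t L.≈
    sum λ m → sum λ k → sum λ l → 𝐱 l L.*
      Func.to (Av₁.average (𝐲 k) (slice h (Inverse.to (proj₂ fin₂) m)) ⊠
               Av₂.average (𝐲 l) (Expand₂.δ m (𝐱 k))) t
  decomposition h t@(η , φ , ψ , φ∈ , ψ∈ , e) = begin
    Func.to h t
      ≈⟨ Func.cong h {t} {Inverse.to ι-bijection ((φ , φ∈) , (ψ , ψ∈))} e ⟩
    Func.to h (Inverse.to ι-bijection ((φ , φ∈) , (ψ , ψ∈)))
      ≈⟨ Expand₂.expand row (ψ , ψ∈) ⟨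
    sum (λ m → Func.to (Expand₂.δ m (Func.to (slice h (to m)) (φ , φ∈))) (ψ , ψ∈))
      ≈⟨ sum-cong-≋ {proj₁ fin₂} (λ m → begin
        Func.to (Expand₂.δ m (Func.to (slice h (to m)) (φ , φ∈))) (ψ , ψ∈)
          ≈⟨ L.*-congˡ (Av₁.average-dual (slice h (to m)) (φ , φ∈)) ⟩
        ind m L.* sum (λ k → 𝐱 k L.* c m k)
          ≈⟨ *-distribˡ-sum (ind m) (λ k → 𝐱 k L.* c m k) ⟩
        sum (λ k → ind m L.* (𝐱 k L.* c m k))
          ≈⟨ sum-cong-≋ {dim} (λ k → begin
            ind m L.* (𝐱 k L.* c m k)
              ≈⟨ L.trans (L.sym (L.*-assoc _ _ _)) (L.*-comm _ _) ⟩
            -- The scalar `𝐱 k` left by the first expansion becomes the value of `δ`, so the second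
            -- expansion absorbs it and a single scalar `𝐱 l` remains.
            c m k L.* Func.to (Expand₂.δ m (𝐱 k)) (ψ , ψ∈)
              ≈⟨ L.*-congˡ (Av₂.average-dual (Expand₂.δ m (𝐱 k)) (ψ , ψ∈)) ⟩
            c m k L.* sum (λ l → 𝐱 l L.* b m k l)
              ≈⟨ *-distribˡ-sum (c m k) (λ l → 𝐱 l L.* b m k l) ⟩
            sum (λ l → c m k L.* (𝐱 l L.* b m k l))
              ≈⟨ sum-cong-≋ {dim} (λ l → x∙yz≈y∙xz _ _ _) ⟩
            sum (λ l → 𝐱 l L.* (c m k L.* b m k l)) ∎) ⟩
        _ ∎) ⟩
    _ ∎
    where
    open SemiringSum L.semiring using (*-distribˡ-sum)
    to = Inverse.to (proj₂ fin₂)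
    row : Func T₂ L.setoid
    row = record
      { to   = λ t → Func.to h (Inverse.to ι-bijection ((φ , φ∈) , t))
      ; cong = λ {t} {t′} e → Func.cong h
          {Inverse.to ι-bijection ((φ , φ∈) , t)} {Inverse.to ι-bijection ((φ , φ∈) , t′)}
          (ι-cong {φ} {φ} {proj₁ t} {proj₁ t′} (λ _ → G.refl) e) }
    ind : Fin (proj₁ fin₂) → L.Carrier
    ind m = Expand₂.indicator m (Inverse.from (proj₂ fin₂) (ψ , ψ∈))
    c : Fin (proj₁ fin₂) → Fin dim → L.Carrier
    c m k = Func.to (Av₁.average (𝐲 k) (slice h (to m))) (φ , φ∈)
    b : Fin (proj₁ fin₂) → Fin dim → Fin dim → L.Carrier
    b m k l = Func.to (Av₂.average (𝐲 l) (Expand₂.δ m (𝐱 k))) (ψ , ψ∈)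

  -- Averaging turns an expression of h as an L-combination of equivariant
  -- functions a ⊠ b into a K-combination: z h becomes Tr(z) h, and
  -- z 𝐱ₗ (a ⊠ b) becomes Tr(z 𝐱ₗ) (a ⊠ b).
  H⊆KSpan : H.H ⊆ KSpan
  H⊆KSpan {h} h∈ = KSpan-saturated {a} {h} a≉0
    (KS.resp {Av.average z h} {a L[N].*ₗ h}
      (λ t → L.trans (Av.average-*-equivariant {h} {h} L.1# z (proj₂ h∈) (λ t → L.sym (L.*-identityˡ _)) t)
        (L.*-congʳ (L.trans (Tr-cong (L.*-identityˡ z)) Trz≈a)))
      (𝒮.resp {total} {h} (λ t → L.sym (L.trans (decomposition h t) (L.sym (total-value t))))
        (𝒮.∑-closed λ m → 𝒮.∑-closed λ k → 𝒮.∑-closed λ l → term∈ m k l)))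
    where
    form = Averaging.traceForm S
    z = proj₁ form
    a = proj₁ (proj₂ form)
    a≉0 = proj₁ (proj₂ (proj₂ form))
    Trz≈a = proj₁ (proj₂ (proj₂ (proj₂ form)))
    module KS = M.IsSubmodule KSpan-isSubmodule
    -- Averaging is linear over `𝒪ᴷ` but not over `L`, so the scalar `𝐱 l` is kept inside each
    -- `term` and treated by its trace.
    𝒮-isSubmodule : M.IsSubmodule (λ c → Av.average z c ∈ KSpan)
    𝒮-isSubmodule = record
      { resp      = λ {c} {c′} e → KS.resp {Av.average z c} {Av.average z c′} (Av.average-cong {c} {c′} z e)
      ; 0∈        = KS.resp {L[N].0ᴹ} {Av.average z L[N].0ᴹ}
          (λ t → L.sym (L.trans (Av.average-f {L[N].0ᴹ} {L[N].0ᴹ} 𝒪ᴷ.0# z (λ _ → L.sym (L.zeroʳ _)) t)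
            (L.trans (L.*-congʳ f-0) (L.zeroˡ _)))) KS.0∈
      ; +-closed  = λ {c} {c′} p q → KS.resp
          {Av.average z c L[N].+ᴹ Av.average z c′} {Av.average z (c L[N].+ᴹ c′)}
          (λ t → L.sym (Av.average-+ {c} {c′} {c L[N].+ᴹ c′} z (λ _ → L.refl) t))
          (KS.+-closed {Av.average z c} {Av.average z c′} p q)
      ; *ₗ-closed = λ r {c} p → KS.resp {r L[N].*ₗ Av.average z c} {Av.average z (r L[N].*ₗ c)}
          (λ t → L.sym (Av.average-f {c} {r L[N].*ₗ c} r z (λ _ → L.refl) t))
          (KS.*ₗ-closed r {Av.average z c} p)
      }
    module 𝒮 = M.IsSubmodule 𝒮-isSubmodule
    pure : Fin (proj₁ fin₂) → Fin dim → Fin dim → L[N].Carrierᴹ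
    pure m k l = Av₁.average (𝐲 k) (slice h (Inverse.to (proj₂ fin₂) m)) ⊠
                 Av₂.average (𝐲 l) (Expand₂.δ m (𝐱 k))
    term : Fin (proj₁ fin₂) → Fin dim → Fin dim → L[N].Carrierᴹ
    term m k l = record
      { to   = λ t → 𝐱 l L.* Func.to (pure m k l) t
      ; cong = λ {t} {t′} e → L.*-congˡ (Func.cong (pure m k l) {t} {t′} e) }
    total : L[N].Carrierᴹ
    total = M.sum λ m → M.sum λ k → M.sum λ l → term m k l
    total-value : ∀ t → Func.to total t L.≈ sum λ m → sum λ k → sum λ l → Func.to (term m k l) t
    total-value t = L.trans (pointwise-sum {T} (λ m → M.sum λ k → M.sum λ l → term m k l) t)
      (sum-cong-≋ {proj₁ fin₂} λ m → L.trans (pointwise-sum {T} (λ k → M.sum λ l → term m k l) t)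
        (sum-cong-≋ {dim} λ k → pointwise-sum {T} (λ l → term m k l) t))
    term∈ : ∀ m k l → Av.average z (term m k l) ∈ KSpan
    term∈ m k l =
      let (r , e) = proj₂ (proj₂ (proj₂ (proj₂ form))) l
          c       = slice h (Inverse.to (proj₂ fin₂) m)
          a₁      = Av₁.average (𝐲 k) c
          a₂      = Av₂.average (𝐲 l) (Expand₂.δ m (𝐱 k))
          a₁∈     = average₁∈ (𝐲 k) c
          a₂∈     = average₂∈ (𝐲 l) (Expand₂.δ m (𝐱 k))
      in KS.resp {r L[N].*ₗ pure m k l} {Av.average z (term m k l)}
           (λ t → L.sym (L.trans
             (Av.average-*-equivariant {term m k l} {pure m k l} (𝐱 l) z
               (proj₂ (⊠∈H a₁ a₂ a₁∈ a₂∈)) (λ _ → L.refl) t)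
             (L.*-congʳ e)))
           (KS.*ₗ-closed r {pure m k l} (⊠∈KSpan a₁ a₂ a₁∈ a₂∈))

  -- Divisibility in `𝔄₁ ⊗ 𝔄̄` and bijectivity of `ext`.

  module TFᵀ = CommutativeMonoid TF.commutativeMonoid

  scaleEF : 𝒪ᴷ.Carrier → 𝒪ᴱ⊗𝒪ᶠ.FormalSum → 𝒪ᴱ⊗𝒪ᶠ.FormalSum
  scaleEF = EF.scale A₁.𝒪ᴹ-isSubmodule A₂.𝒪ᴹ-isSubmodule

  mult-scale : ∀ r t → mult (scaleEF r t) L.≈ f r L.* mult t
  mult-scale r []            = L.sym (L.zeroʳ _)
  mult-scale r ((x , z) ∷ t) = L.trans (L.+-cong (x∙yz≈y∙xz _ _ _) (mult-scale r t)) (L.sym (L.distribˡ _ _ _))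

  -- The action of `s` on `x ⊗ z` before multiplication in `L`, kept as a formal sum so that
  -- relations in `𝒪ᴱ ⊗ 𝒪ᶠ` can be applied to it.
  actEF : 𝔄₁⊗𝔄̄.FormalSum → ∃ 𝒪ᴱ → ∃ 𝒪ᶠ → 𝒪ᴱ⊗𝒪ᶠ.FormalSum
  actEF s (x , x∈) (z , z∈) = map
    (λ ((a , a∈) , (b , b∈)) → (a C₁.⊙ x , proj₂ a∈ x∈) , (b C₂.⊙ z , proj₂ b∈ z∈)) s

  ext-⊙ : ∀ s x z → ext s C.⊙ (proj₁ x L.* proj₁ z) L.≈ mult (actEF s x z)
  ext-⊙ [] x z = sum-zero {proj₁ fin} λ m → L.zeroˡ (R.preimageOfε (Inverse.to (proj₂ fin) m) • _)
  ext-⊙ ((a , b) ∷ s) x z = L.trans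
    (C.⊙-distribʳ {proj₁ a ⊠ proj₁ b} {ext s} {ext ((a , b) ∷ s)} (proj₁ x L.* proj₁ z) λ t → L.refl)
    (L.+-cong (⊠-⊙ (proj₁ a) (proj₁ b) (proj₁ (proj₂ x)) (proj₁ (proj₂ z))) (ext-⊙ s x z))

  module Zb = Coordinates {R = 𝒪ᴷ} {L/R} {𝒪ᶠ} 𝒪ᶠ-basis
  module Z = Basis 𝒪ᶠ-basis
  module Ab = Coordinates {R = 𝒪ᴷ} {L[N₁]} {H₁.𝔄} 𝔄₁-basis
  module A = M₁.Basis 𝔄₁-basis

  -- id ⊗ (l-th coordinate) : 𝒪ᴱ ⊗ 𝒪ᶠ → 𝒪ᴱ
  module Slice (l : Fin Z.rank) where

    open EF.Fold L.+-commutativeMonoid (λ x z → f (Zb.coord z l) L.* proj₁ x) public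
      renaming (fold to slice-at) using (IsBalanced; fold-cong; fold-sum; fold-closed)

    balanced : IsBalanced
    balanced = record
      { φ-cong = λ {_} {_} {z} {z′} e e′ → L.*-cong (f-cong (Zb.coord-cong z z′ e′ l)) e
      ; φ-+ˡ   = λ e → L.trans (L.*-congˡ e) (L.distribˡ _ _ _)
      ; φ-+ʳ   = λ {_} {z₁} {z₂} {z} e → L.trans
          (L.*-congʳ (L.trans (f-cong (Zb.coord-+ z₁ z₂ z e l)) (f-+ _ _))) (L.distribʳ _ _ _)
      ; φ-0ˡ   = λ e → L.trans (L.*-congˡ e) (L.zeroʳ _)
      ; φ-0ʳ   = λ {_} {z} e → L.trans
          (L.*-congʳ (L.trans (f-cong (Zb.coord-0 z e l)) f-0)) (L.zeroˡ _)
      ; φ-bal  = λ r {x} {rx} {z} {rz} e e′ → begin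
          f (Zb.coord z l) L.* proj₁ rx                 ≈⟨ L.*-congˡ e ⟩
          f (Zb.coord z l) L.* (f r L.* proj₁ x)        ≈⟨ L.*-assoc _ _ _ ⟨
          f (Zb.coord z l) L.* f r L.* proj₁ x
            ≈⟨ L.*-congʳ (L.trans (L.*-comm _ _) (L.sym (f-* r _))) ⟩
          f (r 𝒪ᴷ.* Zb.coord z l) L.* proj₁ x           ≈⟨ L.*-congʳ (f-cong (Zb.coord-* r z rz e′ l)) ⟨
          f (Zb.coord rz l) L.* proj₁ x                 ∎
      }

    slice-scale : ∀ r t → slice-at (scaleEF r t) L.≈ f r L.* slice-at t
    slice-scale r []            = L.sym (L.zeroʳ _)
    slice-scale r ((x , z) ∷ t) = L.trans (L.+-cong
      (L.trans (L.*-congʳ (L.trans (f-cong (Zb.coord-* r z _ L.refl l)) (f-* r _))) (L.*-assoc _ _ _))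
      (slice-scale r t)) (L.sym (L.distribˡ _ _ _))

    slice∈ : ∀ t → slice-at t ∈ 𝒪ᴱ
    slice∈ = fold-closed 𝒪ᴱ 0∈ +-closed λ x z → *ₗ-closed (Zb.coord z l) (proj₂ x)
      where open IsSubmodule A₁.𝒪ᴹ-isSubmodule

  lin-⊙ : ∀ {n} r (v : Vector (Func T₁ L.setoid) n) x →
          M₁.lin r v C₁.⊙ x L.≈ sum λ m → f (r m) L.* (v m C₁.⊙ x)
  lin-⊙ {zero}  r v x = A₁.⊙-zeroˡ {M₁.lin r v} x λ _ → L.refl
  lin-⊙ {suc n} r v x = L.trans
    (C₁.⊙-distribʳ {r zero L[N₁].*ₗ v zero} {M₁.lin (tail r) (tail v)} {M₁.lin r v} x λ _ → L.refl)
    (L.+-cong (C₁.⊙-scale {v zero} {r zero L[N₁].*ₗ v zero} (f (r zero)) x λ _ → L.refl)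
              (lin-⊙ (tail r) (tail v) x))

  -- Writing s = Σ aᵢ ⊗ bᵢ over a basis of 𝔄₁ and slicing with a coordinate
  -- of 𝒪ᶠ, divisibility of s on 𝒪ᴸ becomes divisibility of elements of 𝔄₁ on 𝒪ᴱ,
  -- that is of their coordinates; these are the coordinates of the values of bᵢ.
  module _ (s : 𝔄₁⊗𝔄̄.FormalSum) (r : 𝒪ᴷ.Carrier)
    (divides : ∀ {x} → x ∈ 𝒪ᴸ → ∃ λ y → y ∈ 𝒪ᴸ × ext s C.⊙ x L.≈ f r L.* y) where

    private
      v : Vector (∃ H₁.𝔄) A.rank
      v m = A.vector m , A.vector∈ m

      nf = TF.normalForm A₁.𝔄-isSubmodule A₂.𝔄-isSubmodule v (λ {a} → A.span {a}) s
      β = proj₁ nf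

      sumᵀ = Sum.sum TF.commutativeMonoid
      sumᴱ = Sum.sum EF.commutativeMonoid

      value : ∀ (z : ∃ 𝒪ᶠ) m → ∃ 𝒪ᶠ
      value (z , z∈) m = proj₁ (β m) C₂.⊙ z , proj₂ (proj₂ (β m)) z∈

      image : ∀ (x : ∃ 𝒪ᴱ) → Fin A.rank → ∃ 𝒪ᴱ
      image (x , x∈) m = A.vector m C₁.⊙ x , proj₂ (A.vector∈ m) x∈

      t₀ : ∃ 𝒪ᴱ → ∃ 𝒪ᶠ → 𝒪ᴱ⊗𝒪ᶠ.FormalSum
      t₀ x z = sumᴱ λ m → [ image x m , value z m ]

      actEF-sum : ∀ {n} (w : Vector 𝔄₁⊗𝔄̄.FormalSum n) x z →
                  mult (actEF (sumᵀ w) x z) L.≈ sum λ m → mult (actEF (w m) x z)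
      actEF-sum {zero}  w x z = L.refl
      actEF-sum {suc n} w x z = L.trans (actEF-++ (w zero) (sumᵀ (tail w)))
        (L.+-congˡ (actEF-sum (tail w) x z))
        where
        actEF-++ : ∀ s t → mult (actEF (s ++ t) x z) L.≈ mult (actEF s x z) L.+ mult (actEF t x z)
        actEF-++ []      t = L.sym (L.+-identityˡ _)
        actEF-++ (_ ∷ s) t = L.trans (L.+-congˡ (actEF-++ s t)) (L.sym (L.+-assoc _ _ _))

      mult-t₀ : ∀ x z → mult (t₀ x z) L.≈ ext s C.⊙ (proj₁ x L.* proj₁ z)
      mult-t₀ x z = begin
        mult (t₀ x z)
          ≈⟨ mult-sum (λ m → [ image x m , value z m ]) ⟩
        sum (λ m → mult [ image x m , value z m ])
          ≈⟨ actEF-sum (λ m → [ v m , β m ]) x z ⟨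
        mult (actEF (sumᵀ λ m → [ v m , β m ]) x z)
          ≈⟨ ext-⊙ (sumᵀ λ m → [ v m , β m ]) x z ⟨
        ext (sumᵀ λ m → [ v m , β m ]) C.⊙ (proj₁ x L.* proj₁ z)
          ≈⟨ C.⊙-congʳ {ext s} {ext (sumᵀ λ m → [ v m , β m ])} _ (ext-cong (proj₂ nf)) ⟨
        ext s C.⊙ (proj₁ x L.* proj₁ z) ∎

      -- Surjectivity of `𝒪ᴱ ⊗ 𝒪ᶠ → 𝒪ᴸ` writes the quotient as a tensor; injectivity turns the
      -- equation in `L` into a relation of tensors, which the slices respect.
      t₀-divisible : ∀ x z → ∃ λ t → t₀ x z 𝒪ᴱ⊗𝒪ᶠ.~ scaleEF r t
      t₀-divisible x z =
        let (y , y∈ , e)   = divides (integral-* (proj₂ (proj₂ x)) (proj₂ (proj₂ z)))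
            (t , _ , e′)   = proj₂ (proj₂ (proj₂ disjoint)) y∈
        in t , proj₁ (proj₂ (proj₂ disjoint)) _ _ (begin
             mult (t₀ x z)                             ≈⟨ mult-t₀ x z ⟩
             ext s C.⊙ (proj₁ x L.* proj₁ z)           ≈⟨ e ⟩
             f r L.* y                                 ≈⟨ L.*-congˡ e′ ⟨
             f r L.* mult t                            ≈⟨ mult-scale r t ⟨
             mult (scaleEF r t)                        ∎)

      coords : ∃ 𝒪ᶠ → Fin Z.rank → Vector 𝒪ᴷ.Carrier A.rank
      coords z l m = Zb.coord (value z m) l

      combination : ∃ 𝒪ᶠ → Fin Z.rank → Func T₁ L.setoid
      combination z l = M₁.lin (coords z l) A.vector

      -- A slice turns the second factors of `t₀` into scalars, and their combination with the
      -- `A.vector m C₁.⊙ x` is the value at `x` of one element of `𝔄₁`.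
      combination-divisible : ∀ z l {x} → x ∈ 𝒪ᴱ →
        ∃ λ y → y ∈ 𝒪ᴱ × combination z l C₁.⊙ x L.≈ f r L.* y
      combination-divisible z l {x} x∈ =
        let (t , t₀~rt) = t₀-divisible (x , x∈) z
        in slice-at t , slice∈ t , (begin
             combination z l C₁.⊙ x
               ≈⟨ lin-⊙ (coords z l) A.vector x ⟩
             sum (λ m → f (coords z l m) L.* (A.vector m C₁.⊙ x))
               ≈⟨ sum-cong-≋ {A.rank} (λ m → L.+-identityʳ _) ⟨
             sum (λ m → slice-at [ image (x , x∈) m , value z m ])
               ≈⟨ fold-sum (λ m → [ image (x , x∈) m , value z m ]) ⟨
             slice-at (t₀ (x , x∈) z)
               ≈⟨ fold-cong balanced t₀~rt ⟩
             slice-at (scaleEF r t)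
               ≈⟨ slice-scale r t ⟩
             f r L.* slice-at t ∎)
        where open Slice l

      coords-divisible : ∀ z l m → ∃ λ q → coords z l m 𝒪ᴷ.≈ r 𝒪ᴷ.* q
      coords-divisible z l m =
        let (c , c∈ , e) = A₁.divide r (combination z l)
              (𝔄₁.∑-closed {A.rank} {λ m → coords z l m L[N₁].*ₗ A.vector m}
                λ m → 𝔄₁.*ₗ-closed (coords z l m) {A.vector m} (A.vector∈ m))
              (combination-divisible z l)
            q = Ab.coord (c , c∈)
        in q m , Ab.lin-injective (coords z l) (λ m → r 𝒪ᴷ.* q m)
             (λ t → L.trans (e t) (L.trans (L.*-congˡ (Ab.coord-lin (c , c∈) t))
               (M₁.*ₗ-lin r q A.vector t))) m

      β-divisible : ∀ m → ∃ λ b → b ∈ H̄.𝔄 × proj₁ (β m) L[N₂].≈ᴹ r L[N₂].*ₗ b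
      β-divisible m = A₂.divide r (proj₁ (β m)) (proj₂ (β m)) λ {z} z∈ →
        let q = λ l → proj₁ (coords-divisible (z , z∈) l m)
        in lin q Z.vector
         , 𝒪ᶠ.∑-closed {Z.rank} (λ l → 𝒪ᶠ.*ₗ-closed (q l) (Z.vector∈ l))
         , (begin
             proj₁ (β m) C₂.⊙ z
               ≈⟨ Zb.coord-lin (value (z , z∈) m) ⟩
             lin (Zb.coord (value (z , z∈) m)) Z.vector
               ≈⟨ sum-cong-≋ {Z.rank} (λ l → L.*-congʳ (f-cong (proj₂ (coords-divisible (z , z∈) l m)))) ⟩
             lin (λ l → r 𝒪ᴷ.* q l) Z.vector
               ≈⟨ *ₗ-lin r q Z.vector ⟨
             f r L.* lin q Z.vector ∎)
        where module 𝒪ᶠ = IsSubmodule A₂.𝒪ᴹ-isSubmodule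

    divisible : ∃ λ s′ → s 𝔄₁⊗𝔄̄.~ r *ᵀ s′
    divisible = sumᵀ (λ m → [ v m , quotient m ]) ,
      TFᵀ.trans {s} (proj₂ nf) (TFᵀ.trans {sumᵀ λ m → [ v m , β m ]}
        (Sum.sum-cong-≋ TF.commutativeMonoid {A.rank} λ m →
          𝔄₁⊗𝔄̄.cong {v m} {v m} {β m} {r *ᴮ quotient m} (λ _ → L.refl) (proj₂ (proj₂ (β-divisible m))))
        (TFᵀ.sym {r *ᵀ sumᵀ λ m → [ v m , quotient m ]}
          (TF.scale-sum A₁.𝔄-isSubmodule A₂.𝔄-isSubmodule r (λ m → [ v m , quotient m ]))))
      where
      quotient : ∀ m → ∃ H̄.𝔄
      quotient m = proj₁ (β-divisible m) , proj₁ (proj₂ (β-divisible m))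
      _*ᴮ_ = TF._*ᴮ_ A₁.𝔄-isSubmodule A₂.𝔄-isSubmodule

  negateᵀ : 𝔄₁⊗𝔄̄.FormalSum → 𝔄₁⊗𝔄̄.FormalSum
  negateᵀ = TF.negate A₁.𝔄-isSubmodule A₂.𝔄-isSubmodule

  ext-injective : ∀ s t → ext s L[N].≈ᴹ ext t → s 𝔄₁⊗𝔄̄.~ t
  ext-injective s t e = TF.++-negate⇒~ A₁.𝔄-isSubmodule A₂.𝔄-isSubmodule s t
    -- At `r = 0` the divisibility hypothesis says that the difference acts as zero, and its
    -- conclusion that the difference is a zero multiple, hence equivalent to the empty sum.
    (let (s′ , p) = divisible (s ++ negateᵀ t) 𝒪ᴷ.0# λ {x} x∈ → L.0# , 𝒪.0∈ , L.trans
           (L.trans (C.⊙-congʳ {ext (s ++ negateᵀ t)} {L[N].0ᴹ} x vanishes)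
             (sum-zero {proj₁ fin} λ m → L.zeroˡ (R.preimageOfε (Inverse.to (proj₂ fin) m) • x)))
           (L.sym (L.zeroʳ _))
     in 𝔄₁⊗𝔄̄.trans p (TF.scale-0 A₁.𝔄-isSubmodule A₂.𝔄-isSubmodule s′))
    where
    vanishes : ext (s ++ negateᵀ t) L[N].≈ᴹ L[N].0ᴹ
    vanishes η = begin
      Func.to (ext (s ++ negateᵀ t)) η                     ≈⟨ ext-++ s (negateᵀ t) η ⟩
      Func.to (ext s) η L.+ Func.to (ext (negateᵀ t)) η    ≈⟨ L.+-congʳ (e η) ⟩
      Func.to (ext t) η L.+ Func.to (ext (negateᵀ t)) η    ≈⟨ ext-++ t (negateᵀ t) η ⟨
      Func.to (ext (t ++ negateᵀ t)) η
        ≈⟨ ext-cong (𝔄₁⊗𝔄̄.trans (𝔄₁⊗𝔄̄.++-comm t (negateᵀ t))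
             (TF.negate-inverseˡ A₁.𝔄-isSubmodule A₂.𝔄-isSubmodule t)) η ⟩
      L.0#                                                 ∎

  ext-surjective : ∀ h → h ∈ H.𝔄 → ∃ λ s → ext s L[N].≈ᴹ h
  ext-surjective h (h∈ , stable) = clear (H⊆KSpan {h} h∈)
    where
    divide : ∀ {a} → ¬ a 𝒪ᴷ.≈ 𝒪ᴷ.0# → ∀ s → a L[N].*ₗ h L[N].≈ᴹ ext s →
             (∃ λ s′ → s 𝔄₁⊗𝔄̄.~ a *ᵀ s′) → ∃ λ s → ext s L[N].≈ᴹ h
    divide {a} a≉0 s e (s′ , p) = s′ , λ t → *-cancelˡ (f-nonzero a≉0) (begin
      f a L.* Func.to (ext s′) t      ≈⟨ ext-* a s′ t ⟨
      Func.to (ext (a *ᵀ s′)) t       ≈⟨ ext-cong p t ⟨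
      Func.to (ext s) t               ≈⟨ e t ⟨
      f a L.* Func.to h t             ∎)
    clear : h ∈ KSpan → ∃ λ s → ext s L[N].≈ᴹ h
    -- `ext s` sends `x` to `a` times `h C.⊙ x`, and stability of `h` makes this quotient integral.
    clear (a , a≉0 , s , e) = divide a≉0 s e (divisible s a λ {x} x∈ →
      h C.⊙ x , stable x∈ , C.⊙-scale {h} {ext s} (f a) x (λ t → L.sym (e t)))

  ext-bijective : BijectiveOn 𝔄₁⊗𝔄̄.tensor H.L[N] U H.𝔄 𝔄₁⊗𝔄̄→L[N]
  ext-bijective = (λ {s} _ → ext∈𝔄 s) , (λ {s} {t} _ _ → ext-injective s t)
    , λ {h} h∈ → let (s , e) = ext-surjective h h∈ in s , _ , e

  -- The product of two free generators.

  module _ {γ δ : L.Carrier} (γ-gen : γ ∈ H₁.IsFreeGenerator) (δ-gen : δ ∈ H̄.IsFreeGenerator) where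

    private
      module L₁ = A₁.Lift {γ} (proj₂ γ-gen)
      module L₂ = A₂.Lift {δ} (proj₂ δ-gen)
      γᴱ : ∃ 𝒪ᴱ
      γᴱ = γ , proj₁ γ-gen
      δᶠ : ∃ 𝒪ᶠ
      δᶠ = δ , proj₁ δ-gen
    open EF.Fold TF.commutativeMonoid (λ x z → [ L₁.lift x , L₂.lift z ])
      renaming (fold to liftEF; fold-cong to liftEF-cong′) using ()

    -- Linearity of both lifts makes `x ⊗ z ↦ lift x ⊗ lift z` well defined on tensors; it inverts
    -- the action on `γ ⊗ δ`.
    liftEF-cong : ∀ {s t} → s 𝒪ᴱ⊗𝒪ᶠ.~ t → liftEF s 𝔄₁⊗𝔄̄.~ liftEF t
    liftEF-cong = liftEF-cong′ record
      { φ-cong = λ {x} {x′} {z} {z′} e e′ → 𝔄₁⊗𝔄̄.cong (L₁.lift-cong x x′ e) (L₂.lift-cong z z′ e′)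
      ; φ-+ˡ   = λ {x₁} {x₂} {x} e → 𝔄₁⊗𝔄̄.+ˡ (L₁.lift-+ x₁ x₂ x e)
      ; φ-+ʳ   = λ {_} {z₁} {z₂} {z} e → 𝔄₁⊗𝔄̄.+ʳ (L₂.lift-+ z₁ z₂ z e)
      ; φ-0ˡ   = λ {x} e → 𝔄₁⊗𝔄̄.0ˡ (L₁.lift-0 x e)
      ; φ-0ʳ   = λ {_} {z} e → 𝔄₁⊗𝔄̄.0ʳ (L₂.lift-0 z e)
      ; φ-bal  = λ r {x} {rx} {z} {rz} e e′ → 𝔄₁⊗𝔄̄.balance r (L₁.lift-* r x rx e) (L₂.lift-* r z rz e′)
      }

    liftEF-actEF : ∀ s → liftEF (actEF s γᴱ δᶠ) 𝔄₁⊗𝔄̄.~ s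
    liftEF-actEF []            = 𝔄₁⊗𝔄̄.refl
    liftEF-actEF ((a , b) ∷ s) = 𝔄₁⊗𝔄̄.++-cong
      {[ L₁.lift (_ , proj₂ (proj₂ a) (proj₂ γᴱ)) , L₂.lift (_ , proj₂ (proj₂ b) (proj₂ δᶠ)) ]} {[ a , b ]}
      (𝔄₁⊗𝔄̄.cong (L₁.lift-unique (_ , proj₂ (proj₂ a) (proj₂ γᴱ)) {proj₁ a} (proj₂ a) L.refl)
                 (L₂.lift-unique (_ , proj₂ (proj₂ b) (proj₂ δᶠ)) {proj₁ b} (proj₂ b) L.refl))
      (liftEF-actEF s)

    mult-actEF-liftEF : ∀ t → mult (actEF (liftEF t) γᴱ δᶠ) L.≈ mult t
    mult-actEF-liftEF []            = L.refl
    mult-actEF-liftEF ((x , z) ∷ t) =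
      L.+-cong (L.*-cong (L₁.lift-⊙ x) (L₂.lift-⊙ z)) (mult-actEF-liftEF t)

    γδ∈ : γ L.* δ ∈ 𝒪ᴸ
    γδ∈ = integral-* (proj₂ (proj₁ γ-gen)) (proj₂ (proj₁ δ-gen))

    -- Injectivity of `𝒪ᴱ ⊗ 𝒪ᶠ → 𝒪ᴸ` identifies the two tensors acted on, and `liftEF` recovers `s`
    -- and `s′` from them.
    actEF-injective : ∀ s s′ → mult (actEF s γᴱ δᶠ) L.≈ mult (actEF s′ γᴱ δᶠ) → s 𝔄₁⊗𝔄̄.~ s′
    actEF-injective s s′ e = 𝔄₁⊗𝔄̄.trans (𝔄₁⊗𝔄̄.sym (liftEF-actEF s))
      (𝔄₁⊗𝔄̄.trans (liftEF-cong {actEF s γᴱ δᶠ} {actEF s′ γᴱ δᶠ} (proj₁ (proj₂ (proj₂ disjoint)) _ _ e))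
        (liftEF-actEF s′))

    -- Surjectivity of `ext` represents both operators by tensors, reducing the claim to
    -- `actEF-injective`.
    γδ-injective : ∀ {h h′} → h ∈ H.𝔄 → h′ ∈ H.𝔄 →
                   h H.· (γ L.* δ) L.≈ h′ H.· (γ L.* δ) → h L[N].≈ᴹ h′
    γδ-injective {h} {h′} h∈ h′∈ e = compare (ext-surjective h h∈) (ext-surjective h′ h′∈)
      where
      compare : (∃ λ s → ext s L[N].≈ᴹ h) → (∃ λ s → ext s L[N].≈ᴹ h′) → h L[N].≈ᴹ h′
      compare (s , p) (s′ , q) t = L.trans (L.sym (p t)) (L.trans (ext-cong (actEF-injective s s′ (begin
        mult (actEF s γᴱ δᶠ)             ≈⟨ ext-⊙ s γᴱ δᶠ ⟨
        ext s C.⊙ (γ L.* δ)              ≈⟨ C.⊙-congʳ {ext s} {h} _ p ⟩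
        h C.⊙ (γ L.* δ)                  ≈⟨ e ⟩
        h′ C.⊙ (γ L.* δ)                 ≈⟨ C.⊙-congʳ {ext s′} {h′} _ q ⟨
        ext s′ C.⊙ (γ L.* δ)             ≈⟨ ext-⊙ s′ γᴱ δᶠ ⟩
        mult (actEF s′ γᴱ δᶠ)            ∎)) t) (q t))

    γδ-surjective : ∀ {y} → y ∈ 𝒪ᴸ → ∃ λ h → h ∈ H.𝔄 × h H.· (γ L.* δ) L.≈ y
    γδ-surjective {y} y∈ =
      let (t , _ , e) = proj₂ (proj₂ (proj₂ disjoint)) y∈
      in ext (liftEF t) , ext∈𝔄 (liftEF t) ,
         L.trans (ext-⊙ (liftEF t) γᴱ δᶠ) (L.trans (mult-actEF-liftEF t) e)

    γδ-isFreeGenerator : γ L.* δ ∈ H.IsFreeGenerator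
    γδ-isFreeGenerator = γδ∈ , (λ {h} h∈ → proj₂ h∈ γδ∈)
      , (λ {h} {h′} → γδ-injective {h} {h′}) , γδ-surjective

theorem1p5 : ∀ {u : Level} (S : SemidirectGaloisExtension u) (I : InducedHopfGaloisStructure S) →
    let open SemidirectGaloisExtension S
        open InducedHopfGaloisStructure I
    in
    ArithmeticallyDisjoint →
    BijectiveOn 𝔄₁⊗𝔄̄.tensor H.L[N] U H.𝔄 𝔄₁⊗𝔄̄→L[N]
    × (H₁.IsFree → H̄.IsFree → H.IsFree)
    × (∀ γ δ → γ ∈ H₁.IsFreeGenerator → δ ∈ H̄.IsFreeGenerator →
         (γ L.* δ) ∈ H.IsFreeGenerator)
theorem1p5 S I disjoint =
    ext-bijective
  , (λ (_ , γ-gen) (_ , δ-gen) → _ , γδ-isFreeGenerator γ-gen δ-gen)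
  , λ _ _ → γδ-isFreeGenerator
  where open Induced I disjoint
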